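{- Let $G$ be a (simple) graph with maximum degree $\Delta\leq 3$. Then all $(\Delta+1)$-edge-colourings of $G$ are Kempe equivalent.
   Context: A $k$-edge-colouring of a graph $G$ is an assignment of colours from $\{1,\ldots,k\}$ to the edges of $G$ such that adjacent edges (edges sharing an endpoint) receive different colours. Given a $k$-edge-colouring and two colours $a,b$, the edges coloured $a$ or $b$ form a subgraph whose components are paths and cycles alternating in $a$ and $b$; a Kempe change is the operation of interchanging $a$ and $b$ on one such connected component, which yields another $k$-edge-colouring. Two $k$-edge-colourings are Kempe equivalent if one can be obtained from the other by a sequence of Kempe changes; colourings differing only by a permutation of the colours are regarded as the same colouring. -}

module Defs where

open import Data.Nat using (ℕ; suc; _⊔_)
open import Data.Fin using (Fin)
open import Data.Fin.Permutation using (Permutation′; _⟨$⟩ʳ_)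
open import Data.Bool using (Bool; true; false; T; if_then_else_)
open import Data.List using (List; map; foldr; allFin)
open import Data.Nat.ListAction using (sum)
open import Data.Product using (Σ; ∃; _×_; _,_)
open import Data.Sum using (_⊎_)
open import Relation.Nullary using (¬_)
open import Relation.Binary.PropositionalEquality using (_≡_; _≢_)
open import Relation.Binary.Construct.Closure.ReflexiveTransitive using (Star)

record Graph : Set where
  field
    n      : ℕ
    adj    : Fin n → Fin n → Bool
    symm   : ∀ u v → adj u v ≡ adj v u
    irrefl : ∀ u → adj u u ≡ false

module _ (G : Graph) where
  open Graph G

  Adj : Fin n → Fin n → Set
  Adj u v = T (adj u v)

  adj-sym : ∀ {u v} → Adj u v → Adj v u
  adj-sym {u} {v} e with adj u v | adj v u | symm u v
  ... | true | true | _ = e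

  degree : Fin n → ℕ
  degree u = sum (map (λ v → if adj u v then 1 else 0) (allFin n))

  maxDegree : ℕ
  maxDegree = foldr _⊔_ 0 (map degree (allFin n))

  record EdgeColouring (k : ℕ) : Set where
    field
      col    : (u v : Fin n) → Adj u v → Fin k
      col-sym : ∀ u v (e : Adj u v) → col v u (adj-sym e) ≡ col u v e
      proper : ∀ u v w (e : Adj u v) (f : Adj u w) → v ≢ w →
               col u v e ≢ col u w f
  open EdgeColouring public

  module _ {k : ℕ} where

    IsAB : EdgeColouring k → Fin k → Fin k → (u v : Fin n) → Adj u v → Set
    IsAB c a b u v e = col c u v e ≡ a ⊎ col c u v e ≡ b

    data Reach (c : EdgeColouring k) (a b : Fin k) (x : Fin n) : Fin n → Set where
      here : Reach c a b x x
      step : ∀ {u v} → Reach c a b x u → (e : Adj u v) → IsAB c a b u v e →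
             Reach c a b x v

    swap : Fin k → Fin k → Fin k → Fin k
    swap a b i with i Data.Fin.≟ a
    ... | Relation.Nullary.yes _ = b
    ... | Relation.Nullary.no _ with i Data.Fin.≟ b
    ...   | Relation.Nullary.yes _ = a
    ...   | Relation.Nullary.no _ = i

    InComp : EdgeColouring k → Fin k → Fin k → Fin n →
             (u v : Fin n) → Adj u v → Set
    InComp c a b x u v e = IsAB c a b u v e × Reach c a b x u

    KempeChange : EdgeColouring k → EdgeColouring k → Set
    KempeChange c d = Σ (Fin k) λ a → Σ (Fin k) λ b → Σ (Fin n) λ x →
      ∀ u v (e : Adj u v) →
        (InComp c a b x u v e → col d u v e ≡ swap a b (col c u v e)) ×
        (¬ InComp c a b x u v e → col d u v e ≡ col c u v e)

    -- Kempe equivalence, with colourings identified up to a permutation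
    -- of the colour set.
    KempeEquivalent : EdgeColouring k → EdgeColouring k → Set
    KempeEquivalent c c' = Σ (Permutation′ k) λ π → Σ (EdgeColouring k) λ d →
      Star KempeChange c d ×
      (∀ u v (e : Adj u v) → col d u v e ≡ π ⟨$⟩ʳ col c' u v e)

{-# OPTIONS --safe #-}
module Submission where

-- An edge whose neighbours use fewer colours than are available can be inserted: colourings
-- extend to it and Kempe changes lift.  This settles Δ ≤ 2 and, by induction on the number of
-- edges of a loopless multigraph, reduces Δ = 3 to simple cubic graphs.  There let e = uv be
-- an edge in no triangle, with further edges u₁, u₂ at u and v₁, v₂ at v.  Colourings with
-- u₁ = v₁ are colourings of G − {u, v} plus one edge replacing u₁ and v₁, hence connected by
-- induction; a Vizing fan in G − {u, v} plus two edges gives a colouring with u₁ = v₁ and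
-- u₂ = v₂.  So the colourings parallel at e (u₁ = v₁ or u₂ = v₂) are Kempe equivalent, as are
-- those crossed at e (u₁ = v₂ or u₂ = v₁), and every colouring is of one of these types.  It
-- remains to find a single Kempe change that alters the type of some such edge: near a
-- colouring with u₁ = v₁ and u₂ = v₂, or near a triangle, recolouring a few edges does it.

open import Defs
open import Data.Nat using (suc; _≤_)
open import Data.Bool using (Bool; true; false; T; T?; if_then_else_)
open import Data.Bool.Properties using (T-irrelevant)
open import Data.Empty using (⊥; ⊥-elim)
open import Data.Fin using (Fin; zero; suc; inject≤)
import Data.Fin as Fin
import Data.Fin.Properties as Finₚ
open import Data.Fin.Permutation using () renaming (id to idₚ)
open import Data.List using (List; []; _∷_; length; map; filter; foldr; _++_; allFin; cartesianProduct)
open import Data.List.Properties using (length-map; length-filter; length-++)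
open import Data.List.Membership.Propositional using (_∈_; _∉_)
open import Data.List.Membership.Propositional.Properties
  using (∈-map⁺; ∈-map⁻; ∈-filter⁺; ∈-filter⁻; ∈-++⁺ˡ; ∈-++⁺ʳ; ∈-allFin; ∈-cartesianProduct⁺)
open import Data.List.Membership.Setoid.Properties using (index-injective)
import Data.List.Membership.DecPropositional as DecMembership
open import Data.List.Relation.Unary.All as All using (All; []; _∷_)
open import Data.List.Relation.Unary.All.Properties using (All¬⇒¬Any; ++⁺)
open import Data.List.Relation.Unary.Any as Any using (Any; here; there)
open import Data.Nat using (ℕ; zero; _+_; _⊔_; _<_; s≤s; z≤n)
import Data.Nat.Properties as ℕₚ
open import Data.Nat.Induction using (<-wellFounded; Acc; acc)
open import Data.Nat.ListAction using (sum)
open import Data.Product using (Σ; ∃; ∃₂; _×_; _,_; proj₁; proj₂)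
open import Data.Product.Properties using (≡-dec)
open import Data.Sum using (_⊎_; inj₁; inj₂; [_,_]′)
open import Data.Unit using (⊤; tt)
open import Function using (_∘_; id)
open import Level using (0ℓ)
open import Relation.Binary using (DecidableEquality; Rel; Decidable)
open import Relation.Binary.Construct.Closure.ReflexiveTransitive as Star using (Star; ε; _◅_; _◅◅_)
open import Relation.Binary.PropositionalEquality
open import Relation.Nullary using (¬_; Dec; yes; no; contradiction)
open import Relation.Nullary.Decidable using (_⊎-dec_; _×-dec_; ¬?; map′)
import Relation.Unary as Unary

-- Exchanges of two colours

-- The obstacle at Δ = 3 is a single unit: with four colours an edge can be inserted when its
-- neighbours show at most three colours in every colouring considered, but an edge of a cubic graph
-- has four neighbours. Prescribing u₁ = v₁ makes two of them count as one, which lets e be put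
-- back; the price is that colourings obeying different prescriptions must be related by hand. The
-- prescriptions exhaust all colourings because u and v each see two of the three colours other than
-- that of e. The edge replacing u₁ and v₁ joins their far ends. These may already be adjacent, but
-- they coincide only if e lies in a triangle; hence an induction over multigraphs without loops.
-- For u₁ = v₁ and u₂ = v₂ together, the two replacement edges must differ in colour, since u₁ and
-- u₂ meet at u; the induction may supply a colouring where they agree, and the fan repairs it. All
-- multigraphs in the induction live on one fixed set of half-edges, so colourings of a graph and of
-- its modifications are functions on the same domain.

∃-fresh : ∀ {m} (zs : List (Fin (suc m))) → length zs ≤ m → ∃ λ z → z ∉ zs
∃-fresh {m} zs short with Finₚ.any? (λ z → ¬? (z ∈? zs))
  where open DecMembership (Fin._≟_ {suc m}) using (_∈?_)
... | yes fresh = fresh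
... | no none =
  let i , j , i<j , eq = Finₚ.pigeonhole (s≤s short) (λ z → Any.index (used z))
  in contradiction (index-injective (setoid _) (used i) (used j) eq) (Finₚ.<⇒≢ i<j)
  where
  open DecMembership (Fin._≟_ {suc m}) using (_∈?_)
  used : ∀ z → z ∈ zs
  used z with z ∈? zs
  ... | yes z∈zs = z∈zs
  ... | no z∉zs = contradiction (z , z∉zs) none

Among : ∀ {k} → Fin k → Fin k → Fin k → Set
Among a b x = x ≡ a ⊎ x ≡ b

among? : ∀ {k} (a b x : Fin k) → Dec (Among a b x)
among? a b x = (x Fin.≟ a) ⊎-dec (x Fin.≟ b)

Linked : ∀ {k} → Fin k → Fin k → Fin k → Fin k → Set
Linked a b x y = x ≡ y ⊎ Among a b x × Among a b y

linked-sym : ∀ {k} {a b x y : Fin k} → Linked a b x y → Linked a b y x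
linked-sym (inj₁ eq) = inj₁ (sym eq)
linked-sym (inj₂ (p , q)) = inj₂ (q , p)

linked-other : ∀ {k} {a b x y : Fin k} → Linked a b x y → ¬ Among a b y → x ≡ y
linked-other (inj₁ eq) _ = eq
linked-other (inj₂ (_ , q)) ¬q = contradiction q ¬q

linked-ends : ∀ {k} (x y : Fin k) → Linked x y x y
linked-ends x y = inj₂ (inj₁ refl , inj₂ refl)

-- A step exchanges two colours on an arbitrary union of Kempe components, so no
-- component has to be exhibited: being proper before and after is enough.
module Recolouring {D : Set} (_≟_ : DecidableEquality D) (darts : List D)
                   (complete : ∀ x → x ∈ darts) (m : ℕ) where

  Colour : Set
  Colour = Fin (suc m)

  Assignment : Set
  Assignment = D → Colour

  Step : (Assignment → Set) → Assignment → Assignment → Set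
  Step C c c′ = C c × C c′ × ∃₂ λ a b → ∀ x → Linked a b (c x) (c′ x)

  Kempe : (Assignment → Set) → Assignment → Assignment → Set
  Kempe C = Star (Step C)

  Connected : (Assignment → Set) → Set
  Connected C = ∃ C × (∀ c c′ → C c → C c′ → Kempe C c c′)

  step-sym : ∀ {C c c′} → Step C c c′ → Step C c′ c
  step-sym (p , p′ , a , b , l) = p′ , p , a , b , λ x → linked-sym (l x)

  kempe-sym : ∀ {C c c′} → Kempe C c c′ → Kempe C c′ c
  kempe-sym {C} = Star.reverse (step-sym {C})

  pointwise : ∀ {C c c′} → C c → C c′ → (∀ x → c x ≡ c′ x) → Kempe C c c′
  pointwise p p′ eq = (p , p′ , zero , zero , λ x → inj₁ (eq x)) ◅ ε

  transport : ∀ {C C′ : Assignment → Set} → (∀ {c} → C c → C′ c) → (∀ {c} → C′ c → C c) →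
              Connected C → Connected C′
  transport {C} {C′} to from ((c , p) , conn) = (c , to p) ,
    λ c c′ p p′ → Star.gmap id (λ { (q , q′ , s) → to q , to q′ , s }) (conn c c′ (from p) (from p′))

  Off : D → Assignment → Assignment → Set
  Off x c c′ = ∀ y → y ≢ x → c y ≡ c′ y

  Free : (Assignment → Set) → D → Set
  Free C x = ∀ {c c′} → Off x c c′ → C c → C c′

  infixl 20 _[_≔_]
  _[_≔_] : Assignment → D → Colour → Assignment
  (c [ x ≔ z ]) y with y ≟ x
  ... | yes _ = z
  ... | no _ = c y

  ≔-same : ∀ c x z → (c [ x ≔ z ]) x ≡ z
  ≔-same c x z with x ≟ x
  ... | yes _ = refl
  ... | no x≢x = contradiction refl x≢x

  ≔-other : ∀ c z {x y} → y ≢ x → (c [ x ≔ z ]) y ≡ c y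
  ≔-other c z {x} {y} y≢x with y ≟ x
  ... | yes y≡x = contradiction y≡x y≢x
  ... | no _ = refl

  ≔-off : ∀ c x z → Off x c (c [ x ≔ z ])
  ≔-off c x z y y≢x = sym (≔-other c z y≢x)

  -- Recolouring one dart is always a step, with its old and new colours as the exchanged pair. This
  -- is the base of the induction, where no edge is left.
  unconstrained : Connected (λ _ → ⊤)
  unconstrained = ((λ _ → zero) , tt) , λ c c′ _ _ → go darts c c′ (λ y → inj₁ (complete y))
    where
    go : ∀ xs c c′ → (∀ y → y ∈ xs ⊎ c y ≡ c′ y) → Kempe (λ _ → ⊤) c c′
    go [] c c′ rest = pointwise tt tt λ y → [ (λ ()) , id ]′ (rest y)
    go (x ∷ xs) c c′ rest = (tt , tt , c x , c′ x , change) ◅ go xs (c [ x ≔ c′ x ]) c′ rest′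
      where
      change : ∀ y → Linked (c x) (c′ x) (c y) ((c [ x ≔ c′ x ]) y)
      change y with y ≟ x
      ... | yes refl = linked-ends _ _
      ... | no _ = inj₁ refl
      rest′ : ∀ y → y ∈ xs ⊎ (c [ x ≔ c′ x ]) y ≡ c′ y
      rest′ y with y ≟ x | rest y
      ... | yes refl | _ = inj₂ refl
      ... | no y≢x | inj₁ (here y≡x) = contradiction y≡x y≢x
      ... | no _ | inj₁ (there y∈xs) = inj₁ y∈xs
      ... | no _ | inj₂ eq = inj₂ eq

  copy-exists : ∀ {C : Assignment → Set} {x y} → Free C y → y ≢ x → ∃ C → ∃ λ c → C c × c y ≡ c x
  copy-exists {x = x} {y} free y≢x (c , p) = c [ y ≔ c x ] , free (≔-off c y (c x)) p ,
    trans (≔-same c y (c x)) (sym (≔-other c (c x) (y≢x ∘ sym)))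

  -- Duplicating the value at `x` onto `y` turns a step into a step with the same two colours, so a
  -- path of steps can be mapped as a whole. It serves to identify the two halves of an edge, and
  -- the edges that one replacement edge stands for.
  copy : ∀ {C : Assignment → Set} {x y} → Free C y → y ≢ x → Connected C →
         Connected (λ c → C c × c y ≡ c x)
  copy {C} {x} {y} free y≢x (exists , conn) = copy-exists {C} free y≢x exists , λ where
      c c′ (p , eq) (p′ , eq′) →
        pointwise (p , eq) (copied p) (same c eq) ◅◅
        Star.gmap (λ c → c [ y ≔ c x ]) map-step (conn c c′ p p′) ◅◅
        kempe-sym (pointwise (p′ , eq′) (copied p′) (same c′ eq′))
    where
    C′ : Assignment → Set
    C′ c = C c × c y ≡ c x
    copied : ∀ {c} → C c → C′ (c [ y ≔ c x ])
    copied {c} p = proj₂ (copy-exists {C} free y≢x (c , p))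
    same : ∀ c → c y ≡ c x → ∀ d → c d ≡ (c [ y ≔ c x ]) d
    same c eq d with d ≟ y
    ... | yes refl = eq
    ... | no _ = refl
    map-step : ∀ {c c′} → Step C c c′ → Step C′ (c [ y ≔ c x ]) (c′ [ y ≔ c′ x ])
    map-step {c} {c′} (p , p′ , a , b , l) = copied p , copied p′ , a , b , l′
      where
      l′ : ∀ d → Linked a b ((c [ y ≔ c x ]) d) ((c′ [ y ≔ c′ x ]) d)
      l′ d with d ≟ y
      ... | yes _ = l x
      ... | no _ = l d

  -- The Las Vergnas–Meyniel argument: a new variable with few neighbours can follow
  -- every step, after at most one change of its own.
  extend : ∀ {C : Assignment → Set} {x ns} → Free C x → x ∉ ns → length ns ≤ m → Connected C →
           Connected (λ c → C c × All (λ n → c n ≢ c x) ns)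
  extend {C} {x} {ns} free x∉ns short ((c₀ , p₀) , conn) =
      (let z , fresh = fresh-for c₀ in c₀ [ x ≔ z ] , extended p₀ fresh) ,
      λ c c′ p p′ →
        let ĉ , q , off , path = follow (conn c c′ (proj₁ p) (proj₁ p′)) p λ _ _ → refl
        -- The path that follows the given one ends at a colouring agreeing with `c′` except at `x`;
        -- exchanging the two values at `x` is one more step.
        in path ◅◅ ((q , p′ , ĉ x , c′ x , ends off) ◅ ε)
    where
    C′ : Assignment → Set
    C′ c = C c × All (λ n → c n ≢ c x) ns

    fresh-for : ∀ c → ∃ λ z → z ∉ map c ns
    fresh-for c = ∃-fresh (map c ns) (subst (_≤ m) (sym (length-map c ns)) short)

    extended : ∀ {c z} → C c → z ∉ map c ns → C′ (c [ x ≔ z ])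
    extended {c} {z} p fresh = free (≔-off c x z) p , All.tabulate λ {n} n∈ns eq →
      let n≢x = λ { refl → x∉ns n∈ns } in
      fresh (subst (_∈ map c ns) (trans (sym (≔-other c z n≢x)) (trans eq (≔-same c x z)))
                   (∈-map⁺ c n∈ns))

    fresh-in : ∀ {c ĉ} → C′ ĉ → Off x ĉ c → ĉ x ∉ map c ns
    fresh-in {c} {ĉ} (_ , clash) off p∈ with ∈-map⁻ c p∈
    ... | n , n∈ns , eq = All.lookup clash n∈ns (trans (off n λ { refl → x∉ns n∈ns }) (sym eq))

    -- A step only moves darts between the colours `a` and `b`, so a colour outside the pair occurs
    -- at the same places before and after.
    carry : ∀ {a b c c′ z} → (∀ y → Linked a b (c y) (c′ y)) → ¬ Among a b z →
            z ∉ map c ns → z ∉ map c′ ns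
    carry {c = c} {c′} l ¬ab fresh z∈ with ∈-map⁻ c′ z∈
    ... | n , n∈ns , refl = fresh (subst (_∈ map c ns) (linked-other (l n) ¬ab) (∈-map⁺ c n∈ns))

    ends : ∀ {ĉ ĉ′} → Off x ĉ ĉ′ → ∀ y → Linked (ĉ x) (ĉ′ x) (ĉ y) (ĉ′ y)
    ends off y with y ≟ x
    ... | yes refl = linked-ends _ _
    ... | no y≢x = inj₁ (off y y≢x)

    both : ∀ {a b c c′ ĉ z} → (∀ y → Linked a b (c y) (c′ y)) → Off x ĉ c → Linked a b (ĉ x) z →
           ∀ y → Linked a b (ĉ y) ((c′ [ x ≔ z ]) y)
    both l off lx y with y ≟ x
    ... | yes refl = lx
    ... | no y≢x = subst (λ w → Linked _ _ w _) (sym (off y y≢x)) (l y)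

    Lift : Assignment → Assignment → Set
    Lift ĉ c′ = ∃ λ ĉ′ → C′ ĉ′ × Off x ĉ′ c′ × Kempe C′ ĉ ĉ′

    follow₁ : ∀ {c c′ ĉ} → Step C c c′ → C′ ĉ → Off x ĉ c → Lift ĉ c′
    follow₁ {c} {c′} {ĉ} (p , p′ , a , b , l) q off with among? a b (ĉ x) | fresh-for c′
    ... | no ¬ab | _ =
      let q′ = extended p′ (carry l ¬ab (fresh-in q off))
      in c′ [ x ≔ ĉ x ] , q′ , (λ y y≢x → ≔-other c′ (ĉ x) y≢x) ,
         (q , q′ , a , b , both l off (inj₁ refl)) ◅ ε
    ... | yes ab | z , fresh with among? a b z
    -- The old and the new colour of `x` both lie in the exchanged pair, so `x` can change within
    -- the same step.
    ... | yes ab′ =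
      let q′ = extended p′ fresh
      in c′ [ x ≔ z ] , q′ , (λ y y≢x → ≔-other c′ z y≢x) ,
         (q , q′ , a , b , both l off (inj₂ (ab , ab′))) ◅ ε
    -- The new colour lies outside the pair, so by `carry` read backwards it is fresh before the
    -- step as well: `x` moves to it beforehand and then stays put.
    ... | no ¬ab′ =
      let q′ = extended p (carry (λ y → linked-sym (l y)) ¬ab′ fresh)
          q″ = extended p′ fresh
      in c′ [ x ≔ z ] , q″ , (λ y y≢x → ≔-other c′ z y≢x) ,
         (q , q′ , ĉ x , z , both {c = c} (λ y → inj₁ refl) off (linked-ends _ _)) ◅
         (q′ , q″ , a , b , both l (λ y y≢x → ≔-other c z y≢x) (inj₁ (≔-same c x z))) ◅ ε

    follow : ∀ {c c′ ĉ} → Kempe C c c′ → C′ ĉ → Off x ĉ c → Lift ĉ c′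
    follow ε q off = _ , q , off , ε
    follow (s ◅ ss) q off =
      let ĉ′ , q′ , off′ , path = follow₁ s q off
          ĉ″ , q″ , off″ , path′ = follow ss q′ off′
      in ĉ″ , q″ , off″ , path ◅◅ path′

-- Multigraphs as pairings of darts

length-filter-< : ∀ {A : Set} {P Q : A → Set} (P? : Unary.Decidable P) (Q? : Unary.Decidable Q) {xs x} →
                  (∀ {y} → P y → Q y) → x ∈ xs → Q x → ¬ P x →
                  length (filter P? xs) < length (filter Q? xs)
length-filter-< P? Q? P⊆Q (here {x = x} {xs} refl) q ¬p with P? x | Q? x
... | yes p | _ = contradiction p ¬p
... | no _ | no ¬q = contradiction q ¬q
... | no _ | yes _ = s≤s (weak xs)
  where
  weak : ∀ ys → length (filter P? ys) ≤ length (filter Q? ys)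
  weak [] = z≤n
  weak (y ∷ ys) with P? y | Q? y
  ... | yes p | yes _ = s≤s (weak ys)
  ... | yes p | no ¬q = contradiction (P⊆Q p) ¬q
  ... | no _ | yes _ = ℕₚ.m≤n⇒m≤1+n (weak ys)
  ... | no _ | no _ = weak ys
length-filter-< P? Q? {y ∷ ys} P⊆Q (there x∈ys) q ¬p with P? y | Q? y
... | yes p | yes _ = s≤s (length-filter-< P? Q? P⊆Q x∈ys q ¬p)
... | yes p | no ¬q = contradiction (P⊆Q p) ¬q
... | no _ | yes _ = ℕₚ.m≤n⇒m≤1+n (length-filter-< P? Q? P⊆Q x∈ys q ¬p)
... | no _ | no _ = length-filter-< P? Q? P⊆Q x∈ys q ¬p

-- A multigraph is given by its darts (half-edges): `vt x` is the vertex carrying x, and an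
-- involution pairs darts into edges.  Fixed points of the involution are unused darts, on
-- which colours are unconstrained.
module Pairings {D : Set} (_≟_ : DecidableEquality D) (darts : List D)
                (complete : ∀ x → x ∈ darts) (m : ℕ) {V : Set} (vt : D → V) where

  open Recolouring _≟_ darts complete m
  open DecMembership _≟_ using (_∈?_)

  record Pairing : Set where
    field
      partner    : D → D
      involutive : ∀ x → partner (partner x) ≡ x
      loopless   : ∀ {x} → partner x ≢ x → vt (partner x) ≢ vt x
  open Pairing public

  Alive : Pairing → D → Set
  Alive σ x = partner σ x ≢ x

  alive? : ∀ σ → Unary.Decidable (Alive σ)
  alive? σ x = ¬? (partner σ x ≟ x)

  alive-partner : ∀ σ {x} → Alive σ x → Alive σ (partner σ x)
  alive-partner σ alive eq = alive (sym (trans (sym (involutive σ _)) eq))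

  partner-injective : ∀ σ {x y} → partner σ x ≡ partner σ y → x ≡ y
  partner-injective σ {x} {y} eq =
    trans (sym (involutive σ x)) (trans (cong (partner σ) eq) (involutive σ y))

  partner-swap : ∀ σ {x y} → partner σ x ≡ y → partner σ y ≡ x
  partner-swap σ refl = involutive σ _

  size : Pairing → ℕ
  size σ = length (filter (alive? σ) darts)

  size-< : ∀ {σ τ x} → (∀ {y} → Alive τ y → Alive σ y) → Alive σ x → ¬ Alive τ x → size τ < size σ
  size-< {σ} {τ} {x} sub = length-filter-< (alive? τ) (alive? σ) sub (complete x)

  record Proper (σ : Pairing) (c : Assignment) : Set where
    field
      match : ∀ x → c (partner σ x) ≡ c x
      clash : ∀ {x y} → Alive σ x → Alive σ y → x ≢ y → vt x ≡ vt y → c x ≢ c y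
  open Proper public

  proper-free : ∀ {σ x} → ¬ Alive σ x → Free (Proper σ) x
  proper-free {σ} {x} dead {c} {c′} off p = record { match = match′ ; clash = clash′ }
    where
    fixed : partner σ x ≡ x
    fixed with partner σ x ≟ x
    ... | yes eq = eq
    ... | no alive = contradiction alive dead
    match′ : ∀ y → c′ (partner σ y) ≡ c′ y
    match′ y with y ≟ x
    ... | yes refl = cong c′ fixed
    ... | no y≢x = trans (sym (off _ λ eq → y≢x (partner-injective σ (trans eq (sym fixed)))))
                         (trans (match p y) (off y y≢x))
    clash′ : ∀ {y z} → Alive σ y → Alive σ z → y ≢ z → vt y ≡ vt z → c′ y ≢ c′ z
    clash′ ay az y≢z vty≡vtz eq = clash p ay az y≢z vty≡vtz
      (trans (off _ λ { refl → dead ay }) (trans eq (sym (off _ λ { refl → dead az }))))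

  Killed : Pairing → List D → D → Set
  Killed σ S x = x ∈ S ⊎ partner σ x ∈ S

  killed? : ∀ σ S → Unary.Decidable (Killed σ S)
  killed? σ S x = (x ∈? S) ⊎-dec (partner σ x ∈? S)

  opaque
    restricted : Pairing → List D → D → D
    restricted σ S x with killed? σ S x
    ... | yes _ = x
    ... | no _ = partner σ x

    restricted-cases : ∀ σ S x → (Killed σ S x × restricted σ S x ≡ x) ⊎
                       (x ∉ S × partner σ x ∉ S × restricted σ S x ≡ partner σ x)
    restricted-cases σ S x with killed? σ S x
    ... | yes k = inj₁ (k , refl)
    ... | no ¬k = inj₂ (¬k ∘ inj₁ , ¬k ∘ inj₂ , refl)

  restrict : Pairing → List D → Pairing
  restrict σ S = record { partner = restricted σ S ; involutive = inv ; loopless = loop }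
    where
    inv : ∀ x → restricted σ S (restricted σ S x) ≡ x
    inv x with restricted-cases σ S x
    ... | inj₁ (_ , eq) = trans (cong (restricted σ S) eq) eq
    ... | inj₂ (x∉S , σx∉S , eq) with restricted-cases σ S (partner σ x)
    ... | inj₁ (inj₁ k , _) = contradiction k σx∉S
    ... | inj₁ (inj₂ k , _) = contradiction (subst (_∈ S) (involutive σ x) k) x∉S
    ... | inj₂ (_ , _ , eq′) = trans (cong (restricted σ S) eq) (trans eq′ (involutive σ x))
    loop : ∀ {x} → restricted σ S x ≢ x → vt (restricted σ S x) ≢ vt x
    loop {x} ne with restricted-cases σ S x
    ... | inj₁ (_ , eq) = contradiction eq ne
    ... | inj₂ (_ , _ , eq) rewrite eq = loopless σ ne

  module _ (σ : Pairing) where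

    restrict-partner : ∀ {S x} → x ∉ S → partner σ x ∉ S → partner (restrict σ S) x ≡ partner σ x
    restrict-partner {S} {x} x∉S σx∉S with restricted-cases σ S x
    ... | inj₁ (inj₁ k , _) = contradiction k x∉S
    ... | inj₁ (inj₂ k , _) = contradiction k σx∉S
    ... | inj₂ (_ , _ , eq) = eq

    restrict-alive : ∀ {S x} → Alive (restrict σ S) x → Alive σ x × x ∉ S × partner σ x ∉ S
    restrict-alive {S} {x} alive with restricted-cases σ S x
    ... | inj₁ (_ , eq) = contradiction eq alive
    ... | inj₂ (x∉S , σx∉S , eq) = alive ∘ trans eq , x∉S , σx∉S

    alive-restrict : ∀ {S x} → Alive σ x → x ∉ S → partner σ x ∉ S → Alive (restrict σ S) x
    alive-restrict alive x∉S σx∉S eq = alive (trans (sym (restrict-partner x∉S σx∉S)) eq)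

    dead-restrict : ∀ {S x} → Killed σ S x → ¬ Alive (restrict σ S) x
    dead-restrict k alive = [ proj₁ (proj₂ (restrict-alive alive)) , proj₂ (proj₂ (restrict-alive alive)) ]′ k

    restrict-partner-cases : ∀ S x → partner (restrict σ S) x ≡ x ⊎
      (partner (restrict σ S) x ≡ partner σ x × x ∉ S × partner σ x ∉ S)
    restrict-partner-cases S x with restricted-cases σ S x
    ... | inj₁ (_ , eq) = inj₁ eq
    ... | inj₂ (x∉S , σx∉S , eq) = inj₂ (eq , x∉S , σx∉S)

    proper-weaken : ∀ {S S′ c} → (∀ {x} → x ∈ S → x ∈ S′) → Proper (restrict σ S) c → Proper (restrict σ S′) c
    proper-weaken {S} {S′} {c} S⊆S′ p = record
      { match = match′
      ; clash = λ ax ay → clash p (up ax) (up ay) }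
      where
      up : ∀ {x} → Alive (restrict σ S′) x → Alive (restrict σ S) x
      up alive = let a , x∉ , σx∉ = restrict-alive alive in alive-restrict a (x∉ ∘ S⊆S′) (σx∉ ∘ S⊆S′)
      match′ : ∀ x → c (partner (restrict σ S′) x) ≡ c x
      match′ x with restrict-partner-cases S′ x
      ... | inj₁ eq = cong c eq
      ... | inj₂ (eq , x∉ , σx∉) =
        trans (cong c (trans eq (sym (restrict-partner (x∉ ∘ S⊆S′) (σx∉ ∘ S⊆S′))))) (match p x)

    proper-restrict : ∀ S {c} → Proper σ c → Proper (restrict σ S) c
    proper-restrict S {c} p = record
      { match = match′
      ; clash = λ ax ay → clash p (proj₁ (restrict-alive ax)) (proj₁ (restrict-alive ay)) }
      where
      match′ : ∀ x → c (partner (restrict σ S) x) ≡ c x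
      match′ x with restrict-partner-cases S x
      ... | inj₁ eq = cong c eq
      ... | inj₂ (eq , _) = trans (cong c eq) (match p x)

    proper-unrestrict : ∀ {c} → Proper (restrict σ []) c → Proper σ c
    proper-unrestrict {c} p = record
      { match = λ x → trans (cong c (sym (restrict-partner {[]} (λ ()) (λ ())))) (match p x)
      ; clash = λ ax ay → clash p (alive-restrict ax (λ ()) (λ ())) (alive-restrict ay (λ ()) (λ ())) }

    record Near (S : List D) (x y : D) : Set where
      constructor near
      field
        ≢-dart    : y ≢ x
        ≢-partner : y ≢ partner σ x
        alive     : Alive (restrict σ S) y
        touching  : vt y ≡ vt x ⊎ vt y ≡ vt (partner σ x)

    proper-insert : ∀ {S x c} → Alive σ x → Proper (restrict σ (x ∷ S)) c → c (partner σ x) ≡ c x →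
                    (∀ y → Near S x y → c y ≢ c x) → Proper (restrict σ S) c
    proper-insert {S} {x} {c} alive-x p eq apart = record { match = match′ ; clash = clash′ }
      where
      τ = restrict σ S
      match′ : ∀ y → c (partner τ y) ≡ c y
      match′ y with restrict-partner-cases S y
      ... | inj₁ e = cong c e
      ... | inj₂ (e , y∉ , σy∉) with y ≟ x | partner σ y ≟ x
      ... | yes refl | _ = trans (cong c e) eq
      ... | no _ | yes refl = trans (cong c e) (trans (sym eq) (cong c (involutive σ y)))
      ... | no y≢x | no σy≢x =
        trans (cong c (trans e (sym (restrict-partner (λ { (here q) → y≢x q ; (there q) → y∉ q })
                                                      (λ { (here q) → σy≢x q ; (there q) → σy∉ q })))))
              (match p y)
      below : ∀ {y} → Alive τ y → y ≢ x → y ≢ partner σ x → Alive (restrict σ (x ∷ S)) y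
      below ay y≢x y≢σx =
        let a , y∉ , σy∉ = restrict-alive ay in
        alive-restrict a (λ { (here q) → y≢x q ; (there q) → y∉ q })
          (λ { (here q) → y≢σx (sym (partner-swap σ q)) ; (there q) → σy∉ q })
      at-x : ∀ {y} → Alive τ y → x ≢ y → vt x ≡ vt y → c x ≢ c y
      at-x ay x≢y vtx≡vty e =
        apart _ (near (x≢y ∘ sym) (λ { refl → loopless σ alive-x (sym vtx≡vty) }) ay (inj₁ (sym vtx≡vty))) (sym e)
      at-σx : ∀ {y} → Alive τ y → partner σ x ≢ y → vt (partner σ x) ≡ vt y → c (partner σ x) ≢ c y
      at-σx ay σx≢y vteq e =
        apart _ (near (λ { refl → loopless σ alive-x vteq }) (σx≢y ∘ sym) ay (inj₂ (sym vteq)))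
                (trans (sym e) eq)
      clash′ : ∀ {y z} → Alive τ y → Alive τ z → y ≢ z → vt y ≡ vt z → c y ≢ c z
      clash′ {y} {z} ay az y≢z vteq e with y ≟ x | y ≟ partner σ x
      ... | yes refl | _ = at-x az y≢z vteq e
      ... | no _ | yes refl = at-σx az y≢z vteq e
      ... | no y≢x | no y≢σx with z ≟ x | z ≟ partner σ x
      ... | yes refl | _ = at-x ay (y≢z ∘ sym) (sym vteq) (sym e)
      ... | no _ | yes refl = at-σx ay (y≢z ∘ sym) (sym vteq) (sym e)
      ... | no z≢x | no z≢σx = clash p (below ay y≢x y≢σx) (below az z≢x z≢σx) y≢z vteq e

    proper-apart : ∀ {S x c} → Alive (restrict σ S) x → Proper (restrict σ S) c → ∀ y → Near S x y → c y ≢ c x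
    proper-apart {S} {x} ax p y (near y≢x y≢σx ay (inj₁ vteq)) = clash p ay ax y≢x vteq
    proper-apart {S} {x} {c} ax p y (near y≢x y≢σx ay (inj₂ vteq)) e =
      let a , x∉ , σx∉ = restrict-alive ax
          eq = restrict-partner x∉ σx∉
      in clash p ay (subst (Alive (restrict σ S)) eq (alive-partner (restrict σ S) ax)) y≢σx vteq
           (trans e (trans (sym (match p x)) (cong c eq)))

    -- `extend` colours `x`, and `copy` carries the colour to its other half. The list `ns` only has
    -- to represent the colours near the edge: if `C` forces two neighbouring edges to agree, one of
    -- them suffices, and this is how the bound `m` is met in the cubic case.
    insert-edge : ∀ {S x ns} {C : Assignment → Set} → Alive (restrict σ S) x →
      All (Near S x) ns → length ns ≤ m → Free C x → Free C (partner σ x) →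
      (∀ {c} → Proper (restrict σ (x ∷ S)) c → C c → ∀ y → Near S x y → ∃ λ n → n ∈ ns × c y ≡ c n) →
      Connected (λ c → Proper (restrict σ (x ∷ S)) c × C c) →
      Connected (λ c → Proper (restrict σ S) c × C c)
    insert-edge {S} {x} {ns} {C} ax nears short free freeσ cover conn =
      transport to from (copy free₂ (alive-σ) (extend free₁ x∉ns short conn))
      where
      alive-σ = proj₁ (restrict-alive ax)
      x∉ns : x ∉ ns
      x∉ns x∈ = Near.≢-dart (All.lookup nears x∈) refl
      σx∉ns : partner σ x ∉ ns
      σx∉ns x∈ = Near.≢-partner (All.lookup nears x∈) refl
      C₀ : Assignment → Set
      C₀ c = Proper (restrict σ (x ∷ S)) c × C c
      C₁ : Assignment → Set
      C₁ c = C₀ c × All (λ n → c n ≢ c x) ns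
      free₁ : Free C₀ x
      free₁ off (p , q) = proper-free (dead-restrict (inj₁ (here refl))) off p , free off q
      free₂ : Free C₁ (partner σ x)
      free₂ off ((p , q) , r) =
        (proper-free (dead-restrict (inj₂ (here (involutive σ x)))) off p , freeσ off q) ,
        All.tabulate λ {n} n∈ e → All.lookup r n∈
          (trans (off n λ { refl → σx∉ns n∈ }) (trans e (sym (off x λ eq → alive-σ (sym eq)))))
      to : ∀ {c} → C₁ c × c (partner σ x) ≡ c x → Proper (restrict σ S) c × C c
      to {c} (((p , q) , r) , e) = proper-insert alive-σ p e
        (λ y ny e′ → let n , n∈ , e″ = cover p q y ny in All.lookup r n∈ (trans (sym e″) e′)) , q
      from : ∀ {c} → Proper (restrict σ S) c × C c → C₁ c × c (partner σ x) ≡ c x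
      from {c} (p , q) =
        let a , x∉ , σx∉ = restrict-alive ax in
        ((proper-weaken there p , q) ,
         All.tabulate λ n∈ → proper-apart ax p _ (All.lookup nears n∈)) ,
        trans (cong c (sym (restrict-partner x∉ σx∉))) (match p x)

    insert-edge₀ : ∀ {x ns} → Alive σ x → All (Near [] x) ns → length ns ≤ m →
      (∀ {c} → Proper (restrict σ (x ∷ [])) c → ∀ y → Near [] x y → ∃ λ n → n ∈ ns × c y ≡ c n) →
      Connected (Proper (restrict σ (x ∷ []))) → Connected (Proper σ)
    insert-edge₀ {x} ax nears short cover conn =
      transport (proper-unrestrict ∘ proj₁) (λ p → proper-restrict [] p , tt)
        (insert-edge {C = λ _ → ⊤} (alive-restrict ax (λ ()) (λ ())) nears short (λ _ _ → tt) (λ _ _ → tt)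
          (λ p _ → cover p) (transport (_, tt) proj₁ conn))

    paint : D → Colour → Assignment → Assignment
    paint x z c = c [ x ≔ z ] [ partner σ x ≔ z ]

    paint-at : ∀ x z c → paint x z c x ≡ z
    paint-at x z c with x ≟ partner σ x
    ... | yes _ = refl
    ... | no _ = ≔-same c x z

    paint-partner : ∀ x z c → paint x z c (partner σ x) ≡ z
    paint-partner x z c = ≔-same (c [ x ≔ z ]) (partner σ x) z

    paint-other : ∀ {x y} z c → y ≢ x → y ≢ partner σ x → paint x z c y ≡ c y
    paint-other z c y≢x y≢σx = trans (≔-other (c [ _ ≔ z ]) z y≢σx) (≔-other c z y≢x)

    paint-proper : ∀ {S x z c} → Alive σ x → Proper (restrict σ (x ∷ S)) c →
                   (∀ y → Near S x y → c y ≢ z) → Proper (restrict σ S) (paint x z c)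
    paint-proper {S} {x} {z} {c} ax p apart = proper-insert ax
      (proper-free (dead-restrict (inj₂ (here (involutive σ x)))) (≔-off (c [ x ≔ z ]) (partner σ x) z)
        (proper-free (dead-restrict (inj₁ (here refl))) (≔-off c x z) p))
      (trans (paint-partner x z c) (sym (paint-at x z c)))
      λ y ny e → apart y ny (trans (sym (paint-other z c (Near.≢-dart ny) (Near.≢-partner ny)))
                                   (trans e (paint-at x z c)))

    paint-linked : ∀ {a b x z c} → c (partner σ x) ≡ c x → Linked a b (c x) z →
                   ∀ y → Linked a b (c y) (paint x z c y)
    paint-linked {x = x} {z} {c} eq l y with y ≟ partner σ x
    ... | yes refl = subst (λ w → Linked _ _ w z) (sym eq) l
    ... | no _ with y ≟ x
    ... | yes refl = l
    ... | no _ = inj₁ refl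

    opaque
      swapped : D → D → D → D
      swapped p q x with x ≟ p | x ≟ q
      ... | yes _ | _ = q
      ... | no _ | yes _ = p
      ... | no _ | no _ = partner σ x

      swapped-left : ∀ p q → swapped p q p ≡ q
      swapped-left p q with p ≟ p
      ... | yes _ = refl
      ... | no ne = contradiction refl ne

      swapped-right : ∀ p q → swapped p q q ≡ p
      swapped-right p q with q ≟ p | q ≟ q
      ... | yes q≡p | _ = q≡p
      ... | no _ | yes _ = refl
      ... | no _ | no ne = contradiction refl ne

      swapped-cases : ∀ p q x → x ≡ p ⊎ x ≡ q ⊎ (x ≢ p × x ≢ q × swapped p q x ≡ partner σ x)
      swapped-cases p q x with x ≟ p | x ≟ q
      ... | yes x≡p | _ = inj₁ x≡p
      ... | no _ | yes x≡q = inj₂ (inj₁ x≡q)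
      ... | no x≢p | no x≢q = inj₂ (inj₂ (x≢p , x≢q , refl))

    dead-fixed : ∀ {x} → ¬ Alive σ x → partner σ x ≡ x
    dead-fixed {x} dead with partner σ x ≟ x
    ... | yes eq = eq
    ... | no alive = contradiction alive dead

    join : ∀ p q → ¬ Alive σ p → ¬ Alive σ q → vt p ≢ vt q → Pairing
    join p q dead-p dead-q vp≢vq = record { partner = j ; involutive = inv ; loopless = λ {x} → loop x }
      where
      j = swapped p q
      inv : ∀ x → j (j x) ≡ x
      inv x with swapped-cases p q x
      ... | inj₁ refl = trans (cong j (swapped-left p q)) (swapped-right p q)
      ... | inj₂ (inj₁ refl) = trans (cong j (swapped-right p q)) (swapped-left p q)
      ... | inj₂ (inj₂ (x≢p , x≢q , eq)) with swapped-cases p q (partner σ x)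
      ... | inj₁ e = contradiction (trans (sym (partner-swap σ e)) (dead-fixed dead-p)) x≢p
      ... | inj₂ (inj₁ e) = contradiction (trans (sym (partner-swap σ e)) (dead-fixed dead-q)) x≢q
      ... | inj₂ (inj₂ (_ , _ , eq′)) = trans (cong j eq) (trans eq′ (involutive σ x))
      loop : ∀ x → j x ≢ x → vt (j x) ≢ vt x
      loop x ne with swapped-cases p q x
      ... | inj₁ refl = λ e → vp≢vq (trans (sym e) (cong vt (swapped-left p q)))
      ... | inj₂ (inj₁ refl) = λ e → vp≢vq (trans (sym (cong vt (swapped-right p q))) e)
      ... | inj₂ (inj₂ (_ , _ , eq)) rewrite eq = loopless σ ne

    module Join {p q} (dead-p : ¬ Alive σ p) (dead-q : ¬ Alive σ q) (vp≢vq : vt p ≢ vt q) where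

      joined : Pairing
      joined = join p q dead-p dead-q vp≢vq

      partner-p : partner joined p ≡ q
      partner-p = swapped-left p q

      alive-joined : ∀ {x} → x ≡ p ⊎ x ≡ q ⊎ Alive σ x → Alive joined x
      alive-joined (inj₁ refl) e = vp≢vq (cong vt (trans (sym e) (swapped-left p q)))
      alive-joined (inj₂ (inj₁ refl)) e = vp≢vq (cong vt (trans (sym (swapped-right p q)) e))
      alive-joined {x} (inj₂ (inj₂ a)) with swapped-cases p q x
      ... | inj₁ refl = contradiction a dead-p
      ... | inj₂ (inj₁ refl) = contradiction a dead-q
      ... | inj₂ (inj₂ (_ , _ , eq)) = a ∘ trans (sym eq)

      joined-alive : ∀ {x} → Alive joined x → x ≡ p ⊎ x ≡ q ⊎ Alive σ x
      joined-alive {x} a with swapped-cases p q x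
      ... | inj₁ e = inj₁ e
      ... | inj₂ (inj₁ e) = inj₂ (inj₁ e)
      ... | inj₂ (inj₂ (_ , _ , eq)) = inj₂ (inj₂ (a ∘ trans eq))

      proper-unjoin : ∀ {c} → Proper joined c → Proper σ c
      proper-unjoin {c} pr = record
        { match = match′
        ; clash = λ ax ay → clash pr (alive-joined (inj₂ (inj₂ ax))) (alive-joined (inj₂ (inj₂ ay))) }
        where
        match′ : ∀ x → c (partner σ x) ≡ c x
        match′ x with swapped-cases p q x
        ... | inj₁ refl = cong c (dead-fixed dead-p)
        ... | inj₂ (inj₁ refl) = cong c (dead-fixed dead-q)
        ... | inj₂ (inj₂ (_ , _ , eq)) = trans (cong c (sym eq)) (match pr x)

      proper-join : ∀ {c} → Proper σ c → c p ≡ c q →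
                    (∀ y → Alive σ y → vt y ≡ vt p ⊎ vt y ≡ vt q → c y ≢ c p) → Proper joined c
      proper-join {c} pr cp≡cq apart = record { match = match′ ; clash = clash′ }
        where
        match′ : ∀ x → c (partner joined x) ≡ c x
        match′ x with swapped-cases p q x
        ... | inj₁ refl = trans (cong c (swapped-left p q)) (sym cp≡cq)
        ... | inj₂ (inj₁ refl) = trans (cong c (swapped-right p q)) cp≡cq
        ... | inj₂ (inj₂ (_ , _ , eq)) = trans (cong c eq) (match pr x)
        clash′ : ∀ {x y} → Alive joined x → Alive joined y → x ≢ y → vt x ≡ vt y → c x ≢ c y
        clash′ ax ay x≢y vteq e with joined-alive ax | joined-alive ay
        ... | inj₁ refl | inj₁ refl = x≢y refl
        ... | inj₁ refl | inj₂ (inj₁ refl) = vp≢vq vteq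
        ... | inj₁ refl | inj₂ (inj₂ a) = apart _ a (inj₁ (sym vteq)) (sym e)
        ... | inj₂ (inj₁ refl) | inj₁ refl = vp≢vq (sym vteq)
        ... | inj₂ (inj₁ refl) | inj₂ (inj₁ refl) = x≢y refl
        ... | inj₂ (inj₁ refl) | inj₂ (inj₂ a) = apart _ a (inj₂ (sym vteq)) (trans (sym e) (sym cp≡cq))
        ... | inj₂ (inj₂ a) | inj₁ refl = apart _ a (inj₁ vteq) e
        ... | inj₂ (inj₂ a) | inj₂ (inj₁ refl) = apart _ a (inj₂ vteq) (trans e (sym cp≡cq))
        ... | inj₂ (inj₂ a) | inj₂ (inj₂ b) = clash pr a b x≢y vteq e

-- Kempe chains

-- Warshall's algorithm: `Via ws` allows intermediate points from ws only.
module Reachability {A : Set} (_≟_ : DecidableEquality A) (points : List A)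
                    (complete : ∀ x → x ∈ points) {R : Rel A 0ℓ} (R? : Decidable R) where

  Via : List A → Rel A 0ℓ
  Via [] u v = u ≡ v ⊎ R u v
  Via (w ∷ ws) u v = Via ws u v ⊎ Via ws u w × Via ws w v

  via? : ∀ ws → Decidable (Via ws)
  via? [] u v = (u ≟ v) ⊎-dec R? u v
  via? (w ∷ ws) u v = via? ws u v ⊎-dec (via? ws u w ×-dec via? ws w v)

  via⇒star : ∀ ws {u v} → Via ws u v → Star R u v
  via⇒star [] (inj₁ refl) = ε
  via⇒star [] (inj₂ r) = r ◅ ε
  via⇒star (w ∷ ws) (inj₁ p) = via⇒star ws p
  via⇒star (w ∷ ws) (inj₂ (p , q)) = via⇒star ws p ◅◅ via⇒star ws q

  direct : ∀ ws {u v} → u ≡ v ⊎ R u v → Via ws u v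
  direct [] r = r
  direct (w ∷ ws) r = inj₁ (direct ws r)

  -- Walks can be spliced at an allowed point. If both halves pass through the head of the list, the
  -- part between the two visits is dropped, since `Via` admits the head only once.
  compose : ∀ {ws u v w} → w ∈ ws → Via ws u w → Via ws w v → Via ws u v
  compose {_ ∷ ws} (here refl) p q = inj₂ ([ id , proj₁ ]′ p , [ id , proj₂ ]′ q)
  compose {_ ∷ ws} (there w∈) (inj₁ p) (inj₁ q) = inj₁ (compose w∈ p q)
  compose {_ ∷ ws} (there w∈) (inj₁ p) (inj₂ (q , q′)) = inj₂ (compose w∈ p q , q′)
  compose {_ ∷ ws} (there w∈) (inj₂ (p , p′)) (inj₁ q) = inj₂ (p , compose w∈ p′ q)
  compose {_ ∷ ws} (there w∈) (inj₂ (p , _)) (inj₂ (_ , q′)) = inj₂ (p , q′)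

  star⇒via : ∀ {u v} → Star R u v → Via points u v
  star⇒via ε = direct points (inj₁ refl)
  star⇒via (r ◅ rs) = compose (complete _) (direct points (inj₂ r)) (star⇒via rs)

  star? : Decidable (Star R)
  star? u v = map′ (via⇒star points) star⇒via (via? points u v)

last-step : ∀ {A : Set} {R : Rel A 0ℓ} {u v} → Star R u v → u ≡ v ⊎ ∃ λ w → Star R u w × R w v
last-step ε = inj₁ refl
last-step (r ◅ rs) with last-step rs
... | inj₁ refl = inj₂ (_ , ε , r)
... | inj₂ (w , rs′ , r′) = inj₂ (w , r ◅ rs′ , r′)

terminal-unique : ∀ {A : Set} {R : Rel A 0ℓ} → (∀ {u v w} → R u v → R u w → v ≡ w) →
                  ∀ {u v w} → Star R u v → Star R u w → (∀ {x} → ¬ R v x) → (∀ {x} → ¬ R w x) → v ≡ w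
terminal-unique det ε ε _ _ = refl
terminal-unique det ε (r ◅ _) stop _ = contradiction r stop
terminal-unique det (r ◅ _) ε _ stop = contradiction r stop
terminal-unique det (r ◅ rs) (s ◅ ss) stop stop′ with det r s
... | refl = terminal-unique det rs ss stop stop′

flip : ∀ {k} → Fin k → Fin k → Fin k → Fin k
flip i j x with x Fin.≟ i
... | yes _ = j
... | no _ = i

flip-left : ∀ {k} (i j : Fin k) → flip i j i ≡ j
flip-left i j with i Fin.≟ i
... | yes _ = refl
... | no ne = contradiction refl ne

flip-right : ∀ {k} {i j : Fin k} → i ≢ j → flip i j j ≡ i
flip-right {i = i} {j} i≢j with j Fin.≟ i
... | yes j≡i = contradiction (sym j≡i) i≢j
... | no _ = refl

flip-among : ∀ {k} (i j x : Fin k) → Among i j (flip i j x)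
flip-among i j x with x Fin.≟ i
... | yes _ = inj₂ refl
... | no _ = inj₁ refl

flip-injective : ∀ {k} {i j x y : Fin k} → i ≢ j → Among i j x → Among i j y → flip i j x ≡ flip i j y → x ≡ y
flip-injective i≢j (inj₁ refl) (inj₁ refl) _ = refl
flip-injective i≢j (inj₂ refl) (inj₂ refl) _ = refl
flip-injective {i = i} {j} i≢j (inj₁ refl) (inj₂ refl) e =
  contradiction (trans (sym (flip-right i≢j)) (trans (sym e) (flip-left i j))) i≢j
flip-injective {i = i} {j} i≢j (inj₂ refl) (inj₁ refl) e =
  contradiction (trans (sym (flip-right i≢j)) (trans e (flip-left i j))) i≢j

no-three : ∀ {k} {i j x y z : Fin k} → Among i j x → Among i j y → Among i j z → x ≢ y → x ≢ z → y ≢ z → ⊥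
no-three (inj₁ refl) (inj₁ refl) _ x≢y _ _ = x≢y refl
no-three (inj₁ refl) (inj₂ refl) (inj₁ refl) _ x≢z _ = x≢z refl
no-three (inj₁ refl) (inj₂ refl) (inj₂ refl) _ _ y≢z = y≢z refl
no-three (inj₂ refl) (inj₁ refl) (inj₁ refl) _ _ y≢z = y≢z refl
no-three (inj₂ refl) (inj₁ refl) (inj₂ refl) _ x≢z _ = x≢z refl
no-three (inj₂ refl) (inj₂ refl) _ x≢y _ _ = x≢y refl

module Chains {D : Set} (_≟_ : DecidableEquality D) (darts : List D)
              (complete : ∀ x → x ∈ darts) (m : ℕ)
              {V : Set} (_≟ᵥ_ : DecidableEquality V) (vt : D → V) where

  open Recolouring _≟_ darts complete m
  open Pairings _≟_ darts complete m vt

  Missing : Pairing → Assignment → V → Colour → Set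
  Missing σ c v z = ∀ {y} → Alive σ y → vt y ≡ v → c y ≢ z

  present? : ∀ σ c v z → (∃ λ y → Alive σ y × vt y ≡ v × c y ≡ z) ⊎ Missing σ c v z
  present? σ c v z with Any.any? (λ y → alive? σ y ×-dec ((vt y ≟ᵥ v) ×-dec (c y Fin.≟ z))) darts
  ... | yes found = inj₁ (Any.satisfied found)
  ... | no none = inj₂ λ {y} a at e → none (Any.map (λ { refl → a , at , e }) (complete y))

  -- By `only-s` the vertex of `s` is an end of its i/j-component, which is therefore a path,
  -- traversed from `s` by `Next`.
  module Chain (σ : Pairing) {c : Assignment} (proper : Proper σ c) {i j : Colour} (i≢j : i ≢ j)
               {s : D} (alive-s : Alive σ s) (among-s : Among i j (c s))
               (only-s : ∀ {d} → Alive σ d → vt d ≡ vt s → Among i j (c d) → d ≡ s) where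

    Live : D → Set
    Live d = Alive σ d × Among i j (c d)

    live-partner : ∀ {d} → Live d → Live (partner σ d)
    live-partner (a , p) = alive-partner σ a , subst (Among i j) (sym (match proper _)) p

    at-most-two : ∀ {d e f} → Live d → Live e → Live f → vt d ≡ vt e → vt d ≡ vt f →
                  d ≢ e → d ≢ f → e ≢ f → ⊥
    at-most-two (a , p) (a′ , p′) (a″ , p″) de df d≢e d≢f e≢f =
      no-three p p′ p″ (clash proper a a′ d≢e de) (clash proper a a″ d≢f df)
        (clash proper a′ a″ e≢f (trans (sym de) df))

    -- A dart is followed by the other i/j-dart at its far vertex, so the darts of a walk all point
    -- away from `s`.
    Next : D → D → Set
    Next d e = Live d × Live e × vt e ≡ vt (partner σ d) × e ≢ partner σ d

    live? : ∀ d → Dec (Live d)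
    live? d = alive? σ d ×-dec among? i j (c d)

    next? : Decidable Next
    next? d e = live? d ×-dec (live? e ×-dec ((vt e ≟ᵥ vt (partner σ d)) ×-dec ¬? (e ≟ partner σ d)))

    open Reachability _≟_ darts complete next? using (star?)

    next-unique : ∀ {d e f} → Next d e → Next d f → e ≡ f
    next-unique {d} {e} {f} (l , le , ve , e≢) (_ , lf , vf , f≢) with e ≟ f
    ... | yes e≡f = e≡f
    ... | no e≢f = ⊥-elim (at-most-two (live-partner l) le lf (sym ve) (sym vf) (e≢ ∘ sym) (f≢ ∘ sym) e≢f)

    Walk : D → Set
    Walk = Star Next s

    InChain : D → Set
    InChain d = Walk d ⊎ Walk (partner σ d)

    inChain? : ∀ d → Dec (InChain d)
    inChain? d = star? s d ⊎-dec star? s (partner σ d)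

    walk-live : ∀ {d} → Walk d → Live d
    walk-live w with last-step w
    ... | inj₁ refl = alive-s , among-s
    ... | inj₂ (_ , _ , _ , l , _) = l

    chain-live : ∀ {d} → InChain d → Live d
    chain-live (inj₁ w) = walk-live w
    chain-live {d} (inj₂ w) = subst Live (involutive σ d) (live-partner (walk-live w))

    chain-partner : ∀ {d} → InChain d → InChain (partner σ d)
    chain-partner (inj₁ w) = inj₂ (subst Walk (sym (involutive σ _)) w)
    chain-partner (inj₂ w) = inj₁ w

    -- A vertex has at most two live darts, and a walk that enters by one leaves by the other. Only
    -- at the start could a second live dart be overlooked, which `only-s` excludes. This closure is
    -- what keeps the exchange proper.
    chain-closed : ∀ {d e} → InChain d → Live e → vt d ≡ vt e → d ≢ e → InChain e
    chain-closed {d} {e} (inj₂ w) le vde d≢e = inj₁ (w ◅◅ next ◅ ε)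
      where
      next : Next (partner σ d) e
      next = walk-live w , le , trans (sym vde) (cong vt (sym (involutive σ d))) ,
             λ eq → d≢e (trans (sym (involutive σ d)) (sym eq))
    chain-closed {d} {e} (inj₁ w) le vde d≢e with last-step w
    ... | inj₁ refl = contradiction (sym (only-s (proj₁ le) (sym vde) (proj₂ le))) d≢e
    ... | inj₂ (f , w′ , lf , ld , vd , d≢) with e ≟ partner σ f
    ... | yes refl = inj₂ (subst Walk (sym (involutive σ f)) w′)
    ... | no e≢ = ⊥-elim (at-most-two ld le (live-partner lf) vde vd d≢e d≢ e≢)

    -- Away from s, a vertex meeting the chain in a single live dart is where the walk stops.
    Last : D → Set
    Last d = d ≢ s × (∀ {e} → Live e → vt e ≡ vt d → e ≡ d)

    -- `Next` is deterministic and stops at the far end of the chain; hence two far ends reached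
    -- from `s` coincide.
    last-unique : ∀ {d e} → Last d → Last e → InChain d → InChain e → d ≡ e
    last-unique last-d last-e in-d in-e = partner-injective σ
      (terminal-unique next-unique (arrives last-d in-d) (arrives last-e in-e) (stops last-d) (stops last-e))
      where
      arrives : ∀ {d} → Last d → InChain d → Walk (partner σ d)
      arrives _ (inj₂ w) = w
      arrives (d≢s , only) (inj₁ w) with last-step w
      ... | inj₁ refl = contradiction refl d≢s
      ... | inj₂ (f , _ , lf , _ , vd , d≢) = contradiction (sym (only (live-partner lf) (sym vd))) d≢
      stops : ∀ {d x} → Last d → ¬ Next (partner σ d) x
      stops {d} (_ , only) (_ , lx , vx , x≢) =
        x≢ (trans (only lx (trans vx (cong vt (involutive σ d)))) (sym (involutive σ d)))

    exchange : Assignment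
    exchange d with inChain? d
    ... | yes _ = flip i j (c d)
    ... | no _ = c d

    exchange-in : ∀ {d} → InChain d → exchange d ≡ flip i j (c d)
    exchange-in {d} p with inChain? d
    ... | yes _ = refl
    ... | no ¬p = contradiction p ¬p

    exchange-out : ∀ {d} → ¬ InChain d → exchange d ≡ c d
    exchange-out {d} ¬p with inChain? d
    ... | yes p = contradiction p ¬p
    ... | no _ = refl

    exchange-other : ∀ {d} → ¬ Among i j (c d) → exchange d ≡ c d
    exchange-other ¬p = exchange-out (¬p ∘ proj₂ ∘ chain-live)

    exchange-among : ∀ {d} → Among i j (exchange d) → Among i j (c d)
    exchange-among {d} p with inChain? d
    ... | yes q = proj₂ (chain-live q)
    ... | no _ = p

    exchange-proper : Proper σ exchange
    exchange-proper = record { match = match′ ; clash = clash′ }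
      where
      match′ : ∀ d → exchange (partner σ d) ≡ exchange d
      match′ d with inChain? d
      ... | yes p = trans (exchange-in (chain-partner p)) (cong (flip i j) (match proper d))
      ... | no ¬p = trans (exchange-out λ p → ¬p (subst InChain (involutive σ d) (chain-partner p)))
                          (match proper d)
      mixed : ∀ {d e} → Alive σ e → d ≢ e → vt d ≡ vt e → InChain d → ¬ InChain e →
              flip i j (c d) ≢ c e
      mixed {d} ae d≢e vde p ¬p e = ¬p (chain-closed p (ae , subst (Among i j) e (flip-among i j (c d))) vde d≢e)
      clash′ : ∀ {d e} → Alive σ d → Alive σ e → d ≢ e → vt d ≡ vt e → exchange d ≢ exchange e
      clash′ {d} {e} ad ae d≢e vde eq with inChain? d | inChain? e
      ... | yes p | yes q = clash proper ad ae d≢e vde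
              (flip-injective i≢j (proj₂ (chain-live p)) (proj₂ (chain-live q)) eq)
      ... | yes p | no ¬q = mixed ae d≢e vde p ¬q eq
      ... | no ¬p | yes q = mixed ad (d≢e ∘ sym) (sym vde) q ¬p (sym eq)
      ... | no _ | no _ = clash proper ad ae d≢e vde eq

-- Vizing fans

four-colours : ∀ {p q r s t : Fin 4} → p ≢ q → p ≢ r → p ≢ s → q ≢ r → q ≢ s → r ≢ s →
               t ≢ p → t ≢ q → t ≢ r → t ≡ s
four-colours {p} {q} {r} {s} {t} pq pr ps qr qs rs tp tq tr with t Fin.≟ s
... | yes eq = eq
... | no ts with Finₚ.pigeonhole ℕₚ.≤-refl pick
  where
  pick : Fin 5 → Fin 4
  pick zero = p
  pick (suc zero) = q
  pick (suc (suc zero)) = r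
  pick (suc (suc (suc zero))) = s
  pick (suc (suc (suc (suc zero)))) = t
... | zero , suc zero , _ , e = contradiction e pq
... | zero , suc (suc zero) , _ , e = contradiction e pr
... | zero , suc (suc (suc zero)) , _ , e = contradiction e ps
... | zero , suc (suc (suc (suc zero))) , _ , e = contradiction (sym e) tp
... | suc zero , suc (suc zero) , _ , e = contradiction e qr
... | suc zero , suc (suc (suc zero)) , _ , e = contradiction e qs
... | suc zero , suc (suc (suc (suc zero))) , _ , e = contradiction (sym e) tq
... | suc (suc zero) , suc (suc (suc zero)) , _ , e = contradiction e rs
... | suc (suc zero) , suc (suc (suc (suc zero))) , _ , e = contradiction (sym e) tr
... | suc (suc (suc zero)) , suc (suc (suc (suc zero))) , _ , e = contradiction (sym e) ts
... | suc zero , suc zero , lt , _ = contradiction lt (ℕₚ.<-irrefl refl)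
... | suc (suc zero) , suc zero , s≤s () , _
... | suc (suc zero) , suc (suc zero) , lt , _ = contradiction lt (ℕₚ.<-irrefl refl)
... | suc (suc (suc zero)) , suc zero , s≤s () , _
... | suc (suc (suc zero)) , suc (suc zero) , s≤s (s≤s ()) , _
... | suc (suc (suc zero)) , suc (suc (suc zero)) , lt , _ = contradiction lt (ℕₚ.<-irrefl refl)
... | suc (suc (suc (suc zero))) , suc zero , s≤s () , _
... | suc (suc (suc (suc zero))) , suc (suc zero) , s≤s (s≤s ()) , _
... | suc (suc (suc (suc zero))) , suc (suc (suc zero)) , s≤s (s≤s (s≤s ())) , _
... | suc (suc (suc (suc zero))) , suc (suc (suc (suc zero))) , lt , _ = contradiction lt (ℕₚ.<-irrefl refl)

record Corner {D V : Set} (vt : D → V) (x y z : D) : Set where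
  field
    at-y  : vt y ≡ vt x
    at-z  : vt z ≡ vt x
    x≢y   : x ≢ y
    x≢z   : x ≢ z
    y≢z   : y ≢ z
    cover : ∀ {d} → vt d ≡ vt x → d ≡ x ⊎ d ≡ y ⊎ d ≡ z

corner-swap : ∀ {D V : Set} {vt : D → V} {x y z} → Corner vt x y z → Corner vt x z y
corner-swap k = record
  { at-y = at-z ; at-z = at-y ; x≢y = x≢z ; x≢z = x≢y ; y≢z = y≢z ∘ sym
  ; cover = λ e → [ inj₁ , [ inj₂ ∘ inj₂ , inj₂ ∘ inj₁ ]′ ]′ (cover e) }
  where open Corner k

corner-rotate : ∀ {D V : Set} {vt : D → V} {x y z} → Corner vt x y z → Corner vt y z x
corner-rotate k = record
  { at-y = trans at-z (sym at-y) ; at-z = sym at-y ; x≢y = y≢z ; x≢z = x≢y ∘ sym ; y≢z = x≢z ∘ sym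
  ; cover = λ e → [ inj₂ ∘ inj₂ , [ inj₁ , inj₂ ∘ inj₁ ]′ ]′ (cover (trans e at-y)) }
  where open Corner k

module Separation {D : Set} (_≟_ : DecidableEquality D) (darts : List D)
                  (complete : ∀ x → x ∈ darts)
                  {V : Set} (_≟ᵥ_ : DecidableEquality V) (vt : D → V)
                  (corner : ∀ x → ∃₂ (Corner vt x)) where

  open Recolouring _≟_ darts complete 3
  open Pairings _≟_ darts complete 3 vt
  open Chains _≟_ darts complete 3 _≟ᵥ_ vt

  some-missing : ∀ σ c x → ∃ λ z → Missing σ c (vt x) z × c x ≢ z
  some-missing σ c x =
    let y , z , k = corner x
        open Corner k
        free , fresh = ∃-fresh (c x ∷ c y ∷ c z ∷ []) ℕₚ.≤-refl
        miss : Missing σ c (vt x) free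
        miss _ at e = [ (λ { refl → fresh (here (sym e)) }) ,
                      [ (λ { refl → fresh (there (here (sym e))) }) ,
                        (λ { refl → fresh (there (there (here (sym e)))) }) ]′ ]′ (cover at)
    in free , miss , λ e → fresh (here (sym e))

  -- As in Vizing's theorem, the edge of `x` is uncoloured and then recoloured by a fan. The
  -- additional demand is that `x` avoid the colour of `x′`, so the value at `x′` is kept fixed
  -- throughout.
  module Separate (τ : Pairing) {x x′ : D} (alive-x : Alive τ x) (x′≢x : x′ ≢ x)
                  (x′≢τx : x′ ≢ partner τ x) where

    κ : Pairing
    κ = restrict τ (x ∷ [])

    Goal : Set
    Goal = ∃ λ c → Proper τ c × c x ≢ c x′

    paint-value : ∀ {c} d z y → (paint τ d z c y ≡ z) ⊎ (y ≢ d × y ≢ partner τ d × paint τ d z c y ≡ c y)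
    paint-value {c} d z y = cases (y ≟ d) (y ≟ partner τ d)
      where
      cases : Dec (y ≡ d) → Dec (y ≡ partner τ d) →
              (paint τ d z c y ≡ z) ⊎ (y ≢ d × y ≢ partner τ d × paint τ d z c y ≡ c y)
      cases (yes refl) _ = inj₁ (paint-at τ d z c)
      cases (no _) (yes refl) = inj₁ (paint-partner τ d z c)
      cases (no y≢d) (no y≢τd) = inj₂ (y≢d , y≢τd , paint-other τ z c y≢d y≢τd)

    finish : ∀ {c z} → Proper κ c → Missing κ c (vt x) z → Missing κ c (vt (partner τ x)) z →
             c x′ ≢ z → Goal
    finish {c} {z} p miss miss′ ≢z =
      paint τ x z c , proper-unrestrict τ (paint-proper τ alive-x p apart) ,
      λ e → ≢z (trans (sym (paint-other τ z c x′≢x x′≢τx)) (trans (sym e) (paint-at τ x z c)))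
      where
      apart : ∀ y → Near τ [] x y → c y ≢ z
      apart y (near y≢x y≢τx a t) = [ miss alive′ , miss′ alive′ ]′ t
        where
        alive′ : Alive κ y
        alive′ = alive-restrict τ (proj₁ (restrict-alive τ a))
                   (λ { (here e) → y≢x e }) (λ { (here e) → y≢τx (sym (partner-swap τ e)) })

    repaint : ∀ {c d z} → Proper κ c → Alive κ d → Missing κ c (vt d) z →
              Missing κ c (vt (partner τ d)) z → Proper κ (paint τ d z c)
    repaint p a miss miss′ = paint-proper τ (proj₁ (restrict-alive τ a)) (proper-weaken τ there p)
      λ { y (near _ _ ay t) → [ miss ay , miss′ ay ]′ t }

    keeps : ∀ {c v l} d {z} → l ≢ z → Missing κ c v l → Missing κ (paint τ d z c) v l
    keeps {c} d {z} l≢z miss {y} a at e with paint-value {c} d z y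
    ... | inj₁ eq = l≢z (trans (sym e) eq)
    ... | inj₂ (_ , _ , eq) = miss a at (trans (sym eq) e)

    vacates : ∀ {c d z} → Proper κ c → Alive κ d → c d ≢ z → Missing κ (paint τ d z c) (vt d) (c d)
    vacates {c} {d} {z} p a ≢z {y} ay at e with paint-value {c} d z y
    ... | inj₁ eq = ≢z (trans (sym e) eq)
    ... | inj₂ (y≢d , _ , eq) = clash p ay a y≢d at (trans (sym eq) e)

    across : ∀ {c d} → Proper κ c → Alive κ d → c (partner τ d) ≡ c d
    across {c} {d} p a =
      let _ , d∉ , τd∉ = restrict-alive τ a in
      trans (cong c (sym (restrict-partner τ d∉ τd∉))) (match p d)

    untouched : ∀ {c d z} → Proper κ c → Alive κ d → ∀ y → c y ≢ c d → paint τ d z c y ≡ c y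
    untouched {c} {d} {z} p a y ≢cd =
      paint-other τ z c (λ { refl → ≢cd refl }) (λ { refl → ≢cd (across p a) })

    -- A fan with one blade: `d` takes `z`, and its old colour passes to `x`.
    shift : ∀ {c d z} → Proper κ c → Alive κ d → vt d ≡ vt x → Missing κ c (vt x) z →
            Missing κ c (vt (partner τ d)) z → Missing κ c (vt (partner τ x)) (c d) →
            c d ≢ z → c x′ ≢ c d → Goal
    shift {c} {d} {z} p a at miss miss′ miss″ ≢z ≢x′ =
      finish (repaint p a (subst (λ v → Missing κ c v z) (sym at) miss) miss′)
        (subst (λ v → Missing κ (paint τ d z c) v (c d)) at (vacates p a ≢z))
        (keeps d ≢z miss″)
        (λ e → ≢x′ (trans (sym (untouched p a x′ ≢x′)) e))

    -- A fan with two blades: `e` takes `z`, `d` takes the colour of `e`, and `x` takes that of `d`.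
    shift₂ : ∀ {c d e z} → Proper κ c → Alive κ d → vt d ≡ vt x → Alive κ e → vt e ≡ vt x →
             Missing κ c (vt x) z → Missing κ c (vt (partner τ e)) z →
             Missing κ c (vt (partner τ d)) (c e) → Missing κ c (vt (partner τ x)) (c d) →
             c d ≢ z → c e ≢ z → c d ≢ c e → c x′ ≢ c d → c x′ ≢ c e → Goal
    shift₂ {c} {d} {e} {z} p ad at-d ae at-e miss miss-e miss-d miss-x d≢z e≢z d≢e x′≢d x′≢e =
      shift {c′} {d} {c e} p′ ad at-d
        (subst (λ v → Missing κ c′ v (c e)) at-e (vacates p ae e≢z))
        (keeps e e≢z miss-d)
        (subst (Missing κ c′ (vt (partner τ x))) (sym d-kept) (keeps e d≢z miss-x))
        (λ eq → d≢e (trans (sym d-kept) eq))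
        (λ eq → x′≢d (trans (sym (untouched p ae x′ x′≢e)) (trans eq d-kept)))
      where
      c′ = paint τ e z c
      p′ = repaint p ae (subst (λ v → Missing κ c v z) (sym at-e) miss) miss-e
      d-kept : c′ d ≡ c d
      d-kept = untouched p ae d d≢e

    -- Vizing's fan at vt x: with x uncoloured, i = c y₁ is missing at the far end of x,
    -- j = c w₁ at vt x, and the old colour o of x at both; some shift of the fan, possibly
    -- after exchanging i and j along one chain, colours x with i or j.
    fan : ∀ {c o y₁ w₁} → Proper κ c → c x′ ≡ o →
          Missing κ c (vt x) o → Missing κ c (vt (partner τ x)) o →
          Alive κ y₁ → vt y₁ ≡ vt x → Missing κ c (vt (partner τ x)) (c y₁) →
          Alive κ w₁ → vt w₁ ≡ vt (partner τ x) → Missing κ c (vt x) (c w₁) →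
          o ≢ c y₁ → o ≢ c w₁ → Goal
    fan {c} {o} {y₁} {w₁} p x′≡o miss-yo miss-wo a₁ at₁ miss-wi′ aw at-w miss-yj′ o≢i o≢j
      with present? κ c (vt (partner τ y₁)) (c w₁) | present? κ c (vt (partner τ y₁)) o
         | some-missing κ c (partner τ y₁)
    ... | inj₂ miss | _ | _ = shift p a₁ at₁ miss-yj′ miss miss-wi′ (miss-yj′ a₁ at₁) (o≢i ∘ trans (sym x′≡o))
    ... | inj₁ _ | inj₂ miss | _ = shift p a₁ at₁ miss-yo miss miss-wi′ (o≢i ∘ sym) (o≢i ∘ trans (sym x′≡o))
    -- The far end of `y₁` sees the three colours `c y₁`, `c w₁` and `o`, so `z`, missing there, is
    -- the fourth.
    ... | inj₁ (u , au , at-u , eq-u) | inj₁ (u′ , au′ , at-u′ , eq-u′) | z , miss-l , i≢l′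
      with present? κ c (vt x) z
    ... | inj₂ miss = shift p a₁ at₁ miss miss-l miss-wi′ i≢l (o≢i ∘ trans (sym x′≡o))
      where
      i≢l : c y₁ ≢ z
      i≢l e = i≢l′ (trans (across p a₁) e)
    ... | inj₁ (y₂ , a₂ , at₂ , refl)
      with present? κ c (vt (partner τ y₂)) (c w₁) | present? κ c (vt (partner τ y₂)) o
         | some-missing κ c (partner τ y₂)
    ... | inj₂ miss | _ | _ = shift₂ p a₁ at₁ a₂ at₂ miss-yj′ miss miss-l miss-wi′
            (miss-yj′ a₁ at₁) (miss-yj′ a₂ at₂) (λ e → i≢l′ (trans (across p a₁) e))
            (o≢i ∘ trans (sym x′≡o)) (λ e → miss-yo a₂ at₂ (trans (sym e) x′≡o))
    ... | inj₁ _ | inj₂ miss | _ = shift₂ p a₁ at₁ a₂ at₂ miss-yo miss miss-l miss-wi′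
            (o≢i ∘ sym) (miss-yo a₂ at₂) (λ e → i≢l′ (trans (across p a₁) e))
            (o≢i ∘ trans (sym x′≡o)) (λ e → miss-yo a₂ at₂ (trans (sym e) x′≡o))
    -- The far end of `y₂` sees `l`, `j` and `o`, hence misses `i`. Now `w₁`, `y₁` and `t` are all
    -- ends of i/j-chains; the chain from `w₁` has only one other end, so it avoids `y₁` or `t`.
    ... | inj₁ (t , at , at-t , eq-t) | inj₁ (t′ , at′ , at-t′ , eq-t′) | n , miss-n , l≢n′ = chain
      where
      i = c y₁
      j = c w₁
      l = c y₂
      i≢j : i ≢ j
      i≢j = miss-yj′ a₁ at₁
      i≢l : i ≢ l
      i≢l e = i≢l′ (trans (across p a₁) e)
      o≢l : o ≢ l
      o≢l e = miss-yo a₂ at₂ (sym e)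
      j≢l : j ≢ l
      j≢l e = miss-yj′ a₂ at₂ (sym e)
      n≡i : n ≡ i
      n≡i = four-colours o≢j o≢l o≢i j≢l (i≢j ∘ sym) (i≢l ∘ sym)
              (λ e → miss-n at′ at-t′ (trans eq-t′ (sym e)))
              (λ e → miss-n at at-t (trans eq-t (sym e)))
              (λ e → l≢n′ (trans (across p a₂) (sym e)))
      miss-ti : Missing κ c (vt (partner τ y₂)) i
      miss-ti = subst (Missing κ c _) n≡i miss-n
      only-w : ∀ {d} → Alive κ d → vt d ≡ vt w₁ → Among i j (c d) → d ≡ w₁
      only-w ad vd (inj₁ e) = contradiction e (miss-wi′ ad (trans vd at-w))
      only-w {d} ad vd (inj₂ e) with d ≟ w₁
      ... | yes eq = eq
      ... | no ne = contradiction e (clash p ad aw ne vd)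
      open Chain κ p i≢j aw (inj₂ refl) only-w
      last-y₁ : Last y₁
      last-y₁ = (λ { refl → loopless τ alive-x (trans (sym at-w) at₁) }) , only
        where
        only : ∀ {e} → Live e → vt e ≡ vt y₁ → e ≡ y₁
        only (ae , inj₂ eq) ve = contradiction eq (miss-yj′ ae (trans ve at₁))
        only {e} (ae , inj₁ eq) ve with e ≟ y₁
        ... | yes r = r
        ... | no ne = contradiction eq (clash p ae a₁ ne ve)
      last-t : Last t
      last-t = (λ { refl → miss-wo at′ (trans at-t′ (trans (sym at-t) at-w)) eq-t′ }) , only
        where
        only : ∀ {e} → Live e → vt e ≡ vt t → e ≡ t
        only (ae , inj₁ eq) ve = contradiction eq (miss-ti ae (trans ve at-t))
        only {e} (ae , inj₂ eq) ve with e ≟ t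
        ... | yes r = r
        ... | no ne = contradiction (trans eq (sym eq-t)) (clash p ae at ne ve)
      w₁-in : InChain w₁
      w₁-in = inj₁ ε
      new-w₁ : exchange w₁ ≡ i
      new-w₁ = trans (exchange-in w₁-in) (flip-right i≢j)
      o-other : ¬ Among i j o
      o-other = [ o≢i , o≢j ]′
      l-other : ¬ Among i j l
      l-other = [ i≢l ∘ sym , j≢l ∘ sym ]′
      x′-kept : exchange x′ ≡ o
      x′-kept = trans (exchange-other (o-other ∘ subst (Among i j) x′≡o)) x′≡o
      miss-wj : Missing κ exchange (vt (partner τ x)) j
      miss-wj {d} ad vd e with only-w ad (trans vd (sym at-w)) (exchange-among (inj₂ e))
      ... | refl = i≢j (trans (sym new-w₁) e)
      chain : Goal
      chain with inChain? y₁
      -- The exchange turns `w₁` from `j` to `i` and leaves `y₁` alone, so `j` is missing at both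
      -- ends of `x`.
      ... | no ¬in = finish exchange-proper miss-y miss-wj (λ e → o≢j (trans (sym x′-kept) e))
        where
        miss-y : Missing κ exchange (vt x) j
        miss-y {d} ad vd e with proj₂ last-y₁ (ad , exchange-among (inj₂ e)) (trans vd (sym at₁))
        ... | refl = i≢j (trans (sym (exchange-out ¬in)) e)
      -- Now `y₁` has turned to `j` while `t` has kept `j`, so `i` is missing at `vt x` and at the
      -- far end of `y₂`: `y₂` takes `i`, `y₁` takes `l`, and `x` takes `j`.
      ... | yes in-y = shift₂ exchange-proper a₁ at₁ a₂ at₂
              miss-y miss-t (subst (Missing κ exchange _) (sym new-y₂) miss-l′)
              (subst (Missing κ exchange _) (sym new-y₁) miss-wj)
              (λ e → i≢j (sym (trans (sym new-y₁) e))) (λ e → i≢l (sym (trans (sym new-y₂) e)))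
              (λ e → j≢l (trans (sym new-y₁) (trans e new-y₂)))
              (λ e → o≢j (trans (sym x′-kept) (trans e new-y₁)))
              (λ e → o≢l (trans (sym x′-kept) (trans e new-y₂)))
        where
        new-y₁ : exchange y₁ ≡ j
        new-y₁ = trans (exchange-in in-y) (flip-left i j)
        new-y₂ : exchange y₂ ≡ l
        new-y₂ = exchange-other l-other
        t-out : ¬ InChain t
        t-out in-t = i≢j (trans (cong c (last-unique last-y₁ last-t in-y in-t)) eq-t)
        miss-y : Missing κ exchange (vt x) i
        miss-y {d} ad vd e with proj₂ last-y₁ (ad , exchange-among (inj₁ e)) (trans vd (sym at₁))
        ... | refl = i≢j (trans (sym e) new-y₁)
        miss-t : Missing κ exchange (vt (partner τ y₂)) i
        miss-t {d} ad vd e with proj₂ last-t (ad , exchange-among (inj₁ e)) (trans vd (sym at-t))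
        ... | refl = i≢j (trans (sym e) (trans (exchange-out t-out) eq-t))
        miss-l′ : Missing κ exchange (vt (partner τ y₁)) l
        miss-l′ {d} ad vd e with among? i j (c d)
        ... | no ¬a = miss-l ad vd (trans (sym (exchange-other ¬a)) e)
        ... | yes a with inChain? d
        ... | yes _ = l-other (subst (Among i j) e (flip-among i j (c d)))
        ... | no _ = miss-l ad vd e

    separate : ∀ {c} → Proper τ c → c x ≡ c x′ → Goal
    separate {c} proper same
      with some-missing τ c (partner τ x) | some-missing τ c x
    ... | i , miss-wi , o′≢i | j , miss-yj , o≢j = colour
      where
      o = c x
      p : Proper κ c
      p = proper-restrict τ (x ∷ []) proper
      down : ∀ {v z} → Missing τ c v z → Missing κ c v z
      down miss a = miss (proj₁ (restrict-alive τ a))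
      miss-wi′ : Missing κ c (vt (partner τ x)) i
      miss-wi′ = down miss-wi
      miss-yj′ : Missing κ c (vt x) j
      miss-yj′ = down miss-yj
      o≢i : o ≢ i
      o≢i e = o′≢i (trans (match proper x) e)
      x′≢ : ∀ {z} → o ≢ z → c x′ ≢ z
      x′≢ o≢z e = o≢z (trans same e)
      miss-yo : Missing κ c (vt x) o
      miss-yo {y} a at e =
        let a′ , y∉ , _ = restrict-alive τ a in clash proper a′ alive-x (λ { refl → y∉ (here refl) }) at e
      miss-wo : Missing κ c (vt (partner τ x)) o
      miss-wo {y} a at e =
        let a′ , _ , τy∉ = restrict-alive τ a in
        clash proper a′ (alive-partner τ alive-x) (λ { refl → τy∉ (here (involutive τ x)) }) at
          (trans e (sym (match proper x)))
      colour : Goal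
      colour with present? κ c (vt x) i | present? κ c (vt (partner τ x)) j
      ... | inj₂ miss | _ = finish p miss miss-wi′ (x′≢ o≢i)
      ... | inj₁ _ | inj₂ miss = finish p miss-yj′ miss (x′≢ o≢j)
      ... | inj₁ (y₁ , a₁ , at₁ , e₁) | inj₁ (w₁ , aw , at-w , ew) =
        fan p (sym same) miss-yo miss-wo
          a₁ at₁ (subst (Missing κ c _) (sym e₁) miss-wi′)
          aw at-w (subst (Missing κ c _) (sym ew) miss-yj′)
          (λ e → o≢i (trans e e₁)) (λ e → o≢j (trans e ew))

-- Parallel and crossed colourings

module Edges {D : Set} (_≟_ : DecidableEquality D) (darts : List D)
             (complete : ∀ x → x ∈ darts)
             {V : Set} (_≟ᵥ_ : DecidableEquality V) (vt : D → V)
             (corner : ∀ x → ∃₂ (Corner vt x)) where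

  open Recolouring _≟_ darts complete 3 public
  open Pairings _≟_ darts complete 3 vt public
  open Separation _≟_ darts complete _≟ᵥ_ vt corner public using (module Separate)

  record Edge (σ : Pairing) : Set where
    field
      U₀ U₁ U₂ V₁ V₂ : D
      alive-U₀ : Alive σ U₀
      corner-U : Corner vt U₀ U₁ U₂
      corner-V : Corner vt (partner σ U₀) V₁ V₂
    V₀ = partner σ U₀
    u = vt U₀
    v = vt V₀
    w = vt (partner σ U₁)
    x = vt (partner σ U₂)
    y = vt (partner σ V₁)
    z = vt (partner σ V₂)

  module _ {σ : Pairing} where

    flipped : Edge σ → Edge σ
    flipped E = record { U₀ = U₀ ; U₁ = U₁ ; U₂ = U₂ ; V₁ = V₂ ; V₂ = V₁
                       ; alive-U₀ = alive-U₀ ; corner-U = corner-U ; corner-V = corner-swap corner-V }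
      where open Edge E

    mirrored : Edge σ → Edge σ
    mirrored E = record { U₀ = U₀ ; U₁ = U₂ ; U₂ = U₁ ; V₁ = V₂ ; V₂ = V₁
                        ; alive-U₀ = alive-U₀ ; corner-U = corner-swap corner-U
                        ; corner-V = corner-swap corner-V }
      where open Edge E

    reversed : Edge σ → Edge σ
    reversed E = record { U₀ = V₀ ; U₁ = V₁ ; U₂ = V₂ ; V₁ = U₁ ; V₂ = U₂
                        ; alive-U₀ = alive-partner σ alive-U₀ ; corner-U = corner-V
                        ; corner-V = subst (λ d → Corner vt d U₁ U₂) (sym (involutive σ U₀)) corner-U }
      where open Edge E

    Parallel : Edge σ → Assignment → Set
    Parallel E c = c U₁ ≡ c V₁ ⊎ c U₂ ≡ c V₂
      where open Edge E

    Crossed : Edge σ → Assignment → Set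
    Crossed E c = Parallel (flipped E) c

    -- The condition for the replacement edges w - y and x - z not to be loops. Together with
    -- `Straight (flipped E)` it says that the edge lies in no triangle.
    record Straight (E : Edge σ) : Set where
      constructor straight
      open Edge E
      field
        w≢y : w ≢ y
        x≢z : x ≢ z

    straight-mirrored : ∀ {E} → Straight E → Straight (mirrored E)
    straight-mirrored (straight w≢y x≢z) = straight x≢z w≢y

  record Simple (σ : Pairing) : Set where
    field
      full   : ∀ {d e} → Alive σ d → vt e ≡ vt d → Alive σ e
      simple : ∀ {d e} → Alive σ d → vt d ≡ vt e → d ≢ e → vt (partner σ d) ≢ vt (partner σ e)

  distinct : ∀ {d e : D} {p q : V} → vt d ≡ p → vt e ≡ q → p ≢ q → d ≢ e
  distinct dp eq p≢q refl = p≢q (trans (sym dp) eq)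

  module Facts {σ : Pairing} (S : Simple σ) (E : Edge σ) where
    open Simple S public
    open Edge E public
    module U = Corner corner-U
    module V = Corner corner-V

    W = partner σ U₁
    X = partner σ U₂
    Y = partner σ V₁
    Z = partner σ V₂

    σV₀ : partner σ V₀ ≡ U₀
    σV₀ = involutive σ U₀

    alive-V₀ : Alive σ V₀
    alive-V₀ = alive-partner σ alive-U₀
    alive-U₁ = full alive-U₀ U.at-y
    alive-U₂ = full alive-U₀ U.at-z
    alive-V₁ = full alive-V₀ V.at-y
    alive-V₂ = full alive-V₀ V.at-z
    alive-W = alive-partner σ alive-U₁
    alive-X = alive-partner σ alive-U₂
    alive-Y = alive-partner σ alive-V₁
    alive-Z = alive-partner σ alive-V₂

    v≢u : v ≢ u
    v≢u = loopless σ alive-U₀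
    w≢u : w ≢ u
    w≢u e = loopless σ alive-U₁ (trans e (sym U.at-y))
    x≢u : x ≢ u
    x≢u e = loopless σ alive-U₂ (trans e (sym U.at-z))
    y≢v : y ≢ v
    y≢v e = loopless σ alive-V₁ (trans e (sym V.at-y))
    z≢v : z ≢ v
    z≢v e = loopless σ alive-V₂ (trans e (sym V.at-z))
    w≢v : w ≢ v
    w≢v = simple alive-U₁ U.at-y (U.x≢y ∘ sym)
    x≢v : x ≢ v
    x≢v = simple alive-U₂ U.at-z (U.x≢z ∘ sym)
    y≢u : y ≢ u
    y≢u e = simple alive-V₁ V.at-y (V.x≢y ∘ sym) (trans e (cong vt (sym σV₀)))
    z≢u : z ≢ u
    z≢u e = simple alive-V₂ V.at-z (V.x≢z ∘ sym) (trans e (cong vt (sym σV₀)))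
    w≢x : w ≢ x
    w≢x = simple alive-U₁ (trans U.at-y (sym U.at-z)) U.y≢z
    y≢z : y ≢ z
    y≢z = simple alive-V₁ (trans V.at-y (sym V.at-z)) V.y≢z

  module Classes {σ : Pairing} (S : Simple σ) (IH : ∀ τ → size τ < size σ → Connected (Proper τ))
                 (E : Edge σ) (E-straight : Straight E) where
    open Facts S E
    open Straight E-straight

    -- Edges return in the order of the list `S₅`: `U₁` and `V₁` together, through the replacement
    -- edge, then `U₂`, then `V₂`, and last `U₀`, whose four neighbours show only three colours
    -- thanks to the tie.
    S₁ S₂ S₃ S₄ S₅ : List D
    S₁ = U₀ ∷ []
    S₂ = V₂ ∷ S₁
    S₃ = U₂ ∷ S₂
    S₄ = V₁ ∷ S₃
    S₅ = U₁ ∷ S₄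

    ∉-by : ∀ {d} {ds : List D} → All (d ≢_) ds → d ∉ ds
    ∉-by = All¬⇒¬Any

    outside : ∀ {d} → vt d ≢ u → vt d ≢ v → d ∉ S₅
    outside d≢u d≢v = ∉-by ((λ { refl → d≢u U.at-y }) ∷ (λ { refl → d≢v V.at-y }) ∷
      (λ { refl → d≢u U.at-z }) ∷ (λ { refl → d≢v V.at-z }) ∷ (λ { refl → d≢u refl }) ∷ [])

    dead-W : ¬ Alive (restrict σ S₅) W
    dead-W = dead-restrict σ (inj₂ (here (involutive σ U₁)))
    dead-Y : ¬ Alive (restrict σ S₅) Y
    dead-Y = dead-restrict σ (inj₂ (there (here (involutive σ V₁))))
    dead-X : ¬ Alive (restrict σ S₅) X
    dead-X = dead-restrict σ (inj₂ (there (there (here (involutive σ U₂)))))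
    dead-Z : ¬ Alive (restrict σ S₅) Z
    dead-Z = dead-restrict σ (inj₂ (there (there (there (here (involutive σ V₂))))))

    -- The graph without u and v, with an edge w—y standing for both U₁ and V₁.
    module J = Join (restrict σ S₅) dead-W dead-Y w≢y
    τ = J.joined

    dead-τ : ∀ {d} → d ≢ W → d ≢ Y → ¬ Alive (restrict σ S₅) d → ¬ Alive τ d
    dead-τ d≢W d≢Y dead a = [ d≢W , [ d≢Y , dead ]′ ]′ (J.joined-alive a)

    dead-in : ∀ {d} → d ∈ S₅ → ¬ Alive (restrict σ S₅) d
    dead-in d∈ = dead-restrict σ (inj₁ d∈)

    U₀∈ : U₀ ∈ S₅
    U₀∈ = there (there (there (there (here refl))))

    τ-dead-U₀ : ¬ Alive τ U₀
    τ-dead-U₀ = dead-τ (distinct refl refl (w≢u ∘ sym)) (distinct refl refl (y≢u ∘ sym)) (dead-in U₀∈)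
    τ-dead-U₁ : ¬ Alive τ U₁
    τ-dead-U₁ = dead-τ (distinct U.at-y refl (w≢u ∘ sym)) (distinct U.at-y refl (y≢u ∘ sym)) (dead-in (here refl))
    τ-dead-V₁ : ¬ Alive τ V₁
    τ-dead-V₁ = dead-τ (distinct V.at-y refl (w≢v ∘ sym)) (distinct V.at-y refl (y≢v ∘ sym)) (dead-in (there (here refl)))

    alive-below : ∀ {d} → Alive (restrict σ S₅) d → Alive σ d
    alive-below = proj₁ ∘ restrict-alive σ

    τ-alive : ∀ {d} → Alive τ d → Alive σ d
    τ-alive a = [ (λ { refl → alive-W }) , [ (λ { refl → alive-Y }) , alive-below ]′ ]′ (J.joined-alive a)

    τ-connected : Connected (Proper τ)
    τ-connected = IH τ (size-< {σ} {τ} τ-alive alive-U₀ τ-dead-U₀)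

    alive-in-τ : ∀ {d} → Alive σ d → vt d ≢ u → vt d ≢ v → d ≢ X → d ≢ Z → Alive τ d
    alive-in-τ {d} a d≢u d≢v d≢X d≢Z with d ≟ W | d ≟ Y
    ... | yes d≡W | _ = J.alive-joined (inj₁ d≡W)
    ... | no _ | yes d≡Y = J.alive-joined (inj₂ (inj₁ d≡Y))
    ... | no d≢W | no d≢Y = J.alive-joined (inj₂ (inj₂ (alive-restrict σ a (outside d≢u d≢v)
      (∉-by (back d≢W ∷ back d≢Y ∷ back d≢X ∷ back d≢Z ∷
             (λ e → d≢v (cong vt (sym (partner-swap σ e)))) ∷ [])))))
      where
      back : ∀ {e} → d ≢ partner σ e → partner σ d ≢ e
      back d≢ eq = d≢ (sym (partner-swap σ eq))

    facing : ∀ {d e ds} → Alive (restrict σ ds) d → e ∈ ds → d ≢ partner σ e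
    facing {e = e} {ds} a e∈ refl = proj₂ (proj₂ (restrict-alive σ a)) (subst (_∈ ds) (sym (involutive σ e)) e∈)

    member : ∀ {d e ds} → Alive (restrict σ ds) d → e ∈ ds → d ≢ e
    member a e∈ refl = proj₁ (proj₂ (restrict-alive σ a)) e∈

    at-u : ∀ {d} {P : Set} → vt d ≡ u → d ≢ U₀ → (d ≡ U₁ → P) → (d ≡ U₂ → P) → P
    at-u du d≢U₀ f g = [ (λ e → contradiction e d≢U₀) , [ f , g ]′ ]′ (U.cover du)

    at-v : ∀ {d} {P : Set} → vt d ≡ v → d ≢ V₀ → (d ≡ V₁ → P) → (d ≡ V₂ → P) → P
    at-v dv d≢V₀ f g = [ (λ e → contradiction e d≢V₀) , [ f , g ]′ ]′ (V.cover dv)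

    -- The replacement edge is cut in the middle: its colour already avoids all others at w and at
    -- y, and nothing else is present yet at u or v.
    unmerge : ∀ {c} → Proper τ c → c U₁ ≡ c W → c V₁ ≡ c W → Proper (restrict σ S₃) c
    unmerge {c} p eqU eqV = p₃
      where
      W=Y : c Y ≡ c W
      W=Y = trans (cong c (sym J.partner-p)) (match p W)
      τ-W : Alive τ W
      τ-W = J.alive-joined (inj₁ refl)
      τ-Y : Alive τ Y
      τ-Y = J.alive-joined (inj₂ (inj₁ refl))
      p₄ : Proper (restrict σ S₄) c
      p₄ = proper-insert σ alive-U₁ (J.proper-unjoin p) (sym eqU) apart
        where
        apart : ∀ d → Near σ S₄ U₁ d → c d ≢ c U₁
        apart d (near d≢ d≢σ a (inj₁ at)) = at-u (trans at U.at-y)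
          (member a (there (there (there (here refl))))) (λ e → contradiction e d≢)
          (λ e → contradiction e (member a (there (here refl))))
        apart d (near d≢ d≢σ a (inj₂ at)) e =
          clash p (alive-in-τ (proj₁ (restrict-alive σ a)) (w≢u ∘ trans (sym at)) (w≢v ∘ trans (sym at))
                    (facing a (there (here refl))) (facing a (there (there (here refl)))))
            τ-W d≢σ at (trans e eqU)
      p₃ : Proper (restrict σ S₃) c
      p₃ = proper-insert σ alive-V₁ p₄ (trans W=Y (sym eqV)) apart
        where
        apart : ∀ d → Near σ S₃ V₁ d → c d ≢ c V₁
        apart d (near d≢ d≢σ a (inj₁ at)) = at-v (trans at V.at-y)
          (facing a (there (there (here refl)))) (λ e → contradiction e d≢)
          (λ e → contradiction e (member a (there (here refl))))
        apart d (near d≢ d≢σ a (inj₂ at)) e =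
          clash p (alive-in-τ (proj₁ (restrict-alive σ a)) (y≢u ∘ trans (sym at)) (y≢v ∘ trans (sym at))
                    (facing a (here refl)) (facing a (there (here refl))))
            τ-Y d≢σ at (trans e (trans eqV (sym W=Y)))

    Tied : Assignment → Set
    Tied c = c U₁ ≡ c V₁

    off-u-v : ∀ {d} → d ≢ U₁ → d ≢ V₁ → Free Tied d
    off-u-v d≢U₁ d≢V₁ off eq = trans (sym (off U₁ (d≢U₁ ∘ sym))) (trans eq (off V₁ (d≢V₁ ∘ sym)))

    R₃-W : Alive (restrict σ S₃) W
    R₃-W = alive-restrict σ alive-W
      (∉-by (distinct refl U.at-z w≢u ∷ distinct refl V.at-z w≢v ∷ distinct refl refl w≢u ∷ []))
      (∉-by ((λ e → U.y≢z (trans (sym (involutive σ U₁)) e)) ∷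
             (λ e → distinct U.at-y V.at-z (v≢u ∘ sym) (trans (sym (involutive σ U₁)) e)) ∷
             (λ e → U.x≢y (trans (sym e) (involutive σ U₁))) ∷ []))

    R₃-Y : Alive (restrict σ S₃) Y
    R₃-Y = alive-restrict σ alive-Y
      (∉-by (distinct refl U.at-z y≢u ∷ distinct refl V.at-z y≢v ∷ distinct refl refl y≢u ∷ []))
      (∉-by ((λ e → distinct V.at-y U.at-z v≢u (trans (sym (involutive σ V₁)) e)) ∷
             (λ e → V.y≢z (trans (sym (involutive σ V₁)) e)) ∷
             (λ e → distinct V.at-y refl v≢u (trans (sym (involutive σ V₁)) e)) ∷ []))

    R-partner : ∀ {ds c} d → Alive (restrict σ ds) d → Proper (restrict σ ds) c → c (partner σ d) ≡ c d
    R-partner {ds} {c} d a p =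
      let _ , d∉ , σd∉ = restrict-alive σ a in
      trans (cong c (sym (restrict-partner σ d∉ σd∉))) (match p d)

    merge : ∀ {c} → Proper (restrict σ S₃) c → Tied c → Proper τ c × c U₁ ≡ c W × c V₁ ≡ c W
    merge {c} p tied = J.proper-join (proper-weaken σ (there ∘ there) p) (trans (sym eqU) (trans tied eqV)) apart ,
                       eqU , trans (sym tied) eqU
      where
      eqU : c U₁ ≡ c W
      eqU = trans (cong c (sym (involutive σ U₁))) (R-partner W R₃-W p)
      eqV : c V₁ ≡ c Y
      eqV = trans (cong c (sym (involutive σ V₁))) (R-partner Y R₃-Y p)
      lift : ∀ {d} → Alive (restrict σ S₅) d → Alive (restrict σ S₃) d
      lift a = let a′ , d∉ , σd∉ = restrict-alive σ a in
               alive-restrict σ a′ (d∉ ∘ there ∘ there) (σd∉ ∘ there ∘ there)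
      apart : ∀ d → Alive (restrict σ S₅) d → vt d ≡ w ⊎ vt d ≡ y → c d ≢ c W
      apart d a (inj₁ at) = clash p (lift a) R₃-W (facing a (here refl)) at
      apart d a (inj₂ at) e = clash p (lift a) R₃-Y (facing a (there (here refl))) at
        (trans e (trans (sym eqU) (trans tied eqV)))

    tied₃ : Connected (λ c → Proper (restrict σ S₃) c × Tied c)
    tied₃ = transport (λ { ((p , eqU) , eqV) → unmerge p eqU eqV , trans eqU (sym eqV) })
                      (λ { (p , t) → let p′ , eqU , eqV = merge p t in (p′ , eqU) , eqV })
      (copy free₂ (distinct V.at-y refl (w≢v ∘ sym))
        (copy (λ off p → proper-free τ-dead-U₁ off p) (distinct U.at-y refl (w≢u ∘ sym)) τ-connected))
      where
      free₂ : Free (λ c → Proper τ c × c U₁ ≡ c W) V₁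
      free₂ off (p , e) = proper-free τ-dead-V₁ off p ,
        trans (sym (off U₁ (distinct U.at-y V.at-y (v≢u ∘ sym)))) (trans e (off W (distinct refl V.at-y w≢v)))

    -- While `U₀` is absent, `U₂` has one neighbour at u and two at x, which is within the bound of
    -- three.
    tied₂ : Connected (λ c → Proper (restrict σ S₂) c × Tied c)
    tied₂ with corner X
    ... | X₁ , X₂ , kX = insert-edge σ alive-R
        (near-U₁ ∷ near-X (kX.x≢y ∘ sym) kX.at-y ∷ near-X (kX.x≢z ∘ sym) kX.at-z ∷ [])
        ℕₚ.≤-refl
        (off-u-v (U.y≢z ∘ sym) (distinct U.at-z V.at-y (v≢u ∘ sym)))
        (off-u-v (distinct refl U.at-y x≢u) (distinct refl V.at-y x≢v))
        cover tied₃
      where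
      module kX = Corner kX
      alive-R : Alive (restrict σ S₂) U₂
      alive-R = alive-restrict σ alive-U₂
        (∉-by (distinct U.at-z V.at-z (v≢u ∘ sym) ∷ (U.x≢z ∘ sym) ∷ []))
        (∉-by (distinct refl V.at-z x≢v ∷ distinct refl refl x≢u ∷ []))
      near-U₁ : Near σ S₂ U₂ U₁
      near-U₁ = near U.y≢z (distinct U.at-y refl (x≢u ∘ sym))
        (alive-restrict σ alive-U₁
          (∉-by (distinct U.at-y V.at-z (v≢u ∘ sym) ∷ (U.x≢y ∘ sym) ∷ []))
          (∉-by (distinct refl V.at-z w≢v ∷ distinct refl refl w≢u ∷ [])))
        (inj₁ (trans U.at-y (sym U.at-z)))
      near-X : ∀ {d} → d ≢ X → vt d ≡ x → Near σ S₂ U₂ d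
      near-X {d} d≢X at = near (distinct at U.at-z x≢u) d≢X
        (alive-restrict σ (full alive-X at)
          (∉-by (distinct at V.at-z x≢v ∷ distinct at refl x≢u ∷ []))
          (∉-by ((λ e → distinct at refl x≢z (sym (partner-swap σ e))) ∷
                 (λ e → distinct at refl x≢v (sym (partner-swap σ e))) ∷ [])))
        (inj₂ at)
      cover : ∀ {c} → Proper (restrict σ S₃) c → Tied c → ∀ d → Near σ S₂ U₂ d →
              ∃ λ n → n ∈ U₁ ∷ X₁ ∷ X₂ ∷ [] × c d ≡ c n
      cover _ _ d (near d≢ d≢σ a (inj₁ at)) = at-u (trans at U.at-z) (member a (there (here refl)))
        (λ { refl → _ , here refl , refl }) (λ e → contradiction e d≢)
      cover _ _ d (near d≢ d≢σ a (inj₂ at)) with kX.cover at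
      ... | inj₁ e = contradiction e d≢σ
      ... | inj₂ (inj₁ refl) = _ , there (here refl) , refl
      ... | inj₂ (inj₂ refl) = _ , there (there (here refl)) , refl

    tied₁ : Connected (λ c → Proper (restrict σ S₁) c × Tied c)
    tied₁ with corner Z
    ... | Z₁ , Z₂ , kZ = insert-edge σ alive-R
        (near-V₁ ∷ near-Z (kZ.x≢y ∘ sym) kZ.at-y ∷ near-Z (kZ.x≢z ∘ sym) kZ.at-z ∷ [])
        ℕₚ.≤-refl
        (off-u-v (distinct V.at-z U.at-y v≢u) (V.y≢z ∘ sym))
        (off-u-v (distinct refl U.at-y z≢u) (distinct refl V.at-y z≢v))
        cover tied₂
      where
      module kZ = Corner kZ
      alive-R : Alive (restrict σ S₁) V₂
      alive-R = alive-restrict σ alive-V₂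
        (∉-by (distinct V.at-z refl v≢u ∷ [])) (∉-by (distinct refl refl z≢u ∷ []))
      near-V₁ : Near σ S₁ V₂ V₁
      near-V₁ = near V.y≢z (distinct V.at-y refl (z≢v ∘ sym))
        (alive-restrict σ alive-V₁
          (∉-by (distinct V.at-y refl v≢u ∷ [])) (∉-by (distinct refl refl y≢u ∷ [])))
        (inj₁ (trans V.at-y (sym V.at-z)))
      near-Z : ∀ {d} → d ≢ Z → vt d ≡ z → Near σ S₁ V₂ d
      near-Z {d} d≢Z at = near (distinct at V.at-z z≢v) d≢Z
        (alive-restrict σ (full alive-Z at)
          (∉-by (distinct at refl z≢u ∷ []))
          (∉-by ((λ e → distinct at refl z≢v (sym (partner-swap σ e))) ∷ [])))
        (inj₂ at)
      cover : ∀ {c} → Proper (restrict σ S₂) c → Tied c → ∀ d → Near σ S₁ V₂ d →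
              ∃ λ n → n ∈ V₁ ∷ Z₁ ∷ Z₂ ∷ [] × c d ≡ c n
      cover _ _ d (near d≢ d≢σ a (inj₁ at)) = at-v (trans at V.at-z) (facing a (here refl))
        (λ { refl → _ , here refl , refl }) (λ e → contradiction e d≢)
      cover _ _ d (near d≢ d≢σ a (inj₂ at)) with kZ.cover at
      ... | inj₁ e = contradiction e d≢σ
      ... | inj₂ (inj₁ refl) = _ , there (here refl) , refl
      ... | inj₂ (inj₂ refl) = _ , there (there (here refl)) , refl

    near-U : ∀ {d} → vt d ≡ u → d ≢ U₀ → Near σ [] U₀ d
    near-U at d≢ = near d≢ (distinct at refl (v≢u ∘ sym))
      (alive-restrict σ (full alive-U₀ at) (λ ()) (λ ())) (inj₁ at)
    near-V : ∀ {d} → vt d ≡ v → d ≢ V₀ → Near σ [] U₀ d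
    near-V at d≢ = near (distinct at refl v≢u) d≢
      (alive-restrict σ (full alive-V₀ at) (λ ()) (λ ())) (inj₂ at)

    tied : Connected (λ c → Proper σ c × Tied c)
    tied = transport (λ { (p , t) → proper-unrestrict σ p , t }) (λ { (p , t) → proper-restrict σ [] p , t })
      (insert-edge σ (alive-restrict σ alive-U₀ (λ ()) (λ ()))
        (near-U U.at-y (U.x≢y ∘ sym) ∷ near-U U.at-z (U.x≢z ∘ sym) ∷ near-V V.at-z (V.x≢z ∘ sym) ∷ [])
        ℕₚ.≤-refl
        (off-u-v U.x≢y (distinct refl V.at-y (v≢u ∘ sym)))
        (off-u-v (distinct refl U.at-y v≢u) V.x≢y)
        cover tied₁)
      where
      cover : ∀ {c} → Proper (restrict σ S₁) c → Tied c → ∀ d → Near σ [] U₀ d →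
              ∃ λ n → n ∈ U₁ ∷ U₂ ∷ V₂ ∷ [] × c d ≡ c n
      cover _ t d (near d≢ d≢σ a (inj₁ at)) =
        at-u at d≢ (λ { refl → _ , here refl , refl }) (λ { refl → _ , there (here refl) , refl })
      cover _ t d (near d≢ d≢σ a (inj₂ at)) =
        at-v at d≢σ (λ { refl → _ , here refl , sym t }) (λ { refl → _ , there (there (here refl)) , refl })

    τ-dead-U₂ : ¬ Alive τ U₂
    τ-dead-U₂ = dead-τ (distinct U.at-z refl (w≢u ∘ sym)) (distinct U.at-z refl (y≢u ∘ sym)) (dead-in (there (there (here refl))))
    τ-dead-V₂ : ¬ Alive τ V₂
    τ-dead-V₂ = dead-τ (distinct V.at-z refl (w≢v ∘ sym)) (distinct V.at-z refl (y≢v ∘ sym)) (dead-in (there (there (there (here refl)))))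

    U₂≢V₁ : U₂ ≢ V₁
    U₂≢V₁ = distinct U.at-z V.at-y (v≢u ∘ sym)
    X≢Y : X ≢ Y
    X≢Y = U₂≢V₁ ∘ partner-injective σ
    Z≢W : Z ≢ W
    Z≢W = distinct V.at-z U.at-y v≢u ∘ partner-injective σ

    -- A further edge x—z stands for both U₂ and V₂; its colour must differ from that of w—y.
    module J′ = Join τ (dead-τ (distinct refl refl (w≢x ∘ sym)) X≢Y dead-X)
                       (dead-τ Z≢W (distinct refl refl (y≢z ∘ sym)) dead-Z) x≢z
    τ′ = J′.joined

    dead-τ′ : ∀ {d} → d ≢ X → d ≢ Z → ¬ Alive τ d → ¬ Alive τ′ d
    dead-τ′ d≢X d≢Z dead a = [ d≢X , [ d≢Z , dead ]′ ]′ (J′.joined-alive a)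

    alive-in-τ′ : ∀ {d} → Alive σ d → vt d ≢ u → vt d ≢ v → Alive τ′ d
    alive-in-τ′ {d} a d≢u d≢v with d ≟ X | d ≟ Z
    ... | yes d≡X | _ = J′.alive-joined (inj₁ d≡X)
    ... | no _ | yes d≡Z = J′.alive-joined (inj₂ (inj₁ d≡Z))
    ... | no d≢X | no d≢Z = J′.alive-joined (inj₂ (inj₂ (alive-in-τ a d≢u d≢v d≢X d≢Z)))

    separated : ∃ λ c → Proper τ′ c × c W ≢ c X
    separated with proj₁ (IH τ′ (size-< {σ} {τ′} below alive-U₀
                     (dead-τ′ (distinct refl refl (x≢u ∘ sym)) (distinct refl refl (z≢u ∘ sym)) τ-dead-U₀)))
      where
      below : ∀ {d} → Alive τ′ d → Alive σ d
      below a = [ (λ { refl → alive-X }) , [ (λ { refl → alive-Z }) , τ-alive ]′ ]′ (J′.joined-alive a)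
    ... | c , p with c W Fin.≟ c X
    ... | no ne = c , p , ne
    ... | yes e = Separate.separate τ′ {W} {X} (alive-in-τ′ alive-W w≢u w≢v)
                    (distinct refl refl (w≢x ∘ sym)) X≢σ′W p e
      where
      X≢σ′W : X ≢ partner τ′ W
      X≢σ′W eq = Z≢W (trans (sym J′.partner-p) (trans (cong (partner τ′) eq) (involutive τ′ W)))

    Doubly : Assignment → Set
    Doubly c = c U₁ ≡ c V₁ × c U₂ ≡ c V₂

    C₀ C₁ C₂ C₃ : Assignment → Set
    C₀ c = Proper τ′ c × c W ≢ c X
    C₁ c = C₀ c × c U₁ ≡ c W
    C₂ c = C₁ c × c V₁ ≡ c W
    C₃ c = C₂ c × c U₂ ≡ c X
    keep : ∀ {c c′ : Assignment} {d e f} → Off d c c′ → e ≢ d → f ≢ d → c e ≡ c f → c′ e ≡ c′ f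
    keep off e≢d f≢d eq = trans (sym (off _ e≢d)) (trans eq (off _ f≢d))
    keep₀ : ∀ {d} → vt d ≡ u ⊎ vt d ≡ v → ¬ Alive τ′ d → Free C₀ d
    keep₀ at dead off (p , ne) = proper-free dead off p ,
      λ e → ne (trans (off W ([ (λ k → distinct refl k w≢u) , (λ k → distinct refl k w≢v) ]′ at))
        (trans e (sym (off X ([ (λ k → distinct refl k x≢u) , (λ k → distinct refl k x≢v) ]′ at)))))
    free₀ : Free C₀ U₁
    free₀ = keep₀ (inj₁ U.at-y) (dead-τ′ (distinct U.at-y refl (x≢u ∘ sym)) (distinct U.at-y refl (z≢u ∘ sym)) τ-dead-U₁)
    free₁ : Free C₁ V₁
    free₁ off (p , e) =
      keep₀ (inj₂ V.at-y) (dead-τ′ (distinct V.at-y refl (x≢v ∘ sym)) (distinct V.at-y refl (z≢v ∘ sym)) τ-dead-V₁) off p ,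
      keep off (distinct U.at-y V.at-y (v≢u ∘ sym)) (distinct refl V.at-y w≢v) e
    free₂ : Free C₂ U₂
    free₂ off ((p , e) , e′) =
      (keep₀ (inj₁ U.at-z) (dead-τ′ (distinct U.at-z refl (x≢u ∘ sym)) (distinct U.at-z refl (z≢u ∘ sym)) τ-dead-U₂) off p ,
       keep off U.y≢z (distinct refl U.at-z w≢u) e) ,
      keep off (U₂≢V₁ ∘ sym) (distinct refl U.at-z w≢u) e′
    free₃ : Free C₃ V₂
    free₃ off (((p , e) , e′) , e″) =
      ((keep₀ (inj₂ V.at-z) (dead-τ′ (distinct V.at-z refl (x≢v ∘ sym)) (distinct V.at-z refl (z≢v ∘ sym)) τ-dead-V₂) off p ,
        keep off (distinct U.at-y V.at-z (v≢u ∘ sym)) (distinct refl V.at-z w≢v) e) ,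
       keep off V.y≢z (distinct refl V.at-z w≢v) e′) ,
      keep off (distinct U.at-z V.at-z (v≢u ∘ sym)) (distinct refl V.at-z x≢v) e″

    copied : ∃ λ c → C₃ c × c V₂ ≡ c X
    copied =
      copy-exists {C = C₃} {X} {V₂} free₃ (distinct V.at-z refl (x≢v ∘ sym))
      (copy-exists {C = C₂} {X} {U₂} free₂ (distinct U.at-z refl (x≢u ∘ sym))
      (copy-exists {C = C₁} {W} {V₁} free₁ (distinct V.at-y refl (w≢v ∘ sym))
      (copy-exists {C = C₀} {W} {U₁} free₀ (distinct U.at-y refl (w≢u ∘ sym)) separated)))

    fill : ∀ {c} → C₃ c × c V₂ ≡ c X → ∃ λ c′ → Proper σ c′ × Doubly c′
    fill {c} (((((p , W≢X) , U₁=W) , V₁=W) , U₂=X) , V₂=X) = paint σ U₀ free c , proper-c′ , tied₁₁ , tied₂₂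
      where
      X=Z : c Z ≡ c X
      X=Z = trans (cong c (sym J′.partner-p)) (match p X)
      p₂ : Proper (restrict σ S₂) c
      p₂ = proper-insert σ alive-U₂ (unmerge (J′.proper-unjoin p) U₁=W V₁=W) (sym U₂=X) apart
        where
        apart : ∀ d → Near σ S₂ U₂ d → c d ≢ c U₂
        apart d (near d≢ d≢σ a (inj₁ at)) = at-u (trans at U.at-z) (member a (there (here refl)))
          (λ { refl e → W≢X (trans (sym U₁=W) (trans e U₂=X)) }) (λ e → contradiction e d≢)
        apart d (near d≢ d≢σ a (inj₂ at)) e =
          clash p (alive-in-τ′ (proj₁ (restrict-alive σ a)) (x≢u ∘ trans (sym at)) (x≢v ∘ trans (sym at)))
            (J′.alive-joined (inj₁ refl)) d≢σ at (trans e U₂=X)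
      p₁ : Proper (restrict σ S₁) c
      p₁ = proper-insert σ alive-V₂ p₂ (trans X=Z (sym V₂=X)) apart
        where
        apart : ∀ d → Near σ S₁ V₂ d → c d ≢ c V₂
        apart d (near d≢ d≢σ a (inj₁ at)) = at-v (trans at V.at-z) (facing a (here refl))
          (λ { refl e → W≢X (trans (sym V₁=W) (trans e V₂=X)) }) (λ e → contradiction e d≢)
        apart d (near d≢ d≢σ a (inj₂ at)) e =
          clash p (alive-in-τ′ (proj₁ (restrict-alive σ a)) (z≢u ∘ trans (sym at)) (z≢v ∘ trans (sym at)))
            (J′.alive-joined (inj₂ (inj₁ refl))) d≢σ at (trans e (trans V₂=X (sym X=Z)))
      -- Around `U₀` only the colours of `W` and `X` occur, each at both ends, so two of the four
      -- colours remain.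
      fresh-colour : ∃ λ k → k ∉ c W ∷ c X ∷ []
      fresh-colour = ∃-fresh (c W ∷ c X ∷ []) (s≤s (s≤s z≤n))
      free = proj₁ fresh-colour
      W≢free : c W ≢ free
      W≢free e = proj₂ fresh-colour (here (sym e))
      X≢free : c X ≢ free
      X≢free e = proj₂ fresh-colour (there (here (sym e)))
      proper-c′ : Proper σ (paint σ U₀ free c)
      proper-c′ = proper-unrestrict σ (paint-proper σ alive-U₀ p₁ apart)
        where
        apart : ∀ d → Near σ [] U₀ d → c d ≢ free
        apart d (near d≢ d≢σ a (inj₁ at)) = at-u at d≢
          (λ { refl e → W≢free (trans (sym U₁=W) e) }) (λ { refl e → X≢free (trans (sym U₂=X) e) })
        apart d (near d≢ d≢σ a (inj₂ at)) = at-v at d≢σ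
          (λ { refl e → W≢free (trans (sym V₁=W) e) }) (λ { refl e → X≢free (trans (sym V₂=X) e) })
      at-U : ∀ {d} → vt d ≡ u → d ≢ U₀ → paint σ U₀ free c d ≡ c d
      at-U at d≢ = paint-other σ free c d≢ (distinct at refl (v≢u ∘ sym))
      at-V : ∀ {d} → vt d ≡ v → d ≢ V₀ → paint σ U₀ free c d ≡ c d
      at-V at d≢ = paint-other σ free c (distinct at refl v≢u) d≢
      tied₁₁ : paint σ U₀ free c U₁ ≡ paint σ U₀ free c V₁
      tied₁₁ = trans (at-U U.at-y (U.x≢y ∘ sym)) (trans U₁=W (trans (sym V₁=W) (sym (at-V V.at-y (V.x≢y ∘ sym)))))
      tied₂₂ : paint σ U₀ free c U₂ ≡ paint σ U₀ free c V₂
      tied₂₂ = trans (at-U U.at-z (U.x≢z ∘ sym)) (trans U₂=X (trans (sym V₂=X) (sym (at-V V.at-z (V.x≢z ∘ sym)))))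

    -- Such a colouring is parallel in both ways at once, hence connects the class `U₁` = `V₁` with
    -- the class `U₂` = `V₂`.
    strong : ∃ λ c → Proper σ c × Doubly c
    strong = fill (proj₂ copied)

-- Changing the type of an edge

module Linking {D : Set} (_≟_ : DecidableEquality D) (darts : List D)
             (complete : ∀ x → x ∈ darts)
             {V : Set} (_≟ᵥ_ : DecidableEquality V) (vt : D → V)
             (corner : ∀ x → ∃₂ (Corner vt x)) where

  open Edges _≟_ darts complete _≟ᵥ_ vt corner public

  module _ {σ : Pairing} (S : Simple σ) (IH : ∀ τ → size τ < size σ → Connected (Proper τ)) where

    Goal : Set
    Goal = Connected (Proper σ)

    joined-by-tie : ∀ {E c c′} → Straight E → Proper σ c → Proper σ c′ →
                    c (Edge.U₁ E) ≡ c (Edge.V₁ E) → c′ (Edge.U₁ E) ≡ c′ (Edge.V₁ E) → Kempe (Proper σ) c c′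
    joined-by-tie {E} st p p′ t t′ =
      Star.gmap id (λ { ((q , _) , (q′ , _) , s) → q , q′ , s })
        (proj₂ (Classes.tied S IH E st) _ _ (p , t) (p′ , t′))

    parallel-joined : ∀ {E c c′} → Straight E → Proper σ c → Proper σ c′ → Parallel E c → Parallel E c′ →
                      Kempe (Proper σ) c c′
    parallel-joined {E} st p p′ par par′ =
      let c₀ , p₀ , t₁ , t₂ = Classes.strong S IH E st
          to-strong : ∀ {c} → Proper σ c → Parallel E c → Kempe (Proper σ) c c₀
          to-strong = λ q → [ (λ t → joined-by-tie {E} st q p₀ t t₁)
                            , (λ t → joined-by-tie {mirrored E} (straight-mirrored st) q p₀ t t₂) ]′
      in to-strong p par ◅◅ kempe-sym (to-strong p′ par′)

    parallel-or-crossed : ∀ E {c} → Proper σ c → Parallel E c ⊎ Crossed E c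
    parallel-or-crossed E {c} p with c U₁ Fin.≟ c V₁ | c U₂ Fin.≟ c V₂ | c U₁ Fin.≟ c V₂ | c U₂ Fin.≟ c V₁
      where open Edge E
    ... | yes e | _ | _ | _ = inj₁ (inj₁ e)
    ... | no _ | yes e | _ | _ = inj₁ (inj₂ e)
    ... | no _ | no _ | yes e | _ = inj₂ (inj₁ e)
    ... | no _ | no _ | no _ | yes e = inj₂ (inj₂ e)
    -- If all four equalities fail, `V₁` and `V₂` both have the one colour absent at u, although
    -- they meet at v.
    ... | no u₁v₁ | no u₂v₂ | no u₁v₂ | no u₂v₁ = contradiction
        (four-colours (clash p alive-U₀ alive-U₁ U.x≢y (sym U.at-y)) (clash p alive-U₀ alive-U₂ U.x≢z (sym U.at-z))
          (clash p alive-V₀ alive-V₁ V.x≢y (sym V.at-y) ∘ trans (match p U₀))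
          (clash p alive-U₁ alive-U₂ U.y≢z (trans U.at-y (sym U.at-z))) u₁v₁ u₂v₁
          (clash p alive-V₀ alive-V₂ V.x≢z (sym V.at-z) ∘ trans (match p U₀) ∘ sym) (u₁v₂ ∘ sym) (u₂v₂ ∘ sym))
        (clash p alive-V₁ alive-V₂ V.y≢z (trans V.at-y (sym V.at-z)) ∘ sym)
      where open Facts S E

    -- Each type is a single class, by `parallel-joined` for `E` or for its flip, so one path
    -- between the types joins everything.
    link : ∀ {E c c′} → Straight E → Straight (flipped E) → Proper σ c → Proper σ c′ →
           Parallel E c → Crossed E c′ → Kempe (Proper σ) c c′ → Goal
    link {E} {c} {c′} st st′ p p′ par cro path = (c , p) , λ d d′ q q′ →
      to-c d q ◅◅ kempe-sym (to-c d′ q′)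
      where
      to-c : ∀ d → Proper σ d → Kempe (Proper σ) d c
      to-c d q with parallel-or-crossed E q
      ... | inj₁ par′ = parallel-joined {E} st q p par′ par
      ... | inj₂ cro′ = parallel-joined {flipped E} st′ q p′ cro′ cro ◅◅ kempe-sym path

    -- An edge in two triangles: its crossed colourings would clash at a common neighbour.
    diamond : ∀ E → Edge.w E ≡ Edge.z E → Edge.x E ≡ Edge.y E → Goal
    diamond E w≡z x≡y = (let c , p , _ = Classes.strong S IH E st in c , p) ,
      λ c c′ p p′ → parallel-joined {E} st p p′ (parallel p) (parallel p′)
      where
      open Facts S E
      st : Straight E
      st = straight (λ w≡y → y≢z (trans (sym w≡y) w≡z)) (λ x≡z → y≢z (trans (sym x≡y) x≡z))
      parallel : ∀ {c} → Proper σ c → Parallel E c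
      parallel {c} p with parallel-or-crossed E p
      ... | inj₁ par = par
      ... | inj₂ (inj₁ e) = contradiction (trans (match p U₁) (trans e (sym (match p V₂))))
              (clash p alive-W alive-Z (distinct U.at-y V.at-z (v≢u ∘ sym) ∘ partner-injective σ) w≡z)
      ... | inj₂ (inj₂ e) = contradiction (trans (match p U₂) (trans e (sym (match p V₁))))
              (clash p alive-X alive-Y (distinct U.at-z V.at-y (v≢u ∘ sym) ∘ partner-injective σ) x≡y)

    -- A neighbouring edge can be ignored while it is blank; `ds` holds the edges still waiting to
    -- be repainted. Several edges can thus trade two colours in one step although the assignments
    -- in between are not proper.
    Avoids : List D → Assignment → Colour → D → Set
    Avoids ds c k d = c d ≢ k ⊎ Killed σ ds d

    repaint-in : ∀ ds (E : Edge σ) {c k} → let open Edge E in Proper (restrict σ (U₀ ∷ ds)) c →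
                 Avoids ds c k U₁ → Avoids ds c k U₂ → Avoids ds c k V₁ → Avoids ds c k V₂ →
                 Proper (restrict σ ds) (paint σ U₀ k c)
    repaint-in ds E {c} {k} p a₁ a₂ b₁ b₂ = paint-proper σ alive-U₀ p apart
      where
      open Facts S E
      avoid : ∀ {d} → Alive (restrict σ ds) d → Avoids ds c k d → c d ≢ k
      avoid a = [ id , (λ k → contradiction a (dead-restrict σ k)) ]′
      apart : ∀ d → Near σ ds U₀ d → c d ≢ k
      apart d (near d≢ d≢σ a (inj₁ at)) with U.cover at
      ... | inj₁ e = contradiction e d≢
      ... | inj₂ (inj₁ refl) = avoid a a₁
      ... | inj₂ (inj₂ refl) = avoid a a₂
      apart d (near d≢ d≢σ a (inj₂ at)) with V.cover at
      ... | inj₁ e = contradiction e d≢σ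
      ... | inj₂ (inj₁ refl) = avoid a b₁
      ... | inj₂ (inj₂ refl) = avoid a b₂

    repaint : ∀ (E : Edge σ) {c k} → let open Edge E in Proper σ c → c U₁ ≢ k → c U₂ ≢ k → c V₁ ≢ k → c V₂ ≢ k →
              Proper σ (paint σ U₀ k c)
    repaint E p a₁ a₂ b₁ b₂ = proper-unrestrict σ
      (repaint-in [] E (proper-restrict σ _ p) (inj₁ a₁) (inj₁ a₂) (inj₁ b₁) (inj₁ b₂))

    repaint-kempe : ∀ {d k c} → Proper σ c → Proper σ (paint σ d k c) → Kempe (Proper σ) c (paint σ d k c)
    repaint-kempe p p′ = (p , p′ , _ , _ , paint-linked σ (match p _) (linked-ends _ _)) ◅ ε

    -- Successive repaintings whose old and new colours all lie in one pair accumulate to a single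
    -- step.
    linked-paint : ∀ {a b c₀ c d k} → (∀ y → Linked a b (c₀ y) (c y)) → Proper σ c₀ →
                   Among a b (c₀ d) → Among a b k → ∀ y → Linked a b (c₀ y) (paint σ d k c y)
    linked-paint {a} {b} {c₀} {c} {d} {k} l p ad ak y = cases (y ≟ d) (y ≟ partner σ d)
      where
      cases : Dec (y ≡ d) → Dec (y ≡ partner σ d) → Linked a b (c₀ y) (paint σ d k c y)
      cases (yes refl) _ = inj₂ (ad , subst (Among a b) (sym (paint-at σ d k c)) ak)
      cases (no _) (yes refl) = inj₂ (subst (Among a b) (sym (match p d)) ad ,
                                      subst (Among a b) (sym (paint-partner σ d k c)) ak)
      cases (no y≢d) (no y≢σd) = subst (Linked a b (c₀ y)) (sym (paint-other σ k c y≢d y≢σd)) (l y)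

    -- Re-centres the picture on the edge `U₁`: at u, `U₀` and `U₁` trade roles, and the other two
    -- darts at w take the place of `V₁` and `V₂`.
    beside : ∀ (E : Edge σ) {W₁ W₂} → Corner vt (partner σ (Edge.U₁ E)) W₁ W₂ → Edge σ
    beside E {W₁} {W₂} k = record
      { U₀ = U₁ ; U₁ = U₀ ; U₂ = U₂ ; V₁ = W₁ ; V₂ = W₂
      ; alive-U₀ = alive-U₁ ; corner-U = corner-swap (corner-rotate corner-U) ; corner-V = k }
      where open Facts S E

    -- The edge of E hangs off a triangle: the ends of U₁ and U₂ are joined by B₁—C₁.
    record Triangle (E : Edge σ) : Set where
      open Edge E
      field
        B₁ B₂ C₁ C₂ : D
        corner-X : Corner vt (partner σ U₂) B₁ B₂
        corner-W : Corner vt (partner σ U₁) C₁ C₂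
        closes   : partner σ B₁ ≡ C₁

    triangle-mirrored : ∀ {E} → Triangle E → Triangle (mirrored E)
    triangle-mirrored T = record
      { B₁ = C₁ ; B₂ = C₂ ; C₁ = B₁ ; C₂ = B₂ ; corner-X = corner-W ; corner-W = corner-X
      ; closes = partner-swap σ closes }
      where open Triangle T

    -- If v is adjacent to w, the edge from u to w lies in two triangles, with third corners x and
    -- v.
    pendant-diamond : ∀ {E} (T : Triangle E) {d} → vt d ≡ Edge.v E → vt (partner σ d) ≡ Edge.w E → Goal
    pendant-diamond {E} T {d} dv dw = diamond (beside E corner-W) (sym C₂-to-v) (sym C₁-to-x)
      where
      open Facts S E
      open Triangle T
      module B = Corner corner-X
      module C = Corner corner-W
      C₁-to-x : vt (partner σ C₁) ≡ x
      C₁-to-x = trans (cong vt (partner-swap σ closes)) B.at-y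
      C₂-to-v : vt (partner σ C₂) ≡ v
      C₂-to-v with C.cover dw
      ... | inj₁ e = contradiction (partner-injective σ e) (distinct dv U.at-y v≢u)
      ... | inj₂ (inj₁ e) = contradiction (trans (sym C₁-to-x) (trans (cong vt (partner-swap σ e)) dv)) x≢v
      ... | inj₂ (inj₂ e) = trans (cong vt (partner-swap σ e)) dv

    pendant-straight : ∀ {E} → Triangle E → Goal ⊎ Straight E × Straight (flipped E)
    pendant-straight {E} T with w ≟ᵥ y | w ≟ᵥ z | x ≟ᵥ y | x ≟ᵥ z
      where open Edge E
    ... | yes e | _ | _ | _ = inj₁ (pendant-diamond T (Corner.at-y (Edge.corner-V E)) (sym e))
    ... | no _ | yes e | _ | _ = inj₁ (pendant-diamond T (Corner.at-z (Edge.corner-V E)) (sym e))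
    ... | no _ | no _ | yes e | _ = inj₁ (pendant-diamond (triangle-mirrored T) (Corner.at-y (Edge.corner-V E)) (sym e))
    ... | no _ | no _ | no _ | yes e = inj₁ (pendant-diamond (triangle-mirrored T) (Corner.at-z (Edge.corner-V E)) (sym e))
    ... | no wy | no wz | no xy | no xz = inj₂ (straight wy xz , straight wz xy)

    still : ∀ {d e k c} → vt e ≢ vt d → vt e ≢ vt (partner σ d) → paint σ d k c e ≡ c e
    still e≢d e≢σd = paint-other σ _ _ (λ { refl → e≢d refl }) (λ { refl → e≢σd refl })

    module Triangular {E : Edge σ} (T : Triangle E) (st : Straight E) (st′ : Straight (flipped E))
                      {c : Assignment} (p : Proper σ c)
                      (U₁=V₁ : c (Edge.U₁ E) ≡ c (Edge.V₁ E)) (U₂=V₂ : c (Edge.U₂ E) ≡ c (Edge.V₂ E)) where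
      open Facts S E
      open Triangle T public
      module B = Corner corner-X
      module C = Corner corner-W

      edge₁ edge₂ : Edge σ
      edge₁ = beside E corner-W
      edge₂ = beside (mirrored E) corner-X

      alive-at-x : ∀ {d} → vt d ≡ x → Alive σ d
      alive-at-x = full alive-X
      alive-at-w : ∀ {d} → vt d ≡ w → Alive σ d
      alive-at-w = full alive-W

      U₀≢U₁ : c U₀ ≢ c U₁
      U₀≢U₁ = clash p alive-U₀ alive-U₁ U.x≢y (sym U.at-y)
      U₀≢U₂ : c U₀ ≢ c U₂
      U₀≢U₂ = clash p alive-U₀ alive-U₂ U.x≢z (sym U.at-z)
      U₁≢U₂ : c U₁ ≢ c U₂
      U₁≢U₂ = clash p alive-U₁ alive-U₂ U.y≢z (trans U.at-y (sym U.at-z))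
      B₁=C₁ : c B₁ ≡ c C₁
      B₁=C₁ = trans (sym (match p B₁)) (cong c closes)
      B₁≢U₂ : c B₁ ≢ c U₂
      B₁≢U₂ = clash p (alive-at-x B.at-y) alive-X (B.x≢y ∘ sym) B.at-y ∘ λ e → trans e (sym (match p U₂))
      C₁≢U₁ : c C₁ ≢ c U₁
      C₁≢U₁ = clash p (alive-at-w C.at-y) alive-W (C.x≢y ∘ sym) C.at-y ∘ λ e → trans e (sym (match p U₁))
      B₁≢U₁ : c B₁ ≢ c U₁
      B₁≢U₁ e = C₁≢U₁ (trans (sym B₁=C₁) e)
      C₁≢U₂ : c C₁ ≢ c U₂
      C₁≢U₂ e = B₁≢U₂ (trans B₁=C₁ e)

      -- `c` is parallel at `E`; once `U₁` has the colour of `U₂` and `V₂` has kept its own, the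
      -- edge is crossed.
      link-E : ∀ {c′} → Proper σ c′ → c′ U₁ ≡ c U₂ → c′ V₂ ≡ c V₂ → Kempe (Proper σ) c c′ → Goal
      link-E p′ e e′ path = link {E} st st′ p p′ (inj₁ U₁=V₁) (inj₁ (trans e (trans U₂=V₂ (sym e′)))) path

      -- The path formed by `U₁` and `U₂` is continued by neither outer edge, so it is an entire
      -- Kempe chain and its colours can be exchanged.
      exchange-sides : c C₂ ≢ c U₂ → c B₂ ≢ c U₁ → Goal
      exchange-sides C₂≢U₂ B₂≢U₁ = link-E p₂
        (trans (paint-other σ (c U₁) c₁ U.y≢z (distinct U.at-y refl (x≢u ∘ sym))) (paint-at σ U₁ (c U₂) c))
        (trans (still (λ e → v≢u (trans (sym V.at-z) (trans e U.at-z))) (λ e → x≢v (trans (sym e) V.at-z)))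
               (still (λ e → v≢u (trans (sym V.at-z) (trans e U.at-y))) (λ e → w≢v (trans (sym e) V.at-z))))
        ((p , p₂ , c U₁ , c U₂ , linked-paint (linked-paint (λ _ → inj₁ refl) p (inj₁ refl) (inj₂ refl))
                                              p (inj₂ refl) (inj₁ refl)) ◅ ε)
        where
        c₁ = paint σ U₁ (c U₂) c
        c₂ = paint σ U₂ (c U₁) c₁
        p₁ : Proper (restrict σ (U₂ ∷ [])) c₁
        p₁ = repaint-in (U₂ ∷ []) edge₁ (proper-restrict σ _ p)
               (inj₁ U₀≢U₂) (inj₂ (inj₁ (here refl))) (inj₁ C₁≢U₂) (inj₁ C₂≢U₂)
        at-x : ∀ {d} → vt d ≡ x → c₁ d ≡ c d
        at-x at = still (λ e → x≢u (trans (sym at) (trans e U.at-y))) (λ e → w≢x (trans (sym e) at))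
        p₂ : Proper σ c₂
        p₂ = proper-unrestrict σ (repaint-in [] edge₂ p₁
          (inj₁ (U₀≢U₁ ∘ trans (sym (paint-other σ _ c U.x≢y (distinct refl refl (w≢u ∘ sym))))))
          (inj₁ (λ e → U₁≢U₂ (sym (trans (sym (paint-at σ U₁ (c U₂) c)) e))))
          (inj₁ (B₁≢U₁ ∘ trans (sym (at-x B.at-y))))
          (inj₁ (B₂≢U₁ ∘ trans (sym (at-x B.at-z)))))

      fourth : ∃ λ k → k ∉ c U₁ ∷ c U₂ ∷ c B₁ ∷ []
      fourth = ∃-fresh _ ℕₚ.≤-refl
      o = proj₁ fourth
      U₁≢o : c U₁ ≢ o
      U₁≢o e = proj₂ fourth (here (sym e))
      U₂≢o : c U₂ ≢ o
      U₂≢o e = proj₂ fourth (there (here (sym e)))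
      B₁≢o : c B₁ ≢ o
      B₁≢o e = proj₂ fourth (there (there (here (sym e))))

      -- `U₀` first takes the colour of the opposite side `B₁`, which is absent at u and v. Then `o`
      -- is free at both ends of `U₂`, because x sees `c B₁` and the colour of `U₁` besides. After
      -- `U₂` has moved to `o`, its former colour is absent at u.
      module Rotated (B₂=U₁ : c B₂ ≡ c U₁) where
        c₁ c₂ : Assignment
        c₁ = paint σ U₀ (c B₁) c
        c₂ = paint σ U₂ o c₁
        p₁ : Proper σ c₁
        p₁ = repaint E p (B₁≢U₁ ∘ sym) (B₁≢U₂ ∘ sym) (λ e → B₁≢U₁ (sym (trans U₁=V₁ e)))
               (λ e → B₁≢U₂ (sym (trans U₂=V₂ e)))
        at-u₁ : ∀ {d} → vt d ≡ u → d ≢ U₀ → c₁ d ≡ c d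
        at-u₁ at d≢ = paint-other σ (c B₁) c d≢ (distinct at refl (v≢u ∘ sym))
        away₁ : ∀ {d} → vt d ≢ u → vt d ≢ v → c₁ d ≡ c d
        away₁ = still
        at-x₁ : ∀ {d} → vt d ≡ x → c₁ d ≡ c d
        at-x₁ at = still (x≢u ∘ trans (sym at)) (x≢v ∘ trans (sym at))
        p₂ : Proper σ c₂
        p₂ = repaint edge₂ p₁
          (B₁≢o ∘ trans (sym (paint-at σ U₀ (c B₁) c)))
          (U₁≢o ∘ trans (sym (at-u₁ U.at-y (U.x≢y ∘ sym))))
          (B₁≢o ∘ trans (sym (at-x₁ B.at-y)))
          (λ e → U₁≢o (trans (sym B₂=U₁) (trans (sym (at-x₁ B.at-z)) e)))
        path₂ : Kempe (Proper σ) c c₂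
        path₂ = repaint-kempe p p₁ ◅◅ repaint-kempe p₁ p₂
        at-U₀ : c₂ U₀ ≡ c B₁
        at-U₀ = trans (paint-other σ o c₁ U.x≢z (distinct refl refl (x≢u ∘ sym))) (paint-at σ U₀ (c B₁) c)
        at-U₂ : c₂ U₂ ≡ o
        at-U₂ = paint-at σ U₂ o c₁
        at-U₁ : c₂ U₁ ≡ c U₁
        at-U₁ = trans (paint-other σ o c₁ U.y≢z (distinct U.at-y refl (x≢u ∘ sym))) (at-u₁ U.at-y (U.x≢y ∘ sym))
        away : ∀ {d} → vt d ≢ u → vt d ≢ v → vt d ≢ x → c₂ d ≡ c d
        away d≢u d≢v d≢x = trans (still (d≢u ∘ λ e → trans e U.at-z) d≢x) (away₁ d≢u d≢v)
        at-w : ∀ {d} → vt d ≡ w → c₂ d ≡ c d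
        at-w at = away (w≢u ∘ trans (sym at)) (w≢v ∘ trans (sym at)) (w≢x ∘ trans (sym at))
        at-x : ∀ {d} → vt d ≡ x → d ≢ X → c₂ d ≡ c d
        at-x at d≢X = trans (paint-other σ o c₁ (distinct at U.at-z x≢u) d≢X) (at-x₁ at)
        at-v : ∀ {d} → vt d ≡ v → d ≢ V₀ → c₂ d ≡ c d
        at-v at d≢ = trans (still (λ e → v≢u (trans (sym at) (trans e U.at-z))) (λ e → x≢v (trans (sym e) at)))
                           (paint-other σ (c B₁) c (distinct at refl v≢u) d≢)

      -- The rotation has removed the old colour of `U₂` from u, and w does not see it either, so
      -- `U₁` can take it.
      swing : c C₂ ≢ c U₂ → c B₂ ≡ c U₁ → Goal
      swing C₂≢U₂ B₂=U₁ = link-E p₃ (paint-at σ U₁ (c U₂) c₂)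
        (trans (still (λ e → v≢u (trans (sym V.at-z) (trans e U.at-y))) (λ e → w≢v (trans (sym e) V.at-z)))
               (at-v V.at-z (V.x≢z ∘ sym)))
        (path₂ ◅◅ repaint-kempe p₂ p₃)
        where
        open Rotated B₂=U₁
        p₃ : Proper σ (paint σ U₁ (c U₂) c₂)
        p₃ = repaint edge₁ p₂ (B₁≢U₂ ∘ trans (sym at-U₀)) (λ e → U₂≢o (sym (trans (sym at-U₂) e)))
               (C₁≢U₂ ∘ trans (sym (at-w C.at-y))) (C₂≢U₂ ∘ trans (sym (at-w C.at-z)))

      free-side : c C₂ ≢ c U₂ → Goal
      free-side C₂≢U₂ with c B₂ Fin.≟ c U₁
      ... | no B₂≢U₁ = exchange-sides C₂≢U₂ B₂≢U₁
      ... | yes B₂=U₁ = swing C₂≢U₂ B₂=U₁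

      edge₃ : ∀ {H₁ H₂} → Corner vt (partner σ B₂) H₁ H₂ → Edge σ
      edge₃ {H₁} {H₂} k = record
        { U₀ = B₂ ; U₁ = X ; U₂ = B₁ ; V₁ = H₁ ; V₂ = H₂ ; alive-U₀ = alive-at-x B.at-z
        ; corner-U = corner-rotate (corner-rotate corner-X) ; corner-V = k }

      triangle₃ : ∀ {H₁ H₂} (k : Corner vt (partner σ B₂) H₁ H₂) → Triangle (edge₃ k)
      triangle₃ k = record
        { B₁ = W ; B₂ = C₂ ; C₁ = U₁ ; C₂ = U₀
        ; corner-X = subst (λ d → Corner vt d W C₂) (sym closes) (corner-swap (corner-rotate corner-W))
        ; corner-W = subst (λ d → Corner vt d U₁ U₀) (sym (involutive σ U₂))
                       (corner-swap (corner-rotate (corner-rotate corner-U)))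
        ; closes = involutive σ U₁ }

      -- Both outer edges repeat the opposite side: U₂ takes all colours but c B₂, which
      -- realises both types at the edge from B₂.
      blocked : c C₂ ≡ c U₂ → c B₂ ≡ c U₁ → Goal
      blocked C₂=U₂ B₂=U₁ with corner (partner σ B₂)
      ... | H₁ , H₂ , kH with pendant-straight (triangle₃ kH)
      ... | inj₁ goal = goal
      ... | inj₂ (s , s′) =
        -- Giving `X` the colour of `H₁` makes the edge from `B₂` parallel, giving it that of `H₂`
        -- makes it crossed.
        let d , pd , path , eq , same = colour-X (H≢ H.at-y (H.x≢y ∘ sym))
            d′ , pd′ , path′ , eq′ , same′ = colour-X (H≢ H.at-z (H.x≢z ∘ sym))
        in link {edge₃ kH} s s′ pd pd′ (inj₁ (trans eq (sym (same H.at-y))))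
             (inj₁ (trans eq′ (sym (same′ H.at-z)))) (kempe-sym path ◅◅ path′)
        where
        module H = Corner kH
        open Rotated B₂=U₁
        h = vt (partner σ B₂)
        alive-B₂ = alive-at-x B.at-z
        h≢x : h ≢ x
        h≢x e = loopless σ alive-B₂ (trans e (sym B.at-z))
        h≢u : h ≢ u
        h≢u e = simple alive-B₂ B.at-z (B.x≢z ∘ sym) (trans e (sym (trans (cong vt (involutive σ U₂)) U.at-z)))
        h≢w : h ≢ w
        h≢w e = simple alive-B₂ (trans B.at-z (sym B.at-y)) (B.y≢z ∘ sym)
                  (trans e (sym (trans (cong vt closes) C.at-y)))
        h≢v : h ≢ v
        h≢v e with V.cover e
        ... | inj₁ eq = x≢u (trans (sym B.at-z) (cong vt (partner-injective σ eq)))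
        ... | inj₂ (inj₁ eq) = Straight.x≢z st′ (trans (sym B.at-z) (cong vt (sym (partner-swap σ eq))))
        ... | inj₂ (inj₂ eq) = Straight.x≢z st (trans (sym B.at-z) (cong vt (sym (partner-swap σ eq))))
        H≢ : ∀ {d} → vt d ≡ h → d ≢ partner σ B₂ → c d ≢ c B₂
        H≢ at d≢ e = clash p (full (alive-partner σ alive-B₂) at) (alive-partner σ alive-B₂) d≢ at
          (trans e (sym (match p B₂)))

        edge₄ : Edge σ
        edge₄ = record
          { U₀ = B₁ ; U₁ = B₂ ; U₂ = X ; V₁ = C₂ ; V₂ = W ; alive-U₀ = alive-at-x B.at-y
          ; corner-U = corner-rotate corner-X
          ; corner-V = subst (λ d → Corner vt d C₂ W) (sym closes) (corner-rotate corner-W) }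
        σB₁-at : vt (partner σ B₁) ≡ w
        σB₁-at = trans (cong vt closes) C.at-y

        -- In `c₂` the path v, u, x, w formed by `U₀`, `U₂`, `B₁` alternates between `c B₁` and `o`.
        -- Its ends v and w see only `c U₁` and `c U₂` besides, so it is a whole chain; the three
        -- paintings exchange it.
        c₃ c₄ c₅ : Assignment
        c₃ = paint σ U₂ (c B₁) c₂
        c₄ = paint σ U₀ o c₃
        c₅ = paint σ B₁ o c₄
        at-v₃ : ∀ {d} → vt d ≡ v → d ≢ V₀ → c₃ d ≡ c d
        at-v₃ at d≢ = trans (still (λ e → v≢u (trans (sym at) (trans e U.at-z))) (λ e → x≢v (trans (sym e) at)))
                            (at-v at d≢)
        at-U₁₃ : c₃ U₁ ≡ c U₁
        at-U₁₃ = trans (paint-other σ (c B₁) c₂ U.y≢z (distinct U.at-y refl (x≢u ∘ sym))) at-U₁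
        at-B₂₄ : c₄ B₂ ≡ c B₂
        at-B₂₄ = trans (still (x≢u ∘ trans (sym B.at-z)) (x≢v ∘ trans (sym B.at-z)))
          (trans (paint-other σ (c B₁) c₂ (distinct B.at-z U.at-z x≢u) (B.x≢z ∘ sym)) (at-x B.at-z (B.x≢z ∘ sym)))
        at-X₄ : c₄ X ≡ c B₁
        at-X₄ = trans (still x≢u x≢v) (paint-partner σ U₂ (c B₁) c₂)
        at-w₄ : ∀ {d} → vt d ≡ w → c₄ d ≡ c d
        at-w₄ at = trans (still (w≢u ∘ trans (sym at)) (w≢v ∘ trans (sym at)))
          (trans (still (λ e → w≢u (trans (sym at) (trans e U.at-z))) (w≢x ∘ trans (sym at))) (at-w at))
        p₃ : Proper (restrict σ (U₀ ∷ B₁ ∷ [])) c₃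
        p₃ = repaint-in (U₀ ∷ B₁ ∷ []) edge₂ (proper-restrict σ _ p₂)
          (inj₂ (inj₁ (here refl))) (inj₁ (B₁≢U₁ ∘ sym ∘ trans (sym at-U₁)))
          (inj₂ (inj₁ (there (here refl))))
          (inj₁ λ e → B₁≢U₁ (sym (trans (sym B₂=U₁) (trans (sym (at-x B.at-z (B.x≢z ∘ sym))) e))))
        p₄ : Proper (restrict σ (B₁ ∷ [])) c₄
        p₄ = repaint-in (B₁ ∷ []) E p₃
          (inj₁ (U₁≢o ∘ trans (sym at-U₁₃)))
          (inj₁ (B₁≢o ∘ trans (sym (paint-at σ U₂ (c B₁) c₂))))
          (inj₁ λ e → U₁≢o (trans U₁=V₁ (trans (sym (at-v₃ V.at-y (V.x≢y ∘ sym))) e)))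
          (inj₁ λ e → U₂≢o (trans U₂=V₂ (trans (sym (at-v₃ V.at-z (V.x≢z ∘ sym))) e)))
        p₅ : Proper σ c₅
        p₅ = proper-unrestrict σ (repaint-in [] edge₄ p₄
          (inj₁ λ e → U₁≢o (trans (sym B₂=U₁) (trans (sym at-B₂₄) e)))
          (inj₁ (B₁≢o ∘ trans (sym at-X₄)))
          (inj₁ λ e → U₂≢o (trans (sym C₂=U₂) (trans (sym (at-w₄ C.at-z)) e)))
          (inj₁ λ e → U₁≢o (trans (sym (match p U₁)) (trans (sym (at-w₄ refl)) e))))
        path₅ : Kempe (Proper σ) c c₅
        path₅ = path₂ ◅◅ ((p₂ , p₅ , o , c B₁ ,
          linked-paint (linked-paint (linked-paint (λ _ → inj₁ refl) p₂ (inj₁ at-U₂) (inj₂ refl))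
            p₂ (inj₂ at-U₀) (inj₁ refl)) p₂ (inj₂ (at-x B.at-y (B.x≢y ∘ sym))) (inj₁ refl)) ◅ ε)

        -- The colourings `c`, `c₂` and `c₅` give `X` the colours `c U₂`, `o` and `c B₁`, and none
        -- of the changes reaches the vertex h.
        colour-X : ∀ {k} → k ≢ c B₂ → ∃ λ d → Proper σ d × Kempe (Proper σ) c d × d X ≡ k ×
                   (∀ {e} → vt e ≡ h → d e ≡ c e)
        colour-X {k} k≢ with k Fin.≟ c U₂ | k Fin.≟ o
        ... | yes refl | _ = c , p , ε , match p U₂ , λ _ → refl
        ... | no _ | yes refl = c₂ , p₂ , path₂ , trans (paint-partner σ U₂ o c₁) refl ,
              λ at → away (h≢u ∘ trans (sym at)) (h≢v ∘ trans (sym at)) (h≢x ∘ trans (sym at))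
        ... | no k≢U₂ | no k≢o = c₅ , p₅ , path₅ ,
              trans (paint-other σ o c₄ B.x≢y (distinct refl σB₁-at (w≢x ∘ sym))) (trans at-X₄ (sym k=B₁)) ,
              λ at → trans (still (λ e → h≢x (trans (sym at) (trans e B.at-y)))
                                  (λ e → h≢w (trans (sym at) (trans e σB₁-at))))
                    (trans (still (h≢u ∘ trans (sym at)) (h≢v ∘ trans (sym at)))
                    (trans (still (λ e → h≢u (trans (sym at) (trans e U.at-z))) (h≢x ∘ trans (sym at)))
                           (away (h≢u ∘ trans (sym at)) (h≢v ∘ trans (sym at)) (h≢x ∘ trans (sym at)))))
          where
          k=B₁ : k ≡ c B₁
          k=B₁ = four-colours U₁≢U₂ U₁≢o (B₁≢U₁ ∘ sym) U₂≢o (B₁≢U₂ ∘ sym) (B₁≢o ∘ sym)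
                   (λ e → k≢ (trans e (sym B₂=U₁))) k≢U₂ k≢o

    triangle : ∀ {E} → Triangle E → Goal
    triangle {E} T with pendant-straight T
    ... | inj₁ goal = goal
    ... | inj₂ (st , st′) = finish (Classes.strong S IH E st)
      where
      open Edge E
      open Triangle T
      finish : (∃ λ c → Proper σ c × c U₁ ≡ c V₁ × c U₂ ≡ c V₂) → Goal
      finish (c , p , t₁ , t₂) with c C₂ Fin.≟ c U₂ | c B₂ Fin.≟ c U₁
      ... | no C₂≢U₂ | _ = Triangular.free-side T st st′ p t₁ t₂ C₂≢U₂
      ... | yes _ | no B₂≢U₁ = Triangular.free-side (triangle-mirrored T) (straight-mirrored st)
                                 (straight-mirrored st′) p t₂ t₁ B₂≢U₁
      ... | yes C₂=U₂ | yes B₂=U₁ = Triangular.blocked T st st′ p t₁ t₂ C₂=U₂ B₂=U₁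

    -- When `U₁` and `V₁` end at the same vertex, the third edge `U₂` at u hangs off the triangle
    -- that they form with `U₀`.
    apex : ∀ E → Edge.w E ≡ Edge.y E → Goal
    apex E w≡y with corner (partner σ (Edge.U₂ E)) | corner (partner σ (Edge.U₁ E))
    ... | X₁ , X₂ , kX | W₁ , W₂ , kW = closed (Corner.cover kW (sym w≡y))
      where
      open Facts S E
      hung : ∀ {C₂} → Corner vt W Y C₂ → Goal
      hung {C₂} k = triangle {E = record
          { U₀ = U₂ ; U₁ = U₁ ; U₂ = U₀ ; V₁ = X₁ ; V₂ = X₂ ; alive-U₀ = alive-U₂
          ; corner-U = corner-swap (corner-rotate (corner-rotate corner-U)) ; corner-V = kX }}
        (record { B₁ = V₁ ; B₂ = V₂ ; C₁ = Y ; C₂ = C₂ ; corner-X = corner-V ; corner-W = k ; closes = refl })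
      closed : Y ≡ W ⊎ Y ≡ W₁ ⊎ Y ≡ W₂ → Goal
      closed (inj₁ e) = contradiction (sym (partner-injective σ e)) (distinct U.at-y V.at-y (v≢u ∘ sym))
      closed (inj₂ (inj₁ refl)) = hung kW
      closed (inj₂ (inj₂ refl)) = hung (corner-swap kW)

    straight-or-goal : ∀ E → Goal ⊎ Straight E × Straight (flipped E)
    straight-or-goal E with w ≟ᵥ y | w ≟ᵥ z | x ≟ᵥ y | x ≟ᵥ z
      where open Edge E
    ... | yes e | _ | _ | _ = inj₁ (apex E e)
    ... | no _ | yes e | _ | _ = inj₁ (apex (flipped E) e)
    ... | no _ | no _ | yes e | _ = inj₁ (apex (mirrored (flipped E)) e)
    ... | no _ | no _ | no _ | yes e = inj₁ (apex (mirrored E) e)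
    ... | no wy | no wz | no xy | no xz = inj₂ (straight wy xz , straight wz xy)

    linked-types : ∀ E {c c′} → Proper σ c → Proper σ c′ → Parallel E c → Crossed E c′ →
                   Kempe (Proper σ) c c′ → Goal
    linked-types E p p′ par cro path with straight-or-goal E
    ... | inj₁ goal = goal
    ... | inj₂ (st , st′) = link {E} st st′ p p′ par cro path

    -- With u and v seeing the same two colours, the colour of U₀ can be changed freely.
    module Doubled {E : Edge σ} (st : Straight E) (st′ : Straight (flipped E))
                   {s : Assignment} (ps : Proper σ s)
                   (U₁=V₁ : s (Edge.U₁ E) ≡ s (Edge.V₁ E)) (U₂=V₂ : s (Edge.U₂ E) ≡ s (Edge.V₂ E)) where
      open Facts S E

      p q : Colour
      p = s U₁
      q = s U₂
      p≢q : p ≢ q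
      p≢q = clash ps alive-U₁ alive-U₂ U.y≢z (trans U.at-y (sym U.at-z))

      recoloured : Colour → Assignment
      recoloured k = paint σ U₀ k s

      recoloured-proper : ∀ {k} → p ≢ k → q ≢ k → Proper σ (recoloured k)
      recoloured-proper p≢k q≢k = repaint E ps p≢k q≢k (p≢k ∘ trans U₁=V₁) (q≢k ∘ trans U₂=V₂)

      at-u : ∀ {k d} → vt d ≡ u → d ≢ U₀ → recoloured k d ≡ s d
      at-u {k} at d≢ = paint-other σ k s d≢ (distinct at refl (v≢u ∘ sym))
      at-v : ∀ {k d} → vt d ≡ v → d ≢ V₀ → recoloured k d ≡ s d
      at-v {k} at d≢ = paint-other σ k s (distinct at refl v≢u) d≢
      away : ∀ {k d} → vt d ≢ u → vt d ≢ v → recoloured k d ≡ s d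
      away = still

      other-at : ∀ {d e} → Alive σ d → vt d ≡ vt e → d ≢ e → s d ≢ s e
      other-at a at d≢e = clash ps a (full a (sym at)) d≢e at

      -- Unless one of the other two edges at w has colour `q`, they have the two colours besides
      -- `p` and `q`. `U₀` can then agree with either of them in turn, which changes the type of the
      -- edge `U₁`.
      far : Goal ⊎ ∃₂ λ W₁ W₂ → Corner vt W W₁ W₂ × s W₁ ≡ q
      far with corner W
      ... | W₁ , W₂ , k with s W₁ Fin.≟ q | s W₂ Fin.≟ q
      ... | yes e | _ = inj₂ (W₁ , W₂ , k , e)
      ... | no _ | yes e = inj₂ (W₂ , W₁ , corner-swap k , e)
      ... | no W₁≢q | no W₂≢q = inj₁ (cases (s W₁ Fin.≟ s U₀))
        where
        module K = Corner k
        fresh = ∃-fresh (p ∷ q ∷ s U₀ ∷ []) ℕₚ.≤-refl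
        t = proj₁ fresh
        p≢t : p ≢ t
        p≢t e = proj₂ fresh (here (sym e))
        q≢t : q ≢ t
        q≢t e = proj₂ fresh (there (here (sym e)))
        r≢t : s U₀ ≢ t
        r≢t e = proj₂ fresh (there (there (here (sym e))))
        p≢r : p ≢ s U₀
        p≢r = other-at alive-U₁ U.at-y (U.x≢y ∘ sym)
        q≢r : q ≢ s U₀
        q≢r = other-at alive-U₂ U.at-z (U.x≢z ∘ sym)
        W≢p : ∀ {d} → vt d ≡ w → d ≢ W → s d ≢ p
        W≢p at d≢ e = other-at (full alive-W at) at d≢ (trans e (sym (match ps U₁)))
        pt = recoloured-proper p≢t q≢t
        at-w : ∀ {d} → vt d ≡ w → recoloured t d ≡ s d
        at-w at = away (w≢u ∘ trans (sym at)) (w≢v ∘ trans (sym at))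
        flips : ∀ {d e} → Corner vt W d e → s d ≡ s U₀ → s e ≡ t → Goal
        flips {d} {e} k′ dr et = linked-types (beside E k′) ps pt (inj₁ (sym dr))
          (inj₁ (trans (paint-at σ U₀ t s) (sym (trans (at-w (Corner.at-z k′)) et)))) (repaint-kempe ps pt)
        cases : Dec (s W₁ ≡ s U₀) → Goal
        cases (yes e) = flips k e (four-colours p≢q p≢r p≢t q≢r q≢t r≢t (W≢p K.at-z (K.x≢z ∘ sym)) W₂≢q
          (λ e′ → other-at (full alive-W K.at-y) (trans K.at-y (sym K.at-z)) K.y≢z (trans e (sym e′))))
        cases (no ne) = flips (corner-swap k) W₂=r W₁=t
          where
          W₁=t : s W₁ ≡ t
          W₁=t = four-colours p≢q p≢r p≢t q≢r q≢t r≢t (W≢p K.at-y (K.x≢y ∘ sym)) W₁≢q ne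
          W₂=r : s W₂ ≡ s U₀
          W₂=r = four-colours p≢q p≢t p≢r q≢t q≢r (r≢t ∘ sym) (W≢p K.at-z (K.x≢z ∘ sym)) W₂≢q
            (λ e′ → other-at (full alive-W K.at-y) (trans K.at-y (sym K.at-z)) K.y≢z (trans W₁=t (sym e′)))

      -- The configuration that `far` leaves over. The edge `U₂` is crossed, as `U₁` and `X₁` share
      -- the colour `p`; the aim is to make it parallel, by giving `U₁` the colour of `X₂` or `U₀`
      -- the colour of `X₁`.
      module _ {W₁ W₂ X₁ X₂ Y₁ Y₂ : D} (kW : Corner vt W W₁ W₂) (kX : Corner vt X X₁ X₂) (kY : Corner vt Y Y₁ Y₂)
               (W₁=q : s W₁ ≡ q) (X₁=p : s X₁ ≡ p) (Y₁=q : s Y₁ ≡ q) where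
        private
          module kW = Corner kW
          module kX = Corner kX
          module kY = Corner kY

        α β : Colour
        α = s W₂
        p≢α : p ≢ α
        p≢α e = other-at (full alive-W kW.at-z) kW.at-z (kW.x≢z ∘ sym) (trans (sym e) (sym (match ps U₁)))
        q≢α : q ≢ α
        q≢α e = other-at (full alive-W kW.at-y) (trans kW.at-y (sym kW.at-z)) kW.y≢z (trans W₁=q e)
        q≢X₂ : q ≢ s X₂
        q≢X₂ e = other-at (full alive-X kX.at-z) kX.at-z (kX.x≢z ∘ sym) (trans (sym e) (sym (match ps U₂)))

        at-w : ∀ {k d} → vt d ≡ w → recoloured k d ≡ s d
        at-w at = away (w≢u ∘ trans (sym at)) (w≢v ∘ trans (sym at))
        at-x : ∀ {k d} → vt d ≡ x → recoloured k d ≡ s d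
        at-x at = away (x≢u ∘ trans (sym at)) (x≢v ∘ trans (sym at))
        at-y : ∀ {k d} → vt d ≡ y → recoloured k d ≡ s d
        at-y at = away (y≢u ∘ trans (sym at)) (y≢v ∘ trans (sym at))
        at-U₁ : ∀ {k} → recoloured k U₁ ≡ p
        at-U₁ = at-u U.at-y (U.x≢y ∘ sym)
        at-U₂ : ∀ {k} → recoloured k U₂ ≡ q
        at-U₂ = at-u U.at-z (U.x≢z ∘ sym)
        at-V₁ : ∀ {k} → recoloured k V₁ ≡ p
        at-V₁ = trans (at-v V.at-y (V.x≢y ∘ sym)) (sym U₁=V₁)
        at-V₂ : ∀ {k} → recoloured k V₂ ≡ q
        at-V₂ = trans (at-v V.at-z (V.x≢z ∘ sym)) (sym U₂=V₂)

        edge-ux edge-uw edge-vy : Edge σ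
        edge-ux = beside (mirrored E) kX
        edge-uw = beside E kW
        edge-vy = beside (reversed E) kY

        crossed-ux : ∀ {k} → Crossed edge-ux (recoloured k)
        crossed-ux = inj₂ (trans at-U₁ (sym (trans (at-x kX.at-y) X₁=p)))

        -- Once `U₀` has colour `α`, both ends of `U₁` see only `q` and `α` besides `U₁`, so `U₁`
        -- can take the colour of `X₂`.
        unequal : s X₂ ≢ α → Goal
        unequal X₂≢α = linked-types edge-ux p₂ p₁ parallel crossed-ux (kempe-sym (repaint-kempe p₁ p₂))
          where
          c₁ = recoloured α
          p₁ = recoloured-proper p≢α q≢α
          c₂ = paint σ U₁ (s X₂) c₁
          p₂ : Proper σ c₂
          p₂ = repaint edge-uw p₁ (λ e → X₂≢α (trans (sym e) (paint-at σ U₀ α s)))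
                 (q≢X₂ ∘ trans (sym at-U₂)) (λ e → q≢X₂ (trans (sym W₁=q) (trans (sym (at-w kW.at-y)) e)))
                 (λ e → X₂≢α (trans (sym e) (at-w kW.at-z)))
          parallel : Parallel edge-ux c₂
          parallel = inj₂ (trans (paint-at σ U₁ (s X₂) c₁) (sym (trans
            (still (λ e → x≢u (trans (sym kX.at-z) (trans e U.at-y))) (λ e → w≢x (trans (sym e) kX.at-z)))
            (at-x kX.at-z))))

        other : ∃ λ k → k ∉ p ∷ q ∷ α ∷ []
        other = ∃-fresh _ ℕₚ.≤-refl
        β = proj₁ other
        p≢β : p ≢ β
        p≢β e = proj₂ other (here (sym e))
        q≢β : q ≢ β
        q≢β e = proj₂ other (there (here (sym e)))
        α≢β : α ≢ β
        α≢β e = proj₂ other (there (there (here (sym e))))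

        c₁ : Assignment
        c₁ = recoloured β
        p₁ : Proper σ c₁
        p₁ = recoloured-proper p≢β q≢β

        -- After V₁ has been moved out of the way, U₀ and U₁ exchange β and p.
        module Exchange (k : Colour) (k≢p : k ≢ p) where
          c₂ c₃ c₄ : Assignment
          c₂ = paint σ V₁ k c₁
          c₃ = paint σ U₁ β c₂
          c₄ = paint σ U₀ p c₃

          y≢w : y ≢ w
          y≢w = Straight.w≢y st ∘ sym
          y≢x : y ≢ x
          y≢x = Straight.x≢z st′ ∘ sym

          at-u₂ : ∀ {d} → vt d ≡ u → c₂ d ≡ c₁ d
          at-u₂ at = still (λ e → v≢u (sym (trans (sym at) (trans e V.at-y)))) (λ e → y≢u (trans (sym e) at))
          at-w₂ : ∀ {d} → vt d ≡ w → c₂ d ≡ c₁ d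
          at-w₂ at = still (λ e → w≢v (trans (sym at) (trans e V.at-y))) (λ e → y≢w (trans (sym e) at))
          at-x₂ : ∀ {d} → vt d ≡ x → c₂ d ≡ c₁ d
          at-x₂ at = still (λ e → x≢v (trans (sym at) (trans e V.at-y))) (λ e → y≢x (trans (sym e) at))
          at-v₃ : ∀ {d} → vt d ≡ v → c₃ d ≡ c₂ d
          at-v₃ at = still (λ e → v≢u (trans (sym at) (trans e U.at-y))) (λ e → w≢v (trans (sym e) at))

          module _ (p₂ : Proper (restrict σ (U₀ ∷ [])) c₂) where
            p₃ : Proper (restrict σ (U₀ ∷ [])) c₃
            p₃ = repaint-in (U₀ ∷ []) edge-uw (proper-weaken σ there p₂) (inj₂ (inj₁ (here refl)))
              (inj₁ (q≢β ∘ trans (sym (trans (at-u₂ U.at-z) at-U₂))))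
              (inj₁ (q≢β ∘ trans (sym (trans (at-w₂ kW.at-y) (trans (at-w kW.at-y) W₁=q)))))
              (inj₁ (α≢β ∘ trans (sym (trans (at-w₂ kW.at-z) (at-w kW.at-z)))))
            p₄ : Proper σ c₄
            p₄ = proper-unrestrict σ (repaint-in [] E p₃
              (inj₁ (λ e → p≢β (sym (trans (sym (paint-at σ U₁ β c₂)) e))))
              (inj₁ (λ e → p≢q (sym (trans (sym (trans (at-u₂ U.at-z) at-U₂)) (trans (sym U₂₃) e)))))
              (inj₁ (λ e → k≢p (trans (sym (trans (at-v₃ V.at-y) (paint-at σ V₁ k c₁))) e)))
              (inj₁ (λ e → p≢q (sym (trans (sym (trans (at-v₃ V.at-z) V₂₂)) e)))))
              where
              U₂₃ : c₃ U₂ ≡ c₂ U₂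
              U₂₃ = paint-other σ β c₂ (U.y≢z ∘ sym) (distinct U.at-z refl (w≢u ∘ sym))
              V₂₂ : c₂ V₂ ≡ q
              V₂₂ = trans (paint-other σ k c₁ (V.y≢z ∘ sym) (distinct V.at-z refl (y≢v ∘ sym))) at-V₂
            exchanged : Kempe (Proper σ) c₁ c₄ → Goal
            exchanged path = linked-types edge-ux p₄ p₁ (inj₁ (trans (paint-at σ U₀ p c₃) (sym X₁₄)))
                               crossed-ux (kempe-sym path)
              where
              X₁₄ : c₄ X₁ ≡ p
              X₁₄ = trans (still (x≢u ∘ trans (sym kX.at-y)) (x≢v ∘ trans (sym kX.at-y)))
                (trans (still (λ e → x≢u (trans (sym kX.at-y) (trans e U.at-y))) (λ e → w≢x (trans (sym e) kX.at-y)))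
                (trans (at-x₂ kX.at-y) (trans (at-x kX.at-y) X₁=p)))

        Y₁₁ : c₁ Y₁ ≡ q
        Y₁₁ = trans (at-y kY.at-y) Y₁=q
        V₀₁ : c₁ V₀ ≡ β
        V₀₁ = paint-partner σ U₀ β s

        equal : Goal
        equal with s Y₂ Fin.≟ β
        -- `β` is absent at y, so `V₁`, `U₀`, `U₁`, coloured `p`, `β`, `p`, form a whole chain from
        -- y to w and are exchanged in one step.
        ... | no Y₂≢β = exchanged p₂ ((p₁ , p₄ p₂ , p , β ,
            linked-paint (linked-paint (linked-paint (λ _ → inj₁ refl) p₁ (inj₁ at-V₁) (inj₂ refl))
              p₁ (inj₁ at-U₁) (inj₂ refl)) p₁ (inj₂ (paint-at σ U₀ β s)) (inj₁ refl)) ◅ ε)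
          where
          open Exchange β (p≢β ∘ sym)
          p₂ : Proper (restrict σ (U₀ ∷ [])) c₂
          p₂ = repaint-in (U₀ ∷ []) edge-vy (proper-restrict σ _ p₁)
            (inj₂ (inj₂ (here (involutive σ U₀)))) (inj₁ (q≢β ∘ trans (sym at-V₂)))
            (inj₁ (q≢β ∘ trans (sym Y₁₁))) (inj₁ (Y₂≢β ∘ trans (sym (at-y kY.at-z))))
        -- `β` occupies `Y₂`, which leaves `α` free at both ends of `V₁`. With `V₁` moved there,
        -- `U₀` and `U₁` form a chain by themselves.
        ... | yes Y₂=β = exchanged (proper-restrict σ _ p₂) (repaint-kempe p₁ p₂ ◅◅
            ((p₂ , p₄ (proper-restrict σ _ p₂) , p , β ,
              linked-paint (linked-paint (λ _ → inj₁ refl) p₂ (inj₁ (trans (at-u₂ U.at-y) at-U₁)) (inj₂ refl))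
                p₂ (inj₂ (trans (at-u₂ refl) (paint-at σ U₀ β s))) (inj₁ refl)) ◅ ε))
          where
          open Exchange α (p≢α ∘ sym)
          p₂ : Proper σ c₂
          p₂ = repaint edge-vy p₁ (λ e → α≢β (sym (trans (sym V₀₁) e))) (q≢α ∘ trans (sym at-V₂))
            (q≢α ∘ trans (sym Y₁₁)) (λ e → α≢β (sym (trans (sym (trans (at-y kY.at-z) Y₂=β)) e)))

        concluded : Goal
        concluded with s X₂ Fin.≟ α
        ... | no X₂≢α = unequal X₂≢α
        ... | yes _ = equal

    simple-connected : Edge σ → Goal
    simple-connected E with straight-or-goal E
    ... | inj₁ goal = goal
    ... | inj₂ (st , st′) = doubled (Classes.strong S IH E st)
      where
      open Edge E
      doubled : (∃ λ c → Proper σ c × c U₁ ≡ c V₁ × c U₂ ≡ c V₂) → Goal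
      doubled (c , p , t₁ , t₂)
        with Doubled.far {E} st st′ p t₁ t₂
           | Doubled.far {mirrored E} (straight-mirrored st) (straight-mirrored st′) p t₂ t₁
           | Doubled.far {reversed E} st-reversed st′-reversed p (sym t₁) (sym t₂)
        where
        st-reversed : Straight (reversed E)
        st-reversed = straight (Straight.w≢y st ∘ sym) (Straight.x≢z st ∘ sym)
        st′-reversed : Straight (flipped (reversed E))
        st′-reversed = straight (Straight.x≢z st′ ∘ sym) (Straight.w≢y st′ ∘ sym)
      ... | inj₁ goal | _ | _ = goal
      ... | inj₂ _ | inj₁ goal | _ = goal
      ... | inj₂ _ | inj₂ _ | inj₁ goal = goal
      ... | inj₂ (_ , _ , kW , eW) | inj₂ (_ , _ , kX , eX) | inj₂ (_ , _ , kY , eY) =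
        Doubled.concluded {E} st st′ p t₁ t₂ kW kX kY eW eX (trans eY (sym t₂))

-- Induction on the number of edges

module Induction {D : Set} (_≟_ : DecidableEquality D) (darts : List D)
                 (complete : ∀ x → x ∈ darts) (m : ℕ) {V : Set} (vt : D → V) where

  open Recolouring _≟_ darts complete m
  open Pairings _≟_ darts complete m vt

  search : ∀ {P : D → Set} → Unary.Decidable P → Dec (∃ P)
  search {P} P? with Any.any? P? darts
  ... | yes found = yes (Any.satisfied found)
  ... | no none = no λ { (x , p) → none (Any.map (λ { refl → p }) (complete x)) }

  edgeless : ∀ {σ} → ¬ ∃ (Alive σ) → Connected (Proper σ)
  edgeless {σ} none = transport (λ {c} _ → record
    { match = λ x → cong c (dead-fixed σ λ a → none (x , a)) ; clash = λ a → contradiction (_ , a) none })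
    (λ _ → tt) unconstrained

  Touches : Pairing → D → D → Set
  Touches σ x n = n ≢ x × n ≢ partner σ x × (vt n ≡ vt x ⊎ vt n ≡ vt (partner σ x))

  insert-few : ∀ {σ x ns} → Alive σ x → length ns ≤ m → All (Touches σ x) ns →
    (∀ {c} → Proper (restrict σ (x ∷ [])) c → ∀ y → Near σ [] x y → ∃ λ n → n ∈ ns × Alive σ n × c y ≡ c n) →
    Connected (Proper (restrict σ (x ∷ []))) → Connected (Proper σ)
  insert-few {σ} {x} {ns} ax short touch cover =
    insert-edge₀ σ ax nears (ℕₚ.≤-trans (length-filter (alive? σ) ns) short)
      λ p y ny → let n , n∈ , an , eq = cover p y ny in n , ∈-filter⁺ (alive? σ) n∈ an , eq
    where
    nears : All (Near σ [] x) (filter (alive? σ) ns)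
    nears = All.tabulate λ n∈ →
      let n∈ns , an = ∈-filter⁻ (alive? σ) {xs = ns} n∈
          n≢x , n≢σx , at = All.lookup touch n∈ns
      in near n≢x n≢σx (alive-restrict σ an (λ ()) (λ ())) at

  cut-smaller : ∀ {σ x} → Alive σ x → size (restrict σ (x ∷ [])) < size σ
  cut-smaller {σ} {x} ax = size-< {σ} {restrict σ (x ∷ [])} (proj₁ ∘ restrict-alive σ) ax
    (dead-restrict σ (inj₁ (here refl)))

  Mates : D → List D → Set
  Mates d ns = All (λ n → n ≢ d × vt n ≡ vt d) ns × (∀ {e} → vt e ≡ vt d → e ≢ d → e ∈ ns)

  -- Every edge has at most `b` neighbours at each end, so it can always be inserted. With m = Δ and
  -- b = Δ - 1 the bound holds for Δ = 1 and Δ = 2 but would read 4 ≤ 3 for Δ = 3.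
  sparse-connected : ∀ b → b + b ≤ m → (∀ d → ∃ λ ns → Mates d ns × length ns ≤ b) →
                     ∀ σ → Connected (Proper σ)
  sparse-connected b 2b≤m mates σ = go σ (<-wellFounded (size σ))
    where
    go : ∀ σ → Acc _<_ (size σ) → Connected (Proper σ)
    go σ (acc smaller) with search (alive? σ)
    ... | no none = edgeless none
    ... | yes (x , ax) with mates x | mates (partner σ x)
    ... | ns , (all , cover) , short | ns′ , (all′ , cover′) , short′ =
      insert-few ax
        (ℕₚ.≤-trans (ℕₚ.≤-reflexive (length-++ ns)) (ℕₚ.≤-trans (ℕₚ.+-mono-≤ short short′) 2b≤m))
        (++⁺ (All.map (λ { (n≢ , at) → n≢ , (λ { refl → loopless σ ax at }) , inj₁ at }) all)
             (All.map (λ { (n≢ , at) → (λ { refl → loopless σ ax (sym at) }) , n≢ , inj₂ at }) all′))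
        (λ { _ y (near y≢x y≢σx ay at) → y ,
          [ (λ e → ∈-++⁺ˡ (cover e y≢x)) , (λ e → ∈-++⁺ʳ ns (cover′ e y≢σx)) ]′ at ,
          proj₁ (restrict-alive σ ay) , refl })
        (go (restrict σ (x ∷ [])) (smaller (cut-smaller {σ} ax)))

module Cubic {D : Set} (_≟_ : DecidableEquality D) (darts : List D)
             (complete : ∀ x → x ∈ darts)
             {V : Set} (_≟ᵥ_ : DecidableEquality V) (vt : D → V)
             (corner : ∀ x → ∃₂ (Corner vt x)) where

  open Linking _≟_ darts complete _≟ᵥ_ vt corner
  open Induction _≟_ darts complete 3 vt

  corner-through : ∀ {d e} → vt e ≡ vt d → e ≢ d → ∃ (Corner vt d e)
  corner-through {d} at e≢d with corner d
  ... | f , g , k with Corner.cover k at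
  ... | inj₁ eq = contradiction eq e≢d
  ... | inj₂ (inj₁ refl) = g , k
  ... | inj₂ (inj₂ refl) = f , corner-swap k

  module _ {σ : Pairing} where

    -- The dead dart leaves at most one further edge at its end, and there are at most two at the
    -- other: three in all.
    insert-beside-dead : ∀ {d e} → Alive σ d → vt e ≡ vt d → ¬ Alive σ e →
                         Connected (Proper (restrict σ (d ∷ []))) → Connected (Proper σ)
    insert-beside-dead {d} {e} ad at dead
      with corner-through at (λ { refl → dead ad }) | corner (partner σ d)
    ... | f , k | g , h , l = insert-few ad ℕₚ.≤-refl
        ((K.x≢z ∘ sym , (λ { refl → loopless σ ad K.at-z }) , inj₁ K.at-z) ∷
         ((λ { refl → loopless σ ad (sym L.at-y) }) , L.x≢y ∘ sym , inj₂ L.at-y) ∷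
         ((λ { refl → loopless σ ad (sym L.at-z) }) , L.x≢z ∘ sym , inj₂ L.at-z) ∷ [])
        cover
      where
      module K = Corner k
      module L = Corner l
      cover : ∀ {c} → Proper (restrict σ (d ∷ [])) c → ∀ y → Near σ [] d y →
              ∃ λ n → n ∈ f ∷ g ∷ h ∷ [] × Alive σ n × c y ≡ c n
      cover _ y (near y≢d y≢σd ay (inj₁ aty)) with K.cover aty
      ... | inj₁ eq = contradiction eq y≢d
      ... | inj₂ (inj₁ refl) = contradiction (proj₁ (restrict-alive σ ay)) dead
      ... | inj₂ (inj₂ refl) = y , here refl , proj₁ (restrict-alive σ ay) , refl
      cover _ y (near y≢d y≢σd ay (inj₂ aty)) with L.cover aty
      ... | inj₁ eq = contradiction eq y≢σd
      ... | inj₂ (inj₁ refl) = y , there (here refl) , proj₁ (restrict-alive σ ay) , refl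
      ... | inj₂ (inj₂ refl) = y , there (there (here refl)) , proj₁ (restrict-alive σ ay) , refl

    -- The parallel edge meets both ends but has a single colour; with one further edge at each end,
    -- three colours are to be avoided.
    insert-parallel : ∀ {d e} → Alive σ d → vt d ≡ vt e → d ≢ e → vt (partner σ d) ≡ vt (partner σ e) →
                      Connected (Proper (restrict σ (d ∷ []))) → Connected (Proper σ)
    insert-parallel {d} {e} ad at d≢e at′
      with corner-through (sym at) (d≢e ∘ sym)
         | corner-through (sym at′) (d≢e ∘ sym ∘ partner-injective σ)
    ... | f , k | g , l = insert-few ad ℕₚ.≤-refl
        ((K.x≢y ∘ sym , (λ { refl → loopless σ ad K.at-y }) , inj₁ K.at-y) ∷
         (K.x≢z ∘ sym , (λ { refl → loopless σ ad K.at-z }) , inj₁ K.at-z) ∷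
         ((λ { refl → loopless σ ad (sym L.at-z) }) , L.x≢z ∘ sym , inj₂ L.at-z) ∷ [])
        cover
      where
      module K = Corner k
      module L = Corner l
      ae : Alive σ e
      ae eq = loopless σ ad (trans at′ (trans (cong vt eq) (sym at)))
      cover : ∀ {c} → Proper (restrict σ (d ∷ [])) c → ∀ y → Near σ [] d y →
              ∃ λ n → n ∈ e ∷ f ∷ g ∷ [] × Alive σ n × c y ≡ c n
      cover _ y (near y≢d y≢σd ay (inj₁ aty)) with K.cover aty
      ... | inj₁ eq = contradiction eq y≢d
      ... | inj₂ (inj₁ refl) = y , here refl , proj₁ (restrict-alive σ ay) , refl
      ... | inj₂ (inj₂ refl) = y , there (here refl) , proj₁ (restrict-alive σ ay) , refl
      cover {c} p y (near y≢d y≢σd ay (inj₂ aty)) with L.cover aty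
      ... | inj₁ eq = contradiction eq y≢σd
      ... | inj₂ (inj₁ refl) = e , here refl , ae ,
        trans (cong c (sym (restrict-partner σ (λ { (here eq) → d≢e (sym eq) }) (λ { (here eq) → y≢d eq }))))
              (match p e)
      ... | inj₂ (inj₂ refl) = y , there (there (here refl)) , proj₁ (restrict-alive σ ay) , refl

    some-edge : Simple σ → ∃ (Alive σ) → Edge σ
    some-edge S (d , ad) =
      let e , f , k = corner d
          g , h , l = corner (partner σ d)
      in record { alive-U₀ = ad ; corner-U = k ; corner-V = l }

  cubic-connected : ∀ σ → Connected (Proper σ)
  cubic-connected σ = go σ (<-wellFounded (size σ))
    where
    go : ∀ σ → Acc _<_ (size σ) → Connected (Proper σ)
    go σ (acc smaller) with search (alive? σ)
    ... | no none = edgeless none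
    ... | yes edge with search (λ d → alive? σ d ×-dec
            search (λ e → (vt e ≟ᵥ vt d) ×-dec ¬? (alive? σ e)))
    ... | yes (d , ad , e , at , dead) =
      insert-beside-dead ad at dead (go _ (smaller (cut-smaller {σ} ad)))
    ... | no full with search (λ d → alive? σ d ×-dec
            search (λ e → (vt d ≟ᵥ vt e) ×-dec (¬? (d ≟ e) ×-dec (vt (partner σ d) ≟ᵥ vt (partner σ e)))))
    ... | yes (d , ad , e , at , d≢e , at′) =
      insert-parallel ad at d≢e at′ (go _ (smaller (cut-smaller {σ} ad)))
    ... | no simple = simple-connected S (λ τ lt → go τ (smaller lt)) (some-edge S edge)
      where
      S : Simple σ
      S = record { full = full′ ; simple = λ ad at d≢e at′ → simple (_ , ad , _ , at , d≢e , at′) }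
        where
        full′ : ∀ {d e} → Alive σ d → vt e ≡ vt d → Alive σ e
        full′ {d} {e} ad at with alive? σ e
        ... | yes ae = ae
        ... | no dead = contradiction (d , ad , e , at , dead) full

-- From graphs to darts

among-two : ∀ {k} {a b p q r : Fin k} → Among a b p → Among a b q → Among a b r → p ≢ q → r ≢ p → r ≡ q
among-two {q = q} {r} ap aq ar p≢q r≢p with r Fin.≟ q
... | yes eq = eq
... | no r≢q = ⊥-elim (no-three ap aq ar p≢q (r≢p ∘ sym) (r≢q ∘ sym))

linked-among : ∀ {k} {a b p q : Fin k} → Linked a b p q → p ≢ q → Among a b p × Among a b q
linked-among (inj₁ eq) p≢q = contradiction eq p≢q
linked-among (inj₂ both) _ = both

-- Every vertex receives Δ darts whatever its degree, and surplus ones stay unpaired. For Δ = 3 this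
-- gives each vertex a `Corner`.
module Darts (n Δ : ℕ) where

  Dart : Set
  Dart = Fin n × Fin Δ

  _≟ᵈ_ : DecidableEquality Dart
  _≟ᵈ_ = ≡-dec Fin._≟_ Fin._≟_

  darts : List Dart
  darts = cartesianProduct (allFin n) (allFin Δ)

  every-dart : ∀ d → d ∈ darts
  every-dart (u , i) = ∈-cartesianProduct⁺ (∈-allFin u) (∈-allFin i)

  vertex : Dart → Fin n
  vertex = proj₁

pairing-connected : ∀ n Δ → Δ ≤ 3 → let open Darts n Δ in
  ∀ σ → Recolouring.Connected _≟ᵈ_ darts every-dart Δ (Pairings.Proper _≟ᵈ_ darts every-dart Δ vertex σ)
pairing-connected n 0 _ = sparse-connected 0 z≤n λ { (_ , ()) }
  where
  open Darts n 0
  open Induction _≟ᵈ_ darts every-dart 0 vertex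
pairing-connected n 1 _ = sparse-connected 0 z≤n λ { (u , zero) → [] ,
    ([] , λ { {_ , zero} refl ne → contradiction refl ne }) , z≤n }
  where
  open Darts n 1
  open Induction _≟ᵈ_ darts every-dart 1 vertex
pairing-connected n 2 _ = sparse-connected 1 ℕₚ.≤-refl λ
  { (u , zero) → (u , suc zero) ∷ [] , (((λ ()) , refl) ∷ [] ,
      λ { {_ , zero} refl ne → contradiction refl ne ; {_ , suc zero} refl _ → here refl }) , ℕₚ.≤-refl
  ; (u , suc zero) → (u , zero) ∷ [] , (((λ ()) , refl) ∷ [] ,
      λ { {_ , zero} refl _ → here refl ; {_ , suc zero} refl ne → contradiction refl ne }) , ℕₚ.≤-refl }
  where
  open Darts n 2
  open Induction _≟ᵈ_ darts every-dart 2 vertex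
pairing-connected n 3 _ = cubic-connected
  where
  open Darts n 3
  corner₀ : ∀ u → Corner vertex (u , zero) (u , suc zero) (u , suc (suc zero))
  corner₀ u = record
    { at-y = refl ; at-z = refl ; x≢y = λ () ; x≢z = λ () ; y≢z = λ ()
    ; cover = λ { {_ , zero} refl → inj₁ refl ; {_ , suc zero} refl → inj₂ (inj₁ refl)
                ; {_ , suc (suc zero)} refl → inj₂ (inj₂ refl) } }
  corner : ∀ d → ∃₂ (Corner vertex d)
  corner (u , zero) = _ , _ , corner₀ u
  corner (u , suc zero) = _ , _ , corner-rotate (corner₀ u)
  corner (u , suc (suc zero)) = _ , _ , corner-rotate (corner-rotate (corner₀ u))
  open Cubic _≟ᵈ_ darts every-dart Fin._≟_ vertex corner
pairing-connected n (suc (suc (suc (suc _)))) (s≤s (s≤s (s≤s ())))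

length-filter-T : ∀ {A : Set} (f : A → Bool) xs →
                  length (filter (λ v → T? (f v)) xs) ≡ sum (map (λ v → if f v then 1 else 0) xs)
length-filter-T f [] = refl
length-filter-T f (x ∷ xs) with f x
... | true = cong suc (length-filter-T f xs)
... | false = length-filter-T f xs

∈⇒≤foldr-⊔ : ∀ {x xs} → x ∈ xs → x ≤ foldr _⊔_ 0 xs
∈⇒≤foldr-⊔ (here refl) = ℕₚ.m≤m⊔n _ _
∈⇒≤foldr-⊔ {xs = y ∷ ys} (there x∈) = ℕₚ.≤-trans (∈⇒≤foldr-⊔ x∈) (ℕₚ.m≤n⊔m y _)

-- Kempe changes from exchanges of two colours

module KempeSteps (G : Graph) {k : ℕ} where
  open Graph G

  Differ : (c d : EdgeColouring G k) (u v : Fin n) → Adj G u v → Set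
  Differ c d u v e = col c u v e ≢ col d u v e

  module Component (c d : EdgeColouring G k) {a b : Fin k}
                   (linked : ∀ u v e → Linked a b (col c u v e) (col d u v e))
                   {x v₀ : Fin n} {e₀ : Adj G x v₀} (differ₀ : Differ c d x v₀ e₀) where

    Joined : Fin n → Fin n → Set
    Joined u v = Σ (Adj G u v) (IsAB G c a b u v)

    joined? : Decidable Joined
    joined? u v with T? (adj u v)
    ... | no ¬e = no (¬e ∘ proj₁)
    ... | yes e = map′ (e ,_) (λ { (e′ , ab) → subst (IsAB G c a b u v) (T-irrelevant e′ e) ab })
                      (among? a b (col c u v e))

    open Reachability Fin._≟_ (allFin n) ∈-allFin joined? using (star?)

    walk⇒reach : ∀ {u v} → Reach G c a b x u → Star Joined u v → Reach G c a b x v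
    walk⇒reach r ε = r
    walk⇒reach r ((e , ab) ◅ w) = walk⇒reach (step r e ab) w

    reach⇒walk : ∀ {u} → Reach G c a b x u → Star Joined x u
    reach⇒walk here = ε
    reach⇒walk (step r e ab) = reach⇒walk r ◅◅ ((e , ab) ◅ ε)

    inComp? : ∀ u v e → Dec (InComp G c a b x u v e)
    inComp? u v e = among? a b (col c u v e) ×-dec map′ (walk⇒reach here) reach⇒walk (star? x u)

    -- An edge at `u` that changes takes the other colour of the pair. A second edge at `u` coloured
    -- from the pair has just that colour in `c`, so properness of `d` forces it to change too.
    -- Hence changes fill whole components.
    differ-spreads : ∀ {u v w e f} → Differ c d u v e → IsAB G c a b u w f → Differ c d u w f
    differ-spreads {u} {v} {w} {e} {f} differ ab same with v Fin.≟ w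
    ... | yes refl = differ (subst (λ e → col c u v e ≡ col d u v e) (T-irrelevant f e) same)
    ... | no v≢w =
      let ac , ad = linked-among (linked u v e) differ
      in proper d u v w e f v≢w (trans (among-two ac ab ad (proper c u v w e f v≢w) (differ ∘ sym)) same)

    differ-reached : ∀ {u} → Reach G c a b x u → ∀ {v e} → IsAB G c a b u v e → Differ c d u v e
    differ-reached here ab = differ-spreads differ₀ ab
    differ-reached (step {u} {v} r e ab) ab′ = differ-spreads
      (λ same → differ-reached r ab (trans (sym (col-sym c u v e)) (trans same (col-sym d u v e)))) ab′

    reverse-in : ∀ {u v e} → InComp G c a b x u v e → InComp G c a b x v u (adj-sym G e)
    reverse-in {u} {v} {e} (ab , r) = subst (Among a b) (sym (col-sym c u v e)) ab , step r e ab

    switched : (u v : Fin n) → Adj G u v → Fin k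
    switched u v e with inComp? u v e
    ... | yes _ = col d u v e
    ... | no _ = col c u v e

    switched-in : ∀ {u v e} → InComp G c a b x u v e → switched u v e ≡ col d u v e
    switched-in {u} {v} {e} p with inComp? u v e
    ... | yes _ = refl
    ... | no ¬p = contradiction p ¬p

    switched-out : ∀ {u v e} → ¬ InComp G c a b x u v e → switched u v e ≡ col c u v e
    switched-out {u} {v} {e} ¬p with inComp? u v e
    ... | yes p = contradiction p ¬p
    ... | no _ = refl

    in-differ : ∀ {u v e} → InComp G c a b x u v e → Differ c d u v e
    in-differ (ab , r) = differ-reached r ab

    result : EdgeColouring G k
    result = record { col = switched ; col-sym = sym′ ; proper = proper′ }
      where
      sym′ : ∀ u v e → switched v u (adj-sym G e) ≡ switched u v e
      sym′ u v e with inComp? u v e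
      ... | yes p = trans (switched-in (reverse-in p)) (col-sym d u v e)
      ... | no ¬p = trans (switched-out λ q → ¬p (subst (InComp G c a b x u v) (T-irrelevant _ e) (reverse-in q)))
                          (col-sym c u v e)
      mixed : ∀ {u v w e f} → InComp G c a b x u v e → ¬ InComp G c a b x u w f → col d u v e ≢ col c u w f
      mixed {u} {v} {w} {e} {f} p@(_ , r) ¬q eq =
        ¬q (subst (Among a b) eq (proj₂ (linked-among (linked u v e) (in-differ p))) , r)
      proper′ : ∀ u v w e f → v ≢ w → switched u v e ≢ switched u w f
      proper′ u v w e f v≢w eq with inComp? u v e | inComp? u w f
      ... | yes _ | yes _ = proper d u v w e f v≢w eq
      ... | yes p | no ¬q = mixed p ¬q eq
      ... | no ¬p | yes q = mixed q ¬p (sym eq)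
      ... | no _ | no _ = proper c u v w e f v≢w eq

    swap-among : ∀ {p q} → Among a b p → Among a b q → p ≢ q → swap G a b p ≡ q
    swap-among {p} ap aq p≢q with p Fin.≟ a
    swap-among _ (inj₁ q≡a) p≢q | yes p≡a = contradiction (trans p≡a (sym q≡a)) p≢q
    swap-among _ (inj₂ q≡b) _ | yes _ = sym q≡b
    swap-among {p} ap aq p≢q | no p≢a with p Fin.≟ b
    swap-among _ (inj₁ q≡a) _ | no _ | yes _ = sym q≡a
    swap-among _ (inj₂ q≡b) p≢q | no _ | yes p≡b = contradiction (trans p≡b (sym q≡b)) p≢q
    swap-among ap _ _ | no p≢a | no p≢b = contradiction ap [ p≢a , p≢b ]′

    change : KempeChange G c result
    change = a , b , x , λ u v e →
      (λ p → let ac , ad = linked-among (linked u v e) (in-differ p)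
             in trans (switched-in p) (sym (swap-among ac ad (in-differ p)))) ,
      switched-out

    still-linked : ∀ u v e → Linked a b (switched u v e) (col d u v e)
    still-linked u v e with inComp? u v e
    ... | yes _ = inj₁ refl
    ... | no _ = linked u v e

    agrees-at-x : ∀ v e → switched x v e ≡ col d x v e
    agrees-at-x v e with inComp? x v e
    ... | yes _ = refl
    ... | no ¬p = sym (linked-other (linked-sym (linked x v e)) λ ab → ¬p (ab , here))

    keeps-agreement : ∀ {u} → (∀ v e → col c u v e ≡ col d u v e) →
                      ∀ v e → switched u v e ≡ col d u v e
    keeps-agreement {u} agree v e with inComp? u v e
    ... | yes _ = refl
    ... | no _ = agree v e

  differ-at? : ∀ c d u → Dec (∃ λ v → Σ (Adj G u v) (Differ c d u v))
  differ-at? c d u = Finₚ.any? at?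
    where
    at? : ∀ v → Dec (Σ (Adj G u v) (Differ c d u v))
    at? v with T? (adj u v)
    ... | no ¬e = no (¬e ∘ proj₁)
    ... | yes e = map′ (e ,_) (λ { (e′ , ne) → subst (Differ c d u v) (T-irrelevant e′ e) ne })
                      (¬? (col c u v e Fin.≟ col d u v e))

  _≈_ : EdgeColouring G k → EdgeColouring G k → Set
  c ≈ d = ∀ u v e → col c u v e ≡ col d u v e

  -- Component by component: every vertex in turn has the components through it switched.
  linked⇒kempe : ∀ {c d a b} → (∀ u v e → Linked a b (col c u v e) (col d u v e)) →
                 ∃ λ c′ → Star (KempeChange G) c c′ × c′ ≈ d
  linked⇒kempe {c} {d} {a} {b} linked = go (allFin n) c linked (λ u → inj₁ (∈-allFin u))
    where
    go : ∀ us c → (∀ u v e → Linked a b (col c u v e) (col d u v e)) →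
         (∀ u → u ∈ us ⊎ (∀ v e → col c u v e ≡ col d u v e)) →
         ∃ λ c′ → Star (KempeChange G) c c′ × c′ ≈ d
    go [] c linked rest = c , ε , λ u → [ (λ ()) , id ]′ (rest u)
    go (x ∷ us) c linked rest with differ-at? c d x
    ... | no none = go us c linked rest′
      where
      agree : ∀ v e → col c x v e ≡ col d x v e
      agree v e with col c x v e Fin.≟ col d x v e
      ... | yes eq = eq
      ... | no ne = contradiction (v , e , ne) none
      rest′ : ∀ u → u ∈ us ⊎ (∀ v e → col c u v e ≡ col d u v e)
      rest′ u with rest u
      ... | inj₁ (here refl) = inj₂ agree
      ... | inj₁ (there u∈) = inj₁ u∈
      ... | inj₂ done = inj₂ done
    ... | yes (v₀ , e₀ , ne) =
      let c′ , path , eq = go us result still-linked rest′ in c′ , change ◅ path , eq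
      where
      open Component c d linked ne
      rest′ : ∀ u → u ∈ us ⊎ (∀ v e → switched u v e ≡ col d u v e)
      rest′ u with rest u
      ... | inj₁ (here refl) = inj₂ agrees-at-x
      ... | inj₁ (there u∈) = inj₁ u∈
      ... | inj₂ done = inj₂ (keeps-agreement done)

-- Simple graphs as pairings

module Translation (G : Graph) (Δ : ℕ) (bounded : ∀ u → degree G u ≤ Δ) where
  open Graph G
  open Darts n Δ
  open Recolouring _≟ᵈ_ darts every-dart Δ
  open Pairings _≟ᵈ_ darts every-dart Δ vertex
  open KempeSteps G {suc Δ}

  neighbours : Fin n → List (Fin n)
  neighbours u = filter (λ v → T? (adj u v)) (allFin n)

  position : ∀ {u v} → Adj G u v → v ∈ neighbours u
  position {u} {v} e = ∈-filter⁺ (λ v → T? (adj u v)) (∈-allFin v) e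

  few : ∀ u → length (neighbours u) ≤ Δ
  few u = ℕₚ.≤-trans (ℕₚ.≤-reflexive (length-filter-T (adj u) (allFin n))) (bounded u)

  -- The position of `v` in the neighbour list of `u` names the half-edge at `u`; the degree bound
  -- makes it fit among the Δ darts there.
  slot : ∀ u v → Adj G u v → Fin Δ
  slot u v e = inject≤ (Any.index (position e)) (few u)

  slot-injective : ∀ {u v w e f} → slot u v e ≡ slot u w f → v ≡ w
  slot-injective {u} {e = e} {f} eq =
    index-injective (setoid _) (position e) (position f) (Finₚ.inject≤-injective (few u) (few u) _ _ eq)

  slot-irrelevant : ∀ {u v} e f → slot u v e ≡ slot u v f
  slot-irrelevant {u} {v} e f = cong (slot u v) (T-irrelevant e f)

  Occupied : Dart → Set
  Occupied (u , i) = ∃ λ v → Σ (Adj G u v) λ e → slot u v e ≡ i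

  occupied? : ∀ d → Dec (Occupied d)
  occupied? (u , i) = Finₚ.any? at?
    where
    at? : ∀ v → Dec (Σ (Adj G u v) λ e → slot u v e ≡ i)
    at? v with T? (adj u v)
    ... | no ¬e = no (¬e ∘ proj₁)
    ... | yes e = map′ (e ,_) (λ { (e′ , eq) → trans (slot-irrelevant e e′) eq }) (slot u v e Fin.≟ i)

  partner′ : Dart → Dart
  partner′ d with occupied? d
  ... | yes (v , e , _) = v , slot v (proj₁ d) (adj-sym G e)
  ... | no _ = d

  partner-slot : ∀ u v e → partner′ (u , slot u v e) ≡ (v , slot v u (adj-sym G e))
  partner-slot u v e with occupied? (u , slot u v e)
  ... | no none = contradiction (v , e , refl) none
  ... | yes (w , f , eq) with slot-injective eq
  ... | refl = cong (v ,_) (slot-irrelevant _ _)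

  partner-free : ∀ {d} → ¬ Occupied d → partner′ d ≡ d
  partner-free {d} ¬o with occupied? d
  ... | yes o = contradiction o ¬o
  ... | no _ = refl

  adj-≢ : ∀ {u v} → Adj G u v → v ≢ u
  adj-≢ {u} e refl = subst T (irrefl u) e

  σ : Pairing
  σ = record { partner = partner′ ; involutive = inv ; loopless = λ {d} → loop d }
    where
    inv : ∀ d → partner′ (partner′ d) ≡ d
    inv (u , i) with occupied? (u , i)
    ... | no ¬o = partner-free ¬o
    ... | yes (v , e , refl) = trans (partner-slot v u (adj-sym G e)) (cong (u ,_) (slot-irrelevant _ _))
    loop : ∀ d → partner′ d ≢ d → proj₁ (partner′ d) ≢ proj₁ d
    loop d ne with occupied? d
    ... | no _ = contradiction refl ne
    ... | yes (v , e , _) = adj-≢ e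

  alive-occupied : ∀ {d} → Alive σ d → Occupied d
  alive-occupied {d} a with occupied? d
  ... | yes o = o
  ... | no _ = contradiction refl a

  alive-slot : ∀ u v e → Alive σ (u , slot u v e)
  alive-slot u v e eq = adj-≢ e (cong proj₁ (trans (sym (partner-slot u v e)) eq))

  assignment : EdgeColouring G (suc Δ) → Assignment
  assignment c (u , i) with occupied? (u , i)
  ... | yes (v , e , _) = col c u v e
  -- Unpaired darts are unconstrained, so `zero` is an arbitrary default.
  ... | no _ = zero

  assignment-slot : ∀ c u v e → assignment c (u , slot u v e) ≡ col c u v e
  assignment-slot c u v e with occupied? (u , slot u v e)
  ... | no none = contradiction (v , e , refl) none
  ... | yes (w , f , eq) with slot-injective eq
  ... | refl = cong (col c u v) (T-irrelevant f e)

  assignment-proper : ∀ c → Proper σ (assignment c)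
  assignment-proper c = record { match = match′ ; clash = clash′ }
    where
    match′ : ∀ d → assignment c (partner′ d) ≡ assignment c d
    match′ (u , i) with occupied? (u , i) in eq
    ... | no ¬o rewrite eq = refl
    ... | yes (v , e , _) = trans (assignment-slot c v u (adj-sym G e)) (col-sym c u v e)
    clash′ : ∀ {d d′} → Alive σ d → Alive σ d′ → d ≢ d′ → proj₁ d ≡ proj₁ d′ → assignment c d ≢ assignment c d′
    clash′ {u , i} {_ , j} a a′ d≢d′ refl eq with alive-occupied a | alive-occupied a′
    ... | v , e , refl | w , f , refl =
      proper c u v w e f (λ { refl → d≢d′ (cong (u ,_) (slot-irrelevant e f)) })
        (trans (sym (assignment-slot c u v e)) (trans eq (assignment-slot c u w f)))

  colouring : ∀ f → Proper σ f → EdgeColouring G (suc Δ)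
  colouring f p = record
    { col = λ u v e → f (u , slot u v e)
    ; col-sym = λ u v e → trans (cong f (sym (partner-slot u v e))) (match p (u , slot u v e))
    ; proper = λ u v w e e′ v≢w → clash p (alive-slot u v e) (alive-slot u w e′)
                 (v≢w ∘ slot-injective ∘ cong proj₂) refl }

  -- Kempe changes reach a colouring only up to equality of all its colours, so the invariant
  -- carried along is pointwise agreement, not an equation between records.
  follow : ∀ {f g c} → Kempe (Proper σ) f g → (∀ u v e → col c u v e ≡ f (u , slot u v e)) →
           ∃ λ d → Star (KempeChange G) c d × (∀ u v e → col d u v e ≡ g (u , slot u v e))
  follow {c = c} ε same = c , ε , same
  follow {c = c} (_◅_ {j = h} (_ , q , a , b , linked) rest) same =
    let c′ , path , same′ = linked⇒kempe {c} {colouring h q}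
          λ u v e → subst (λ k → Linked a b k (h (u , slot u v e))) (sym (same u v e)) (linked _)
        d , path′ , same″ = follow rest same′
    in d , path ◅◅ path′ , same″

  kempe-equivalent : Δ ≤ 3 → ∀ c c′ → KempeEquivalent G c c′
  kempe-equivalent Δ≤3 c c′ =
    let kempe = proj₂ (pairing-connected n Δ Δ≤3 σ) (assignment c) (assignment c′)
                  (assignment-proper c) (assignment-proper c′)
        d , path , same = follow {c = c} kempe λ u v e → sym (assignment-slot c u v e)
    -- The path reaches the colours of `c′` themselves, so the identity permutation serves.
    in idₚ , d , path , λ u v e → trans (same u v e) (assignment-slot c′ u v e)

theorem3 : (G : Graph) → maxDegree G ≤ 3 →
    (c c' : EdgeColouring G (suc (maxDegree G))) → KempeEquivalent G c c'
theorem3 G Δ≤3 = Translation.kempe-equivalent G (maxDegree G)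
  (λ u → ∈⇒≤foldr-⊔ (∈-map⁺ (degree G) (∈-allFin u))) Δ≤3
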